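{- Let $q$ and $c$ be complex numbers with $|q|<1$ and $|cq|<1$. For each non-negative integer $m$ define \[ M_{m,c} = \sum_{n=1}^{\infty} n^m c^n q^n (q^{n+1};q)_\infty, \qquad K_{m+1,c} = \sum_{n=1}^{\infty} \sigma_{m,c}(n) q^n, \] where $\sigma_{m,c}(n) = \sum_{d\mid n} d^m c^d$. Then, as an identity of formal power series in $t$ (equivalently, for all complex $t$ in a neighbourhood of $0$), \[ \frac{(q;q)_\infty}{(cq;q)_\infty} \exp\Bigl(\sum_{m=1}^{\infty} K_{m,c} \frac{t^m}{m!}\Bigr) = \frac{(q;q)_\infty}{(cq;q)_\infty} + \sum_{m=1}^{\infty} M_{m,c} \frac{t^m}{m!}, \] and for every integer $m\ge 1$, \[ M_{m,c} = \frac{(q;q)_\infty}{(cq;q)_\infty}\, Y_m(K_{1,c}, K_{2,c}, \dots, K_{m,c}), \] where $Y_m$ is the Bell polynomial \[ Y_m(u_1,\dots,u_m) = \sum \frac{m!}{k_1!\cdots k_m!}\Bigl(\frac{u_1}{1!}\Bigr)^{k_1}\cdots \Bigl(\frac{u_m}{m!}\Bigr)^{k_m}, \] the sum being over all tuples $(k_1,\dots,k_m)$ of non-negative integers with $k_1 + 2k_2 + \cdots + m k_m = m$.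
   Context: For complex $a$ and $|q|<1$, $(a;q)_\infty = \prod_{j=0}^{\infty}(1-aq^j)$; thus $(q^{n+1};q)_\infty=\prod_{j\ge n+1}(1-q^j)$. The sum $\sum_{d\mid n}$ runs over positive divisors $d$ of $n$. -}

module Defs where

open import Algebra.Apartness.Bundles using (HeytingField)
open import Algebra.Bundles.Raw using (RawRing)
import Algebra.Definitions.RawSemiring as RawSemiringDefs
open import Data.Fin.Base using (toℕ)
open import Data.List.Base as List using (List; []; _∷_; applyUpTo; upTo; filter; cartesianProductWith)
open import Data.Nat.Base as ℕ using (ℕ; zero; suc; NonZero; _!)
open import Data.Nat.Divisibility using (_∣?_)
open import Data.Nat.Properties using (_!≢0) renaming (_≟_ to _≟ℕ_)
open import Data.Product.Base using (∃-syntax; _×_; _,_; proj₁; proj₂)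
open import Data.Sum.Base using (_⊎_; inj₂)
open import Data.Vec.Functional as Vector using (Vector)
open import Function.Bundles using (_⇔_; Equivalence)
open import Level using (_⊔_) renaming (suc to lsuc)
open import Relation.Binary.Core using (Rel)
open import Relation.Binary.Structures using (IsStrictPartialOrder)

-- Cotransitivity of _<_ and tightness are inherited from the apartness relation
-- of the Heyting field through #⇔<>.

record OrderedField c ℓ₁ ℓ₂ : Set (lsuc (c ⊔ ℓ₁ ⊔ ℓ₂)) where
  field
    heytingField : HeytingField c ℓ₁ ℓ₂

  open HeytingField heytingField public

  infix 4 _<_ _⟶_
  field
    _<_                  : Rel Carrier ℓ₂
    isStrictPartialOrder : IsStrictPartialOrder _≈_ _<_
    #⇔<>                 : ∀ {x y} → x # y ⇔ (x < y ⊎ y < x)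
    0<1                  : 0# < 1#
    +-monoˡ-<            : ∀ {x y} z → x < y → x + z < y + z
    *-pos                : ∀ {x y} → 0# < x → 0# < y → 0# < x * y

  open IsStrictPartialOrder isStrictPartialOrder public
    using (<-resp-≈; <-respʳ-≈; <-respˡ-≈)
    renaming (irrefl to <-irrefl; trans to <-trans)

  -- This is 1/x: the stdlib inverts the difference x - 0#.
  recip : ∀ x → 0# < x → Carrier
  recip x 0<x = proj₁ (#⇒invertible (Equivalence.from #⇔<> (inj₂ 0<x)))

  fromℕ : ℕ → Carrier
  fromℕ zero    = 0#
  fromℕ (suc n) = 1# + fromℕ n

  fromℕ-pos : ∀ n → 0# < fromℕ (suc n)
  fromℕ-pos zero    = <-respʳ-≈ (sym (+-identityʳ 1#)) 0<1
  fromℕ-pos (suc n) = <-trans (fromℕ-pos n)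
    (<-respˡ-≈ (+-identityˡ (fromℕ (suc n))) (+-monoˡ-< (fromℕ (suc n)) 0<1))

  -- m and n vary independently, so this bounds the absolute value of s m - s n.
  Cauchy : (ℕ → Carrier) → Set (c ⊔ ℓ₂)
  Cauchy s = ∀ ε → 0# < ε → ∃[ N ] (∀ m n → N ℕ.≤ m → N ℕ.≤ n → s m - s n < ε)

  _⟶_ : (ℕ → Carrier) → Carrier → Set (c ⊔ ℓ₂)
  s ⟶ l = ∀ ε → 0# < ε → ∃[ N ] (∀ n → N ℕ.≤ n → (s n - l < ε) × (l - s n < ε))

-- The real numbers, specified (uniquely up to isomorphism) as a Cauchy-complete
-- Archimedean ordered field.

record Reals c ℓ₁ ℓ₂ : Set (lsuc (c ⊔ ℓ₁ ⊔ ℓ₂)) where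
  field
    orderedField : OrderedField c ℓ₁ ℓ₂

  open OrderedField orderedField public

  field
    archimedean : ∀ x → ∃[ n ] (x < fromℕ n)
    complete    : ∀ s → Cauchy s → ∃[ l ] (s ⟶ l)

module Complex {a ℓ₁ ℓ₂} (ℝ : Reals a ℓ₁ ℓ₂) where

  private module ℝ = Reals ℝ

  infix 4 _≈_ _≋_ _⟶_ ∣_∣<_

  record ℂ : Set a where
    constructor _+i_
    field
      re im : ℝ.Carrier

  open ℂ public

  _≈_ : Rel ℂ ℓ₁
  z ≈ w = (re z ℝ.≈ re w) × (im z ℝ.≈ im w)

  ι : ℝ.Carrier → ℂ
  ι x = x +i ℝ.0#

  ℂ-rawRing : RawRing a ℓ₁
  ℂ-rawRing = record
    { Carrier = ℂ
    ; _≈_     = _≈_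
    ; _+_     = λ z w → (re z ℝ.+ re w) +i (im z ℝ.+ im w)
    ; _*_     = λ z w → (re z ℝ.* re w ℝ.- im z ℝ.* im w) +i (re z ℝ.* im w ℝ.+ im z ℝ.* re w)
    ; -_      = λ z → (ℝ.- re z) +i (ℝ.- im z)
    ; 0#      = ι ℝ.0#
    ; 1#      = ι ℝ.1#
    }

  open RawRing ℂ-rawRing public using (_+_; _*_; -_; 0#; 1#; rawSemiring)
  open RawSemiringDefs rawSemiring public using (_^_; product)

  infixl 6 _-_
  _-_ : ℂ → ℂ → ℂ
  z - w = z + (- w)

  normSq : ℂ → ℝ.Carrier
  normSq z = re z ℝ.* re z ℝ.+ im z ℝ.* im z

  -- ∣z∣ < r with the square root cleared; only meaningful for r ≥ 0.
  ∣_∣<_ : ℂ → ℝ.Carrier → Set ℓ₂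
  ∣ z ∣< r = normSq z ℝ.< r ℝ.* r

  -- The constructive form of z ≠ 0.
  NonZeroℂ : ℂ → Set ℓ₂
  NonZeroℂ z = ℝ.0# ℝ.< normSq z

  _/_[_] : ℂ → (w : ℂ) → NonZeroℂ w → ℂ
  z / w [ w≠0 ] = z * ((re w ℝ.* r) +i (ℝ.- (im w ℝ.* r)))
    where r = ℝ.recip (normSq w) w≠0

  fromℕ : ℕ → ℂ
  fromℕ n = ι (ℝ.fromℕ n)

  1/ℕ : ∀ n → .{{NonZero n}} → ℂ
  1/ℕ (suc n) = ι (ℝ.recip (ℝ.fromℕ (suc n)) (ℝ.fromℕ-pos n))

  1/_! : ℕ → ℂ
  1/ n ! = 1/ℕ (n !) {{n !≢0}}

  Σ< : ℕ → (ℕ → ℂ) → ℂ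
  Σ< zero    f = 0#
  Σ< (suc N) f = Σ< N f + f N

  Π< : ℕ → (ℕ → ℂ) → ℂ
  Π< zero    f = 1#
  Π< (suc N) f = Π< N f * f N

  Σ∈ : ∀ {b} {B : Set b} → List B → (B → ℂ) → ℂ
  Σ∈ xs f = List.foldr (λ x s → f x + s) 0# xs

  _⟶_ : (ℕ → ℂ) → ℂ → Set (a ⊔ ℓ₂)
  s ⟶ l = ∀ ε → ℝ.0# ℝ.< ε → ∃[ N ] (∀ n → N ℕ.≤ n → ∣ s n - l ∣< ε)

  -- Σ_{n=1}^∞ f n = l; the value f 0 is ignored.
  Sum≥1 : (ℕ → ℂ) → ℂ → Set (a ⊔ ℓ₂)
  Sum≥1 f l = (λ N → Σ< N (λ n → f (suc n))) ⟶ l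

  -- (x;q)_∞ = l
  Pochhammer∞ : ℂ → ℂ → ℂ → Set (a ⊔ ℓ₂)
  Pochhammer∞ x q l = (λ N → Π< N (λ j → 1# - x * q ^ j)) ⟶ l

  divisors : ℕ → List ℕ
  divisors n = filter (_∣? n) (applyUpTo suc n)

  σ : ℕ → ℂ → ℕ → ℂ
  σ m c n = Σ∈ (divisors n) (λ d → fromℕ (d ℕ.^ m) * c ^ d)

  -- The values of all infinite products and series occurring in the theorem:
  -- an inhabitant says that each of them converges, and to what.
  record Values (q c : ℂ) : Set (a ⊔ ℓ₂) where
    field
      [q]∞     : ℂ
      [cq]∞    : ℂ
      [q^1+_]∞ : ℕ → ℂ
      M        : ℕ → ℂ
      K        : ℕ → ℂ      -- K 0 is unconstrained and never used

      [q]∞-value   : Pochhammer∞ q q [q]∞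
      [cq]∞-value  : Pochhammer∞ (c * q) q [cq]∞
      [cq]∞-nonzero : NonZeroℂ [cq]∞
      [q^1+]∞-value : ∀ n → Pochhammer∞ (q ^ suc n) q [q^1+ n ]∞
      M-value      : ∀ m → Sum≥1 (λ n → fromℕ (n ℕ.^ m) * c ^ n * q ^ n * [q^1+ n ]∞) (M m)
      K-value      : ∀ m → Sum≥1 (λ n → σ m c n * q ^ n) (K (suc m))

    ratio : ℂ
    ratio = [q]∞ / [cq]∞ [ [cq]∞-nonzero ]

  -- Formal power series in t, as coefficient sequences.

  FPS : Set a
  FPS = ℕ → ℂ

  _≋_ : FPS → FPS → Set ℓ₁
  f ≋ g = ∀ n → f n ≈ g n

  constant : ℂ → FPS
  constant z zero    = z
  constant z (suc n) = 0#

  infixl 6 _⊕_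
  infixl 7 _⊛_

  _⊕_ : FPS → FPS → FPS
  (f ⊕ g) n = f n + g n

  _⊛_ : FPS → FPS → FPS
  (f ⊛ g) n = Σ< (suc n) (λ i → f i * g (n ℕ.∸ i))

  power : FPS → ℕ → FPS
  power f zero    = constant 1#
  power f (suc k) = f ⊛ power f k

  -- Σ_k f^k / k!, for f without constant term: then f^k has no term of degree
  -- below k, so only k ≤ n contribute to the coefficient of t^n.
  exp : FPS → FPS
  exp f n = Σ< (suc n) (λ k → power f k n * 1/ k !)

  -- Σ_{m≥1} u_m t^m / m!
  egf≥1 : (ℕ → ℂ) → FPS
  egf≥1 u zero    = 0#
  egf≥1 u (suc m) = u (suc m) * 1/ suc m !

  boundedTuples : ∀ m → ℕ → List (Vector ℕ m)
  boundedTuples zero    b = Vector.[] ∷ []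
  boundedTuples (suc m) b = cartesianProductWith Vector._∷_ (upTo (suc b)) (boundedTuples m b)

  -- Component i : Fin m of a tuple is the one written with subscript i + 1.
  weight : ∀ {m} → Vector ℕ m → ℕ
  weight k = Vector.foldr ℕ._+_ 0 (λ i → suc (toℕ i) ℕ.* k i)

  -- k₁ + 2k₂ + ⋯ + mkₘ = m forces every kᵢ ≤ m.
  bellTuples : ∀ m → List (Vector ℕ m)
  bellTuples m = filter (λ k → weight k ≟ℕ m) (boundedTuples m m)

  Y : ∀ m → Vector ℂ m → ℂ
  Y m u = Σ∈ (bellTuples m) (λ k →
    fromℕ (m !) * product (λ i → 1/ k i !) * product (λ i → (u i * 1/ suc (toℕ i) !) ^ k i))

{-# OPTIONS --safe #-}

-- Let x = cq, h_n = 1/(q;q)_n and w_k = 1/(1 - qᵏ). Since (q^{n+1};q)_∞ = (q;q)_∞ h_n, for m ≥ 1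
-- M_m is (q;q)_∞ times the moment B_m = Σ nᵐ h_n xⁿ, while expanding the Lambert series gives
-- K_{m+1} = P_m = Σ kᵐ w_k xᵏ. Newton's identity n h_n = Σ_{k≥1} w_k h_{n-k}, summed against nᵐ
-- with a Cauchy product, becomes B_{m+1} = Σ_i (m choose i) P_i B_{m-i}; so the exponential
-- generating function G of the B_m satisfies t G′ = t f′ G with f = Σ K_m tᵐ/m!, whence
-- G = B_0 exp f. Euler's functional equation (1 - x) Σ h_n xⁿ = Σ h_n (qx)ⁿ, iterated, gives
-- (x;q)_∞ B_0 = 1, hence also that (x;q)_∞ does not vanish. The Bell sum is the coefficient of tᵐ in
-- Π_i exp(f_i tⁱ), which satisfies the same differential equation up to degree m.

module Submission where

open import Defs
import Algebra.Definitions.RawSemiring as RawSemiringDefs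
import Algebra.Properties.AbelianGroup as AbelianGroupProperties
import Algebra.Properties.CommutativeSemiring.Exp as CommutativeExp
import Algebra.Properties.Ring as RingProperties
import Algebra.Properties.Semiring.Exp as Exp
import Algebra.Properties.Semiring.Mult as Multiples
import Algebra.Properties.Semiring.Mult.TCOptimised as OptimisedMultiples
import Algebra.Solver.Ring as RingSolver
open import Algebra.Apartness.Bundles using (HeytingCommutativeRing)
open import Algebra.Bundles using (CommutativeRing; RawRing; Semiring)
open import Algebra.Solver.Ring.AlmostCommutativeRing using (fromCommutativeRing; _-Raw-AlmostCommutative⟶_)
open import Data.Bool.Base using (true; false; if_then_else_)
open import Data.Empty using (⊥-elim)
open import Data.Fin.Base as Fin using (toℕ)
open import Data.List.Base as List using (List; []; _∷_; _++_; applyUpTo; upTo; filter; cartesianProductWith)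
open import Data.Maybe.Base using (Maybe; just; nothing)
open import Data.Nat.Base as ℕ using (ℕ; zero; suc; z≤n; s≤s; _!; NonZero)
open import Data.Nat.Divisibility using (_∣_; _∣?_; _∣0; ∣m+n∣m⇒∣n; ∣m∣n⇒∣m+n; ∣-refl; ∣⇒≤)
import Data.Nat.Properties as ℕₚ
open import Data.Product.Base using (_×_; _,_; ∃-syntax; proj₁; proj₂)
open import Data.Sum.Base using (_⊎_; inj₁; inj₂)
open import Data.Vec.Functional as Vector using (Vector)
open import Function.Bundles using (Equivalence)
open import Level using (_⊔_) renaming (suc to lsuc)
open import Relation.Binary.Core using (Rel)
open import Relation.Binary.PropositionalEquality.Core as ≡ using (_≡_)
import Relation.Binary.Reasoning.Base.Triple as TripleReasoning
import Relation.Binary.Reasoning.Setoid as SetoidReasoning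
open import Relation.Binary.Structures using (IsPreorder)
open import Relation.Nullary.Decidable.Core using (yes; no; does; _because_)
open import Relation.Nullary.Negation.Core using (¬_)
open import Relation.Unary using (Pred; Decidable)

-- The order on the reals is not assumed decidable, and this shapes the analysis. No proof may
-- decide between `x ≤ y` and `y ≤ x` or pick a maximum by cases, so every infinite process is
-- controlled by an explicit bound `C · rⁿ` with 0 < r < 1, and polynomial factors are paid for by
-- moving r closer to 1. Interchanges of summation are reduced to exact finite identities whose
-- remainder is estimated in this way. Likewise the non-vanishing of (cq;q)_∞ comes from an
-- exhibited inverse, not from excluding zero. Only cq is assumed small, so c itself may be large:
-- each cᵈ has to stay paired with a qᵈ, which dictates how the tails of the Lambert series are
-- written. The restriction m ≥ 1 is genuine. The sum M_0 starts at n = 1 and misses the term n = 0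
-- of B_0, whereas for m ≥ 1 that term carries 0ᵐ = 0. The identities are claimed for arbitrary
-- values of the series; they transfer from the constructed values by uniqueness of limits.

-- A ring solver with integer coefficients, so that cancellation is visible to it.
-- The pair (a , b) represents a - b; one component of a normal pair is 0.
module IntegerSolver {c ℓ} (R : CommutativeRing c ℓ) where
  open CommutativeRing R
  open RingProperties ring
  open AbelianGroupProperties +-abelianGroup using (⁻¹-∙-comm)
  open SetoidReasoning setoid
  private module M = OptimisedMultiples semiring

  nat : ℕ → Carrier
  nat n = n M.× 1#

  normal : ℕ → ℕ → ℕ × ℕ
  normal (suc a) (suc b) = normal a b
  normal a       b       = a , b

  coefficients : RawRing _ _
  coefficients = record
    { Carrier = ℕ × ℕ
    ; _≈_     = _≡_
    ; _+_     = λ (a , b) (c , d) → normal (a ℕ.+ c) (b ℕ.+ d)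
    ; _*_     = λ (a , b) (c , d) → normal (a ℕ.* c ℕ.+ b ℕ.* d) (a ℕ.* d ℕ.+ b ℕ.* c)
    ; -_      = λ (a , b) → b , a
    ; 0#      = 0 , 0
    ; 1#      = 1 , 0
    }

  -- The case `b = 0` omits the subtraction so that `con (0 , 0)` and `con (1 , 0)` denote `0#` and
  -- `1#` definitionally; goals that mention these constants are then solved with `refl`.
  ⟦_⟧ : ℕ × ℕ → Carrier
  ⟦ a , zero  ⟧ = nat a
  ⟦ a , suc b ⟧ = nat a - nat (suc b)

  ⟦⟧-diff : ∀ a b → ⟦ a , b ⟧ ≈ nat a - nat b
  ⟦⟧-diff a zero    = sym (trans (+-congˡ -0#≈0#) (+-identityʳ _))
  ⟦⟧-diff a (suc b) = refl

  interchange : ∀ x y z w → (x + y) + (z + w) ≈ (x + z) + (y + w)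
  interchange x y z w = begin
    (x + y) + (z + w) ≈⟨ +-assoc x y _ ⟩
    x + (y + (z + w)) ≈⟨ +-congˡ (trans (sym (+-assoc y z w)) (trans (+-congʳ (+-comm y z)) (+-assoc z y w))) ⟩
    x + (z + (y + w)) ≈⟨ sym (+-assoc x z _) ⟩
    (x + z) + (y + w) ∎

  diff-+ : ∀ x y z w → (x + z) - (y + w) ≈ (x - y) + (z - w)
  diff-+ x y z w = trans (+-congˡ (sym (⁻¹-∙-comm y w))) (interchange x z (- y) (- w))

  diff-* : ∀ x y z w → (x * z + y * w) - (x * w + y * z) ≈ (x - y) * (z - w)
  diff-* x y z w = sym (begin
    (x - y) * (z - w)                                     ≈⟨ distribʳ _ _ _ ⟩
    x * (z - w) + - y * (z - w)                           ≈⟨ +-cong (distribˡ _ _ _) (distribˡ _ _ _) ⟩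
    (x * z + x * - w) + (- y * z + - y * - w)             ≈⟨ +-congˡ (+-comm _ _) ⟩
    (x * z + x * - w) + (- y * - w + - y * z)             ≈⟨ interchange _ _ _ _ ⟩
    (x * z + - y * - w) + (x * - w + - y * z)             ≈⟨ +-cong (+-congˡ (-x*-y≈x*y y w)) (+-cong (sym (-‿distribʳ-* x w)) (sym (-‿distribˡ-* y z))) ⟩
    (x * z + y * w) + (- (x * w) - y * z)                 ≈⟨ +-congˡ (⁻¹-∙-comm _ _) ⟩
    (x * z + y * w) - (x * w + y * z)                     ∎)
    where
    -x*-y≈x*y : ∀ x y → - x * - y ≈ x * y
    -x*-y≈x*y x y = trans (sym (-‿distribˡ-* x (- y))) (trans (-‿cong (sym (-‿distribʳ-* x y))) (-‿involutive (x * y)))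

  nat-suc : ∀ n → nat (suc n) ≈ 1# + nat n
  nat-suc n = M.×-homo-+ 1# 1 n

  ⟦normal⟧ : ∀ a b → ⟦ normal a b ⟧ ≈ nat a - nat b
  ⟦normal⟧ zero    b       = ⟦⟧-diff 0 b
  ⟦normal⟧ (suc a) zero    = ⟦⟧-diff (suc a) 0
  ⟦normal⟧ (suc a) (suc b) = begin
    ⟦ normal a b ⟧                    ≈⟨ ⟦normal⟧ a b ⟩
    nat a - nat b                     ≈⟨ sym (+-identityˡ _) ⟩
    0# + (nat a - nat b)              ≈⟨ +-congʳ (sym (-‿inverseʳ 1#)) ⟩
    (1# - 1#) + (nat a - nat b)       ≈⟨ sym (diff-+ _ _ _ _) ⟩
    (1# + nat a) - (1# + nat b)       ≈⟨ +-cong (sym (nat-suc a)) (-‿cong (sym (nat-suc b))) ⟩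
    nat (suc a) - nat (suc b)         ∎

  homomorphism : coefficients -Raw-AlmostCommutative⟶ fromCommutativeRing R
  homomorphism = record
    { ⟦_⟧    = ⟦_⟧
    ; +-homo = λ (a , b) (c , d) → begin
        ⟦ normal (a ℕ.+ c) (b ℕ.+ d) ⟧          ≈⟨ ⟦normal⟧ (a ℕ.+ c) (b ℕ.+ d) ⟩
        nat (a ℕ.+ c) - nat (b ℕ.+ d)           ≈⟨ +-cong (M.×-homo-+ 1# a c) (-‿cong (M.×-homo-+ 1# b d)) ⟩
        (nat a + nat c) - (nat b + nat d)       ≈⟨ diff-+ _ _ _ _ ⟩
        (nat a - nat b) + (nat c - nat d)       ≈⟨ sym (+-cong (⟦⟧-diff a b) (⟦⟧-diff c d)) ⟩
        ⟦ a , b ⟧ + ⟦ c , d ⟧                   ∎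
    ; *-homo = λ (a , b) (c , d) → begin
        ⟦ normal (a ℕ.* c ℕ.+ b ℕ.* d) (a ℕ.* d ℕ.+ b ℕ.* c) ⟧        ≈⟨ ⟦normal⟧ (a ℕ.* c ℕ.+ b ℕ.* d) _ ⟩
        nat (a ℕ.* c ℕ.+ b ℕ.* d) - nat (a ℕ.* d ℕ.+ b ℕ.* c)         ≈⟨ +-cong (products a c b d) (-‿cong (products a d b c)) ⟩
        (nat a * nat c + nat b * nat d) - (nat a * nat d + nat b * nat c) ≈⟨ diff-* _ _ _ _ ⟩
        (nat a - nat b) * (nat c - nat d)                             ≈⟨ sym (*-cong (⟦⟧-diff a b) (⟦⟧-diff c d)) ⟩
        ⟦ a , b ⟧ * ⟦ c , d ⟧                                         ∎
    ; -‿homo = λ (a , b) → begin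
        ⟦ b , a ⟧                ≈⟨ ⟦⟧-diff b a ⟩
        nat b - nat a            ≈⟨ +-comm _ _ ⟩
        - nat a + nat b          ≈⟨ +-congˡ (sym (-‿involutive _)) ⟩
        - nat a + - (- nat b)    ≈⟨ ⁻¹-∙-comm _ _ ⟩
        - (nat a - nat b)        ≈⟨ -‿cong (sym (⟦⟧-diff a b)) ⟩
        - ⟦ a , b ⟧              ∎
    ; 0-homo = refl
    ; 1-homo = refl
    }
    where
    products : ∀ a b c d → nat (a ℕ.* b ℕ.+ c ℕ.* d) ≈ nat a * nat b + nat c * nat d
    products a b c d = trans (M.×-homo-+ 1# (a ℕ.* b) (c ℕ.* d)) (+-cong (M.×1-homo-* a b) (M.×1-homo-* c d))

  coefficients-≟ : ∀ p r → Maybe (⟦ p ⟧ ≈ ⟦ r ⟧)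
  coefficients-≟ (a , b) (c , d) with a ℕₚ.≟ c | b ℕₚ.≟ d
  ... | yes ≡.refl | yes ≡.refl = just refl
  ... | _          | _          = nothing

  open RingSolver coefficients (fromCommutativeRing R) homomorphism coefficients-≟ public
    using (solve; _:=_; _:+_; _:*_; _:-_; :-_; con)

-- Constructive ordered fields and geometric rates of decay.

module OrderedFieldFacts {c ℓ₁ ℓ₂} (F : OrderedField c ℓ₁ ℓ₂) where
  open OrderedField F public using
    ( _#_; #-cotrans; tight; #⇒invertible; invertible⇒#; heytingCommutativeRing
    ; _<_; <-resp-≈; <-respʳ-≈; <-irrefl; <-trans
    ; #⇔<>; 0<1; +-monoˡ-<; *-pos; recip; fromℕ; fromℕ-pos )

  commutativeRing : CommutativeRing c ℓ₁
  commutativeRing = HeytingCommutativeRing.commutativeRing heytingCommutativeRing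

  open CommutativeRing commutativeRing public hiding (zero)
  open Exp semiring public using (_^_; ^-homo-*)
  open IntegerSolver commutativeRing public

  infix 4 _≤_
  -- Being a negation, `x ≤ y` may be proved by contradiction although the order is not decidable;
  -- tightness of apartness still makes it antisymmetric.
  _≤_ : Rel Carrier ℓ₂
  x ≤ y = ¬ (y < x)

  <⇒# : ∀ {x y} → x < y → x # y
  <⇒# x<y = Equivalence.from #⇔<> (inj₁ x<y)

  -- The constructive substitute for comparing z with x and y. Cotransitivity of apartness leaves
  -- four sign cases; the two that do not answer directly do so after one use of transitivity
  -- through `x < y`.
  <-cotrans : ∀ {x y} → x < y → ∀ z → x < z ⊎ z < y
  <-cotrans x<y z with #-cotrans (<⇒# x<y) z
  ... | inj₁ x#z with Equivalence.to #⇔<> x#z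
  ...   | inj₁ x<z = inj₁ x<z
  ...   | inj₂ z<x = inj₂ (<-trans z<x x<y)
  <-cotrans x<y z | inj₂ z#y with Equivalence.to #⇔<> z#y
  ...   | inj₁ z<y = inj₂ z<y
  ...   | inj₂ y<z = inj₁ (<-trans x<y y<z)

  <-asym : ∀ {x y} → x < y → ¬ (y < x)
  <-asym x<y y<x = <-irrefl refl (<-trans x<y y<x)

  <⇒≤ : ∀ {x y} → x < y → x ≤ y
  <⇒≤ = <-asym

  ≤-reflexive : ∀ {x y} → x ≈ y → x ≤ y
  ≤-reflexive x≈y y<x = <-irrefl (sym x≈y) y<x

  ≤-refl : ∀ {x} → x ≤ x
  ≤-refl = ≤-reflexive refl

  <-≤-trans : ∀ {x y z} → x < y → y ≤ z → x < z
  <-≤-trans {z = z} x<y y≤z with <-cotrans x<y z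
  ... | inj₁ x<z = x<z
  ... | inj₂ z<y = ⊥-elim (y≤z z<y)

  ≤-<-trans : ∀ {x y z} → x ≤ y → y < z → x < z
  ≤-<-trans {x} x≤y y<z with <-cotrans y<z x
  ... | inj₁ y<x = ⊥-elim (x≤y y<x)
  ... | inj₂ x<z = x<z

  ≤-trans : ∀ {x y z} → x ≤ y → y ≤ z → x ≤ z
  ≤-trans x≤y y≤z z<x = y≤z (<-≤-trans z<x x≤y)

  ≤-antisym : ∀ {x y} → x ≤ y → y ≤ x → x ≈ y
  ≤-antisym {x} {y} x≤y y≤x = proj₁ (tight x y) λ x#y → apart (Equivalence.to #⇔<> x#y)
    where
    apart : ¬ (x < y ⊎ y < x)
    apart (inj₁ x<y) = y≤x x<y
    apart (inj₂ y<x) = x≤y y<x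

  ≤-isPreorder : IsPreorder _≈_ _≤_
  ≤-isPreorder = record
    { isEquivalence = isEquivalence ; reflexive = ≤-reflexive ; trans = ≤-trans }

  module ≤-Reasoning = TripleReasoning ≤-isPreorder <-asym <-trans <-resp-≈ <⇒≤ <-≤-trans ≤-<-trans
  open ≤-Reasoning

  +-monoʳ-< : ∀ {x y} z → x < y → z + x < z + y
  +-monoʳ-< {x} {y} z x<y = begin-strict
    z + x ≈⟨ +-comm z x ⟩
    x + z <⟨ +-monoˡ-< z x<y ⟩
    y + z ≈⟨ +-comm y z ⟩
    z + y ∎

  +-cancelʳ-< : ∀ {x y} z → x + z < y + z → x < y
  +-cancelʳ-< {x} {y} z x+z<y+z = begin-strict
    x           ≈⟨ solve 2 (λ x z → x := (x :+ z) :- z) refl x z ⟩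
    (x + z) - z <⟨ +-monoˡ-< (- z) x+z<y+z ⟩
    (y + z) - z ≈⟨ solve 2 (λ x z → (x :+ z) :- z := x) refl y z ⟩
    y           ∎

  +-monoˡ-≤ : ∀ {x y} z → x ≤ y → x + z ≤ y + z
  +-monoˡ-≤ z x≤y y+z<x+z = x≤y (+-cancelʳ-< z y+z<x+z)

  +-mono-≤ : ∀ {x y z w} → x ≤ y → z ≤ w → x + z ≤ y + w
  +-mono-≤ {x} {y} {z} {w} x≤y z≤w = begin
    x + z ≤⟨ +-monoˡ-≤ z x≤y ⟩
    y + z ≈⟨ +-comm y z ⟩
    z + y ≤⟨ +-monoˡ-≤ y z≤w ⟩
    w + y ≈⟨ +-comm w y ⟩
    y + w ∎

  x≤y⇒0≤y-x : ∀ {x y} → x ≤ y → 0# ≤ y - x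
  x≤y⇒0≤y-x {x} {y} x≤y = begin
    0#    ≈⟨ sym (-‿inverseʳ x) ⟩
    x - x ≤⟨ +-monoˡ-≤ (- x) x≤y ⟩
    y - x ∎

  x<y⇒0<y-x : ∀ {x y} → x < y → 0# < y - x
  x<y⇒0<y-x {x} {y} x<y = begin-strict
    0#    ≈⟨ sym (-‿inverseʳ x) ⟩
    x - x <⟨ +-monoˡ-< (- x) x<y ⟩
    y - x ∎

  x≤x+d : ∀ {x y d} → 0# ≤ d → y ≈ x + d → x ≤ y
  x≤x+d {x} {y} {d} 0≤d y≈x+d = begin
    x      ≈⟨ sym (+-identityˡ x) ⟩
    0# + x ≤⟨ +-monoˡ-≤ x 0≤d ⟩
    d + x  ≈⟨ trans (+-comm d x) (sym y≈x+d) ⟩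
    y      ∎

  x<x+d : ∀ {x y d} → 0# < d → y ≈ x + d → x < y
  x<x+d {x} {y} {d} 0<d y≈x+d = begin-strict
    x      ≈⟨ sym (+-identityˡ x) ⟩
    0# + x <⟨ +-monoˡ-< x 0<d ⟩
    d + x  ≈⟨ trans (+-comm d x) (sym y≈x+d) ⟩
    y      ∎

  +-nonneg : ∀ {x y} → 0# ≤ x → 0# ≤ y → 0# ≤ x + y
  +-nonneg {x} {y} 0≤x 0≤y = begin
    0#      ≈⟨ sym (+-identityˡ 0#) ⟩
    0# + 0# ≤⟨ +-mono-≤ 0≤x 0≤y ⟩
    x + y   ∎

  +-pos-nonneg : ∀ {x y} → 0# < x → 0# ≤ y → 0# < x + y
  +-pos-nonneg {x} {y} 0<x 0≤y = <-≤-trans 0<x (x≤x+d 0≤y refl)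

  -- The goal is a negation, so it suffices that each factor is positive up to double negation: a
  -- factor that is nonnegative and not positive is zero, and then the product is not negative.
  *-nonneg : ∀ {x y} → 0# ≤ x → 0# ≤ y → 0# ≤ x * y
  *-nonneg {x} {y} 0≤x 0≤y xy<0 = 0≮x (λ 0<x → 0≮y (λ 0<y → <-asym xy<0 (*-pos 0<x 0<y)))
    where
    0≮y : ¬ ¬ (0# < y)
    0≮y y≤0 = <-irrefl (trans (*-congˡ (≤-antisym y≤0 0≤y)) (zeroʳ x)) xy<0
    0≮x : ¬ ¬ (0# < x)
    0≮x x≤0 = <-irrefl (trans (*-congʳ (≤-antisym x≤0 0≤x)) (zeroˡ y)) xy<0

  *-monoˡ-≤ : ∀ {x y} z → 0# ≤ z → x ≤ y → x * z ≤ y * z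
  *-monoˡ-≤ {x} {y} z 0≤z x≤y = x≤x+d (*-nonneg (x≤y⇒0≤y-x x≤y) 0≤z)
    (solve 3 (λ x y z → y :* z := x :* z :+ (y :- x) :* z) refl x y z)

  *-monoʳ-≤ : ∀ {x y} z → 0# ≤ z → x ≤ y → z * x ≤ z * y
  *-monoʳ-≤ {x} {y} z 0≤z x≤y = x≤x+d (*-nonneg 0≤z (x≤y⇒0≤y-x x≤y))
    (solve 3 (λ x y z → z :* y := z :* x :+ z :* (y :- x)) refl x y z)

  *-mono-≤ : ∀ {x y z w} → 0# ≤ x → 0# ≤ z → x ≤ y → z ≤ w → x * z ≤ y * w
  *-mono-≤ {x} {y} {z} {w} 0≤x 0≤z x≤y z≤w = begin
    x * z ≤⟨ *-monoˡ-≤ z 0≤z x≤y ⟩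
    y * z ≤⟨ *-monoʳ-≤ y (≤-trans 0≤x x≤y) z≤w ⟩
    y * w ∎

  *-monoˡ-< : ∀ {x y} z → 0# < z → x < y → x * z < y * z
  *-monoˡ-< {x} {y} z 0<z x<y = x<x+d (*-pos (x<y⇒0<y-x x<y) 0<z)
    (solve 3 (λ x y z → y :* z := x :* z :+ (y :- x) :* z) refl x y z)

  *-cancelʳ-≤ : ∀ {x y} z → 0# < z → x * z ≤ y * z → x ≤ y
  *-cancelʳ-≤ z 0<z xz≤yz y<x = xz≤yz (*-monoˡ-< z 0<z y<x)

  square-nonneg : ∀ x → 0# ≤ x * x
  square-nonneg x xx<0 = <-irrefl (trans (*-congʳ (≤-antisym x≤0 0≤x)) (zeroˡ x)) xx<0
    where
    x≤0 : x ≤ 0#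
    x≤0 0<x = <-asym xx<0 (*-pos 0<x 0<x)
    0≤x : 0# ≤ x
    0≤x x<0 = <-asym xx<0 (<-respʳ-≈ (solve 1 (λ x → (con (0 , 0) :- x) :* (con (0 , 0) :- x) := x :* x) refl x)
      (*-pos (x<y⇒0<y-x x<0) (x<y⇒0<y-x x<0)))

  square-cancel-≤ : ∀ {x y} → 0# ≤ y → x * x ≤ y * y → x ≤ y
  square-cancel-≤ {x} {y} 0≤y xx≤yy y<x = xx≤yy (begin-strict
    y * y ≤⟨ *-monoʳ-≤ y 0≤y (<⇒≤ y<x) ⟩
    y * x <⟨ *-monoˡ-< x (≤-<-trans 0≤y y<x) y<x ⟩
    x * x ∎)

  recip-inverseʳ : ∀ x (0<x : 0# < x) → x * recip x 0<x ≈ 1#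
  recip-inverseʳ x 0<x = trans (*-comm x _) (trans (*-congˡ x≈x-0) (proj₁ (proj₂ (#⇒invertible (Equivalence.from #⇔<> (inj₂ 0<x))))))
    where
    x≈x-0 : x ≈ x - 0#
    x≈x-0 = solve 1 (λ x → x := x :- con (0 , 0)) refl x

  x*y≈1⇒x#0 : ∀ {x y} → x * y ≈ 1# → x # 0#
  x*y≈1⇒x#0 {x} {y} xy≈1 = invertible⇒# (y , trans (solve 2 (λ x y → y :* (x :- con (0 , 0)) := x :* y) refl x y) xy≈1
    , trans (solve 2 (λ x y → (x :- con (0 , 0)) :* y := x :* y) refl x y) xy≈1)

  recip-pos : ∀ x (0<x : 0# < x) → 0# < recip x 0<x
  recip-pos x 0<x with Equivalence.to #⇔<> (x*y≈1⇒x#0 (trans (*-comm (recip x 0<x) x) (recip-inverseʳ x 0<x)))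
  ... | inj₂ 0<r = 0<r
  ... | inj₁ r<0 = ⊥-elim (<-asym 0<1 (begin-strict
    1#                ≈⟨ sym (recip-inverseʳ x 0<x) ⟩
    x * recip x 0<x   ≈⟨ *-comm x _ ⟩
    recip x 0<x * x   <⟨ *-monoˡ-< x 0<x r<0 ⟩
    0# * x            ≈⟨ zeroˡ x ⟩
    0#                ∎))

  0≤1 : 0# ≤ 1#
  0≤1 = <⇒≤ 0<1

  0<2 : 0# < 1# + 1#
  0<2 = +-pos-nonneg 0<1 0≤1

  ½ : Carrier
  ½ = recip (1# + 1#) 0<2

  0<½ : 0# < ½
  0<½ = recip-pos _ 0<2

  halves : ∀ x → x * ½ + x * ½ ≈ x
  halves x = trans (solve 2 (λ x h → x :* h :+ x :* h := x :* ((con (1 , 0) :+ con (1 , 0)) :* h)) refl x ½)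
    (trans (*-congˡ (recip-inverseʳ _ 0<2)) (*-identityʳ x))

  0<x*½ : ∀ {x} → 0# < x → 0# < x * ½
  0<x*½ 0<x = *-pos 0<x 0<½

  x*½<x : ∀ {x} → 0# < x → x * ½ < x
  x*½<x {x} 0<x = x<x+d (0<x*½ 0<x) (sym (halves x))

  ≤-squeeze : ∀ {x y} → (∀ ε → 0# < ε → x ≤ y + ε) → x ≤ y
  ≤-squeeze {x} {y} bound y<x = bound ((x - y) * ½) (0<x*½ 0<x-y) (begin-strict
    y + (x - y) * ½ <⟨ +-monoʳ-< y (x*½<x 0<x-y) ⟩
    y + (x - y)     ≈⟨ solve 2 (λ x y → y :+ (x :- y) := x) refl x y ⟩
    x               ∎)
    where
    0<x-y : 0# < x - y
    0<x-y = x<y⇒0<y-x y<x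

  ^-nonneg : ∀ {x} n → 0# ≤ x → 0# ≤ x ^ n
  ^-nonneg zero    0≤x = 0≤1
  ^-nonneg (suc n) 0≤x = *-nonneg 0≤x (^-nonneg n 0≤x)

  ^-pos : ∀ {x} n → 0# < x → 0# < x ^ n
  ^-pos zero    0<x = 0<1
  ^-pos (suc n) 0<x = *-pos 0<x (^-pos n 0<x)

  ^-mono-≤ : ∀ {x y} n → 0# ≤ x → x ≤ y → x ^ n ≤ y ^ n
  ^-mono-≤ zero    0≤x x≤y = ≤-refl
  ^-mono-≤ (suc n) 0≤x x≤y = *-mono-≤ 0≤x (^-nonneg n 0≤x) x≤y (^-mono-≤ n 0≤x x≤y)

  ^-≤-1 : ∀ {x} n → 0# ≤ x → x ≤ 1# → x ^ n ≤ 1#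
  ^-≤-1 zero    0≤x x≤1 = ≤-refl
  ^-≤-1 {x} (suc n) 0≤x x≤1 = begin
    x * x ^ n ≤⟨ *-mono-≤ 0≤x (^-nonneg n 0≤x) x≤1 (^-≤-1 n 0≤x x≤1) ⟩
    1# * 1#   ≈⟨ *-identityʳ 1# ⟩
    1#        ∎

  ^-antimono : ∀ {x m n} → 0# ≤ x → x ≤ 1# → m ℕ.≤ n → x ^ n ≤ x ^ m
  ^-antimono {x} {n = n} 0≤x x≤1 ℕ.z≤n       = ^-≤-1 n 0≤x x≤1
  ^-antimono {x}         0≤x x≤1 (ℕ.s≤s m≤n) = *-monoʳ-≤ x 0≤x (^-antimono 0≤x x≤1 m≤n)

  fromℕ-nonneg : ∀ n → 0# ≤ fromℕ n
  fromℕ-nonneg zero    = ≤-refl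
  fromℕ-nonneg (suc n) = +-nonneg 0≤1 (fromℕ-nonneg n)

  fromℕ-mono : ∀ {m n} → m ℕ.≤ n → fromℕ m ≤ fromℕ n
  fromℕ-mono {n = n} ℕ.z≤n       = fromℕ-nonneg n
  fromℕ-mono         (ℕ.s≤s m≤n) = +-mono-≤ ≤-refl (fromℕ-mono m≤n)

  -- Strict positivity is required because rates get divided by when an index is shifted back, and
  -- because their powers serve as tolerances ε.
  record Rate : Set (c ⊔ ℓ₂) where
    field
      rate    : Carrier
      positive : 0# < rate
      below-1 : rate < 1#

    nonneg : 0# ≤ rate
    nonneg = <⇒≤ positive

    at-most-1 : rate ≤ 1#
    at-most-1 = <⇒≤ below-1

  open Rate

  0<1-rate : ∀ s → 0# < 1# - rate s
  0<1-rate s = x<y⇒0<y-x (below-1 s)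

  gap : Rate → Carrier
  gap s = (1# - rate s) * ½

  0<gap : ∀ s → 0# < gap s
  0<gap s = 0<x*½ (0<1-rate s)

  -- The midpoint between the rate and 1: the room gained absorbs one factor n.
  widen : Rate → Rate
  widen s = record
    { rate     = rate s + gap s
    ; positive = +-pos-nonneg (positive s) (<⇒≤ (0<gap s))
    ; below-1  = begin-strict
        rate s + gap s         <⟨ +-monoʳ-< (rate s) (x*½<x (0<1-rate s)) ⟩
        rate s + (1# - rate s) ≈⟨ solve 1 (λ s → s :+ (con (1 , 0) :- s) := con (1 , 0)) refl (rate s) ⟩
        1#                     ∎
    }

  infixr 6 _⊔ʳ_
  -- This is `1 - (1 - s)(1 - t)`, an upper bound of both rates that needs no comparison between
  -- them.
  _⊔ʳ_ : Rate → Rate → Rate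
  s ⊔ʳ t = record
    { rate     = rate s + (1# - rate s) * rate t
    ; positive = +-pos-nonneg (positive s) (*-nonneg (<⇒≤ (0<1-rate s)) (nonneg t))
    ; below-1  = x<x+d (*-pos (0<1-rate s) (0<1-rate t))
        (solve 2 (λ s t → con (1 , 0) := s :+ (con (1 , 0) :- s) :* t :+ (con (1 , 0) :- s) :* (con (1 , 0) :- t)) refl (rate s) (rate t))
    }

  ⊔ʳ-upperˡ : ∀ s t → rate s ≤ rate (s ⊔ʳ t)
  ⊔ʳ-upperˡ s t = x≤x+d (*-nonneg (<⇒≤ (0<1-rate s)) (nonneg t)) refl

  ⊔ʳ-upperʳ : ∀ s t → rate t ≤ rate (s ⊔ʳ t)
  ⊔ʳ-upperʳ s t = x≤x+d (*-nonneg (<⇒≤ (0<1-rate t)) (nonneg s))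
    (solve 2 (λ s t → s :+ (con (1 , 0) :- s) :* t := t :+ (con (1 , 0) :- t) :* s) refl (rate s) (rate t))

  -- Bernoulli's inequality (s + δ)ⁿ ≥ n sⁿ δ.
  linear-geometric : ∀ s n → fromℕ n * rate s ^ n ≤ recip (gap s) (0<gap s) * rate (widen s) ^ n
  linear-geometric s n = *-cancelʳ-≤ δ (0<gap s) (begin
    fromℕ n * r ^ n * δ                       ≤⟨ bernoulli n ⟩
    t ^ n                                     ≈⟨ sym (*-identityˡ _) ⟩
    1# * t ^ n                                ≈⟨ *-congʳ (sym (recip-inverseʳ δ (0<gap s))) ⟩
    δ * recip δ (0<gap s) * t ^ n             ≈⟨ solve 3 (λ d e x → d :* e :* x := e :* x :* d) refl δ _ (t ^ n) ⟩
    recip δ (0<gap s) * t ^ n * δ             ∎)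
    where
    r δ t : Carrier
    r = rate s
    δ = gap s
    t = rate (widen s)
    r≤t : r ≤ t
    r≤t = x≤x+d (<⇒≤ (0<gap s)) refl
    bernoulli : ∀ n → fromℕ n * r ^ n * δ ≤ t ^ n
    bernoulli zero    = begin
      0# * 1# * δ ≈⟨ trans (*-congʳ (zeroˡ 1#)) (zeroˡ δ) ⟩
      0#          ≤⟨ 0≤1 ⟩
      1#          ∎
    bernoulli (suc n) = begin
      (1# + fromℕ n) * (r * r ^ n) * δ         ≈⟨ solve 4 (λ n r p d → (con (1 , 0) :+ n) :* (r :* p) :* d := r :* (n :* p :* d) :+ (r :* p) :* d) refl (fromℕ n) r (r ^ n) δ ⟩
      r * (fromℕ n * r ^ n * δ) + (r * r ^ n) * δ ≤⟨ +-mono-≤ (*-monoʳ-≤ r (nonneg s) (bernoulli n)) (*-monoˡ-≤ δ (<⇒≤ (0<gap s)) (*-monoˡ-≤ _ (^-nonneg n (nonneg s)) (at-most-1 s))) ⟩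
      r * t ^ n + (1# * r ^ n) * δ               ≤⟨ +-mono-≤ ≤-refl (*-monoˡ-≤ δ (<⇒≤ (0<gap s)) (≤-trans (≤-reflexive (*-identityˡ _)) (^-mono-≤ n (nonneg s) r≤t))) ⟩
      r * t ^ n + t ^ n * δ                    ≈⟨ solve 3 (λ r p d → r :* p :+ p :* d := (r :+ d) :* p) refl r (t ^ n) δ ⟩
      (r + δ) * t ^ n                          ∎

  -- Each of the k factors n costs one application of `linear-geometric`, hence one widening of the
  -- rate.
  polynomial-geometric : ∀ k s → ∃[ C ] ∃[ t ] (0# ≤ C) × (∀ n → fromℕ n ^ k * rate s ^ n ≤ C * rate t ^ n)
  polynomial-geometric zero    s = 1# , s , 0≤1 , λ n → ≤-refl
  polynomial-geometric (suc k) s with polynomial-geometric k s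
  ... | C , t , 0≤C , bound = C * recip (gap t) (0<gap t) , widen t , *-nonneg 0≤C (<⇒≤ (recip-pos _ (0<gap t))) , λ n → begin
    fromℕ n * fromℕ n ^ k * rate s ^ n                     ≈⟨ *-assoc _ _ _ ⟩
    fromℕ n * (fromℕ n ^ k * rate s ^ n)                   ≤⟨ *-monoʳ-≤ _ (fromℕ-nonneg n) (bound n) ⟩
    fromℕ n * (C * rate t ^ n)                             ≈⟨ solve 3 (λ n c x → n :* (c :* x) := c :* (n :* x)) refl (fromℕ n) C (rate t ^ n) ⟩
    C * (fromℕ n * rate t ^ n)                             ≤⟨ *-monoʳ-≤ C 0≤C (linear-geometric t n) ⟩
    C * (recip (gap t) (0<gap t) * rate (widen t) ^ n)     ≈⟨ sym (*-assoc _ _ _) ⟩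
    C * recip (gap t) (0<gap t) * rate (widen t) ^ n       ∎

  -- By `linear-geometric`, `n · sⁿ` is bounded by a constant E, so `C sⁿ ≤ C E / n`. The
  -- Archimedean property is asked for an n above `C E / ε`.
  geometric-null : (∀ x → ∃[ n ] (x < fromℕ n)) →
    ∀ s C → 0# ≤ C → ∀ ε → 0# < ε → ∃[ N ] (∀ n → N ℕ.≤ n → C * rate s ^ n ≤ ε)
  geometric-null archimedean s C 0≤C ε 0<ε = proj₁ large , bound
    where
    E D : Carrier
    E = recip (gap s) (0<gap s)
    D = C * E * recip ε 0<ε
    0≤E : 0# ≤ E
    0≤E = <⇒≤ (recip-pos _ (0<gap s))
    0≤D : 0# ≤ D
    0≤D = *-nonneg (*-nonneg 0≤C 0≤E) (<⇒≤ (recip-pos _ 0<ε))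
    large : ∃[ N ] (D < fromℕ N)
    large = archimedean D
    bound : ∀ n → proj₁ large ℕ.≤ n → C * rate s ^ n ≤ ε
    bound n N≤n = *-cancelʳ-≤ (fromℕ n) (≤-<-trans 0≤D D<n) (begin
      C * rate s ^ n * fromℕ n        ≈⟨ solve 3 (λ c x n → c :* x :* n := c :* (n :* x)) refl C (rate s ^ n) (fromℕ n) ⟩
      C * (fromℕ n * rate s ^ n)      ≤⟨ *-monoʳ-≤ C 0≤C (≤-trans (linear-geometric s n) (*-monoʳ-≤ E 0≤E (^-≤-1 n (nonneg (widen s)) (at-most-1 (widen s))))) ⟩
      C * (E * 1#)                    ≈⟨ *-congˡ (*-identityʳ E) ⟩
      C * E                           ≈⟨ sym (trans (*-congˡ (recip-inverseʳ ε 0<ε)) (*-identityʳ _)) ⟩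
      C * E * (ε * recip ε 0<ε)       ≈⟨ solve 3 (λ a e r → a :* (e :* r) := e :* (a :* r)) refl (C * E) ε _ ⟩
      ε * D                           ≤⟨ *-monoʳ-≤ ε (<⇒≤ 0<ε) (<⇒≤ D<n) ⟩
      ε * fromℕ n                     ∎)
      where
      D<n : D < fromℕ n
      D<n = <-≤-trans (proj₂ large) (fromℕ-mono N≤n)

  -- The ratio test, by induction on the threshold. Dropping the first term shifts the index, which
  -- a factor `1 / s` undoes; the first term is then added to the constant, so that no maximum has
  -- to be taken.
  eventually-geometric : ∀ s N (v : ℕ → Carrier) → (∀ n → 0# ≤ v n) → (∀ n → N ℕ.≤ n → v (suc n) ≤ rate s * v n) →
    ∃[ C ] (0# ≤ C) × (∀ n → v n ≤ C * rate s ^ n)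
  eventually-geometric s zero v 0≤v ratio = v 0 , 0≤v 0 , bound
    where
    bound : ∀ n → v n ≤ v 0 * rate s ^ n
    bound zero    = ≤-reflexive (sym (*-identityʳ (v 0)))
    bound (suc n) = begin
      v (suc n)                    ≤⟨ ratio n ℕ.z≤n ⟩
      rate s * v n                 ≤⟨ *-monoʳ-≤ (rate s) (nonneg s) (bound n) ⟩
      rate s * (v 0 * rate s ^ n)  ≈⟨ solve 3 (λ s v p → s :* (v :* p) := v :* (s :* p)) refl _ _ _ ⟩
      v 0 * (rate s * rate s ^ n)  ∎
  eventually-geometric s (suc N) v 0≤v ratio =
    let C , 0≤C , bound = eventually-geometric s N (λ n → v (suc n)) (λ n → 0≤v (suc n)) (λ n N≤n → ratio (suc n) (ℕ.s≤s N≤n))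
    in v 0 + C * s⁻¹ , +-nonneg (0≤v 0) (*-nonneg 0≤C 0≤s⁻¹) , extend C 0≤C bound
    where
    s⁻¹ : Carrier
    s⁻¹ = recip (rate s) (positive s)
    0≤s⁻¹ : 0# ≤ s⁻¹
    0≤s⁻¹ = <⇒≤ (recip-pos _ (positive s))
    extend : ∀ C → 0# ≤ C → (∀ n → v (suc n) ≤ C * rate s ^ n) → ∀ n → v n ≤ (v 0 + C * s⁻¹) * rate s ^ n
    extend C 0≤C bound zero    = x≤x+d (*-nonneg 0≤C 0≤s⁻¹) (*-identityʳ _)
    extend C 0≤C bound (suc n) = begin
      v (suc n)                              ≤⟨ bound n ⟩
      C * rate s ^ n                         ≈⟨ *-congˡ (trans (sym (*-identityˡ _)) (*-congʳ (sym (trans (*-comm s⁻¹ (rate s)) (recip-inverseʳ _ _))))) ⟩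
      C * (s⁻¹ * rate s * rate s ^ n)        ≤⟨ x≤x+d (*-nonneg (0≤v 0) (^-nonneg (suc n) (nonneg s)))
        (solve 5 (λ v c i s p → (v :+ c :* i) :* (s :* p) := c :* (i :* s :* p) :+ v :* (s :* p)) refl (v 0) C s⁻¹ (rate s) (rate s ^ n)) ⟩
      (v 0 + C * s⁻¹) * rate s ^ suc n       ∎

-- Finite sums, finite products and convolutions.

module FiniteSums {c ℓ} (R : CommutativeRing c ℓ) where
  open CommutativeRing R public hiding (zero)
  open Exp semiring public using (_^_; ^-congˡ; ^-homo-*)
  open CommutativeExp commutativeSemiring public using (^-distrib-*)
  open IntegerSolver R public using (solve; _:=_; _:+_; _:*_; _:-_; :-_; con)
  open SetoidReasoning setoid
  private module M = Multiples semiring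

  fromℕ : ℕ → Carrier
  fromℕ n = n M.× 1#

  fromℕ-+ : ∀ m n → fromℕ (m ℕ.+ n) ≈ fromℕ m + fromℕ n
  fromℕ-+ = M.×-homo-+ 1#

  fromℕ-* : ∀ m n → fromℕ (m ℕ.* n) ≈ fromℕ m * fromℕ n
  fromℕ-* = M.×1-homo-*

  fromℕ-^ : ∀ m k → fromℕ (m ℕ.^ k) ≈ fromℕ m ^ k
  fromℕ-^ m zero    = +-identityʳ 1#
  fromℕ-^ m (suc k) = trans (fromℕ-* m (m ℕ.^ k)) (*-congˡ (fromℕ-^ m k))

  ≡⇒≈ : ∀ {x y} → x ≡ y → x ≈ y
  ≡⇒≈ ≡.refl = refl

  Σ< : ℕ → (ℕ → Carrier) → Carrier
  Σ< zero    f = 0#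
  Σ< (suc N) f = Σ< N f + f N

  Π< : ℕ → (ℕ → Carrier) → Carrier
  Π< zero    f = 1#
  Π< (suc N) f = Π< N f * f N

  Π<-cong : ∀ N {f g} → (∀ n → f n ≈ g n) → Π< N f ≈ Π< N g
  Π<-cong zero    f≈g = refl
  Π<-cong (suc N) f≈g = *-cong (Π<-cong N f≈g) (f≈g N)

  Π<-shift : ∀ N f → Π< (suc N) f ≈ f 0 * Π< N (λ n → f (suc n))
  Π<-shift zero    f = *-comm 1# (f 0)
  Π<-shift (suc N) f = trans (*-congʳ (Π<-shift N f)) (*-assoc _ _ _)

  Π<-+ : ∀ m N f → Π< (m ℕ.+ N) f ≈ Π< m f * Π< N (λ n → f (m ℕ.+ n))
  Π<-+ zero    N f = sym (*-identityˡ _)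
  Π<-+ (suc m) N f = begin
    Π< (suc (m ℕ.+ N)) f                                                ≈⟨ Π<-shift (m ℕ.+ N) f ⟩
    f 0 * Π< (m ℕ.+ N) (λ n → f (suc n))                                ≈⟨ *-congˡ (Π<-+ m N (λ n → f (suc n))) ⟩
    f 0 * (Π< m (λ n → f (suc n)) * Π< N (λ n → f (suc m ℕ.+ n)))       ≈⟨ sym (*-assoc _ _ _) ⟩
    f 0 * Π< m (λ n → f (suc n)) * Π< N (λ n → f (suc m ℕ.+ n))         ≈⟨ *-congʳ (sym (Π<-shift m f)) ⟩
    Π< (suc m) f * Π< N (λ n → f (suc m ℕ.+ n))                         ∎

  Σ<-cong-< : ∀ N {f g} → (∀ n → n ℕ.< N → f n ≈ g n) → Σ< N f ≈ Σ< N g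
  Σ<-cong-< zero    f≈g = refl
  Σ<-cong-< (suc N) f≈g = +-cong (Σ<-cong-< N λ n n<N → f≈g n (ℕₚ.m<n⇒m<1+n n<N)) (f≈g N ℕₚ.≤-refl)

  Σ<-cong : ∀ N {f g} → (∀ n → f n ≈ g n) → Σ< N f ≈ Σ< N g
  Σ<-cong N f≈g = Σ<-cong-< N λ n _ → f≈g n

  Σ<-zero : ∀ N → Σ< N (λ _ → 0#) ≈ 0#
  Σ<-zero zero    = refl
  Σ<-zero (suc N) = trans (+-identityʳ _) (Σ<-zero N)

  Σ<-+ : ∀ N f g → Σ< N (λ n → f n + g n) ≈ Σ< N f + Σ< N g
  Σ<-+ zero    f g = sym (+-identityʳ 0#)
  Σ<-+ (suc N) f g = trans (+-congʳ (Σ<-+ N f g))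
    (solve 4 (λ a b c d → a :+ b :+ (c :+ d) := a :+ c :+ (b :+ d)) refl _ _ _ _)

  Σ<-* : ∀ N x f → Σ< N (λ n → x * f n) ≈ x * Σ< N f
  Σ<-* zero    x f = sym (zeroʳ x)
  Σ<-* (suc N) x f = trans (+-congʳ (Σ<-* N x f)) (sym (distribˡ x _ _))

  Σ<-*ʳ : ∀ N x f → Σ< N (λ n → f n * x) ≈ Σ< N f * x
  Σ<-*ʳ zero    x f = sym (zeroˡ x)
  Σ<-*ʳ (suc N) x f = trans (+-congʳ (Σ<-*ʳ N x f)) (sym (distribʳ x _ _))

  Σ<-shift : ∀ N f → Σ< (suc N) f ≈ f 0 + Σ< N (λ n → f (suc n))
  Σ<-shift zero    f = +-comm 0# (f 0)
  Σ<-shift (suc N) f = trans (+-congʳ (Σ<-shift N f)) (+-assoc _ _ _)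

  Σ<-swap : ∀ N M (f : ℕ → ℕ → Carrier) → Σ< N (λ i → Σ< M (f i)) ≈ Σ< M (λ j → Σ< N (λ i → f i j))
  Σ<-swap zero    M f = sym (Σ<-zero M)
  Σ<-swap (suc N) M f = trans (+-congʳ (Σ<-swap N M f)) (sym (Σ<-+ M _ _))

  -- The sum over i + j = n, free of the truncated subtraction in Σ F i (n ∸ i).
  diag : ℕ → (ℕ → ℕ → Carrier) → Carrier
  diag zero    F = F 0 0
  diag (suc n) F = F 0 (suc n) + diag n (λ i j → F (suc i) j)

  diag-cong : ∀ n {F G : ℕ → ℕ → Carrier} → (∀ i j → i ℕ.+ j ≡ n → F i j ≈ G i j) → diag n F ≈ diag n G
  diag-cong zero    F≈G = F≈G 0 0 ≡.refl
  diag-cong (suc n) F≈G = +-cong (F≈G 0 (suc n) ≡.refl) (diag-cong n λ i j i+j≡n → F≈G (suc i) j (≡.cong suc i+j≡n))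

  diag-cong′ : ∀ n {F G : ℕ → ℕ → Carrier} → (∀ i j → F i j ≈ G i j) → diag n F ≈ diag n G
  diag-cong′ n F≈G = diag-cong n λ i j _ → F≈G i j

  diag-+ : ∀ n (F G : ℕ → ℕ → Carrier) → diag n (λ i j → F i j + G i j) ≈ diag n F + diag n G
  diag-+ zero    F G = refl
  diag-+ (suc n) F G = trans (+-congˡ (diag-+ n _ _))
    (solve 4 (λ a b c d → a :+ b :+ (c :+ d) := a :+ c :+ (b :+ d)) refl _ _ _ _)

  diag-* : ∀ n x (F : ℕ → ℕ → Carrier) → diag n (λ i j → x * F i j) ≈ x * diag n F
  diag-* zero    x F = refl
  diag-* (suc n) x F = trans (+-congˡ (diag-* n x _)) (sym (distribˡ x _ _))

  diag-*ʳ : ∀ n x (F : ℕ → ℕ → Carrier) → diag n (λ i j → F i j * x) ≈ diag n F * x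
  diag-*ʳ n x F = trans (diag-cong′ n λ i j → *-comm _ _) (trans (diag-* n x F) (*-comm _ _))

  diag-zero : ∀ n → diag n (λ _ _ → 0#) ≈ 0#
  diag-zero zero    = refl
  diag-zero (suc n) = trans (+-identityˡ _) (diag-zero n)

  diag-Σ< : ∀ n N (F : ℕ → ℕ → ℕ → Carrier) → diag n (λ i j → Σ< N (F i j)) ≈ Σ< N (λ k → diag n (λ i j → F i j k))
  diag-Σ< n zero    F = diag-zero n
  diag-Σ< n (suc N) F = trans (diag-+ n _ _) (+-congʳ (diag-Σ< n N F))

  diag-last : ∀ n (F : ℕ → ℕ → Carrier) → diag (suc n) F ≈ diag n (λ i j → F i (suc j)) + F (suc n) 0
  diag-last zero    F = refl
  diag-last (suc n) F = trans (+-congˡ (diag-last n (λ i j → F (suc i) j))) (sym (+-assoc _ _ _))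

  diag-swap : ∀ n (F : ℕ → ℕ → Carrier) → diag n F ≈ diag n (λ i j → F j i)
  diag-swap zero    F = refl
  diag-swap (suc n) F = begin
    F 0 (suc n) + diag n (λ i j → F (suc i) j) ≈⟨ +-congˡ (diag-swap n _) ⟩
    F 0 (suc n) + diag n (λ i j → F (suc j) i) ≈⟨ +-comm _ _ ⟩
    diag n (λ i j → F (suc j) i) + F 0 (suc n) ≈⟨ sym (diag-last n (λ i j → F j i)) ⟩
    diag (suc n) (λ i j → F j i)               ∎

  diag-assoc : ∀ n (F : ℕ → ℕ → ℕ → Carrier) →
    diag n (λ i m → diag m (F i)) ≈ diag n (λ m k → diag m (λ i j → F i j k))
  diag-assoc zero    F = refl
  diag-assoc (suc n) F = begin
    (F 0 0 (suc n) + diag n (λ j k → F 0 (suc j) k)) + diag n (λ i m → diag m (F (suc i)))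
      ≈⟨ +-assoc _ _ _ ⟩
    F 0 0 (suc n) + (diag n (λ j k → F 0 (suc j) k) + diag n (λ i m → diag m (F (suc i))))
      ≈⟨ +-congˡ (+-congˡ (diag-assoc n (λ i → F (suc i)))) ⟩
    F 0 0 (suc n) + (diag n (λ j k → F 0 (suc j) k) + diag n (λ m k → diag m (λ i j → F (suc i) j k)))
      ≈⟨ +-congˡ (sym (diag-+ n _ _)) ⟩
    F 0 0 (suc n) + diag n (λ m k → F 0 (suc m) k + diag m (λ i j → F (suc i) j k))
      ∎

  diag≈Σ< : ∀ n (F : ℕ → ℕ → Carrier) → Σ< (suc n) (λ i → F i (n ℕ.∸ i)) ≈ diag n F
  diag≈Σ< zero    F = +-identityˡ _
  diag≈Σ< (suc n) F = trans (Σ<-shift (suc n) _) (+-congˡ (diag≈Σ< n (λ i j → F (suc i) j)))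

  Σ<-diag : ∀ N (F : ℕ → ℕ → Carrier) → Σ< (suc N) (λ n → diag n F) ≈ diag N (λ k l → Σ< (suc l) (F k))
  Σ<-diag zero    F = refl
  Σ<-diag (suc N) F = begin
    Σ< (suc N) (λ n → diag n F) + diag (suc N) F
      ≈⟨ +-cong (Σ<-diag N F) (diag-last N F) ⟩
    diag N (λ k l → Σ< (suc l) (F k)) + (diag N (λ k l → F k (suc l)) + F (suc N) 0)
      ≈⟨ sym (+-assoc _ _ _) ⟩
    diag N (λ k l → Σ< (suc l) (F k)) + diag N (λ k l → F k (suc l)) + F (suc N) 0
      ≈⟨ +-cong (sym (diag-+ N _ _)) (sym (+-identityˡ _)) ⟩
    diag N (λ k l → Σ< (suc (suc l)) (F k)) + Σ< 1 (F (suc N))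
      ≈⟨ sym (diag-last N (λ k l → Σ< (suc l) (F k))) ⟩
    diag (suc N) (λ k l → Σ< (suc l) (F k))
      ∎

  infixl 7 _⊛_
  _⊛_ : (ℕ → Carrier) → (ℕ → Carrier) → ℕ → Carrier
  (f ⊛ g) n = diag n (λ i j → f i * g j)

  ⊛-comm : ∀ f g n → (f ⊛ g) n ≈ (g ⊛ f) n
  ⊛-comm f g n = trans (diag-swap n _) (diag-cong′ n λ i j → *-comm _ _)

  ⊛-assoc : ∀ f g h n → ((f ⊛ g) ⊛ h) n ≈ (f ⊛ (g ⊛ h)) n
  ⊛-assoc f g h n = sym (begin
    diag n (λ i m → f i * diag m (λ j k → g j * h k))          ≈⟨ diag-cong′ n (λ i m → sym (diag-* m (f i) _)) ⟩
    diag n (λ i m → diag m (λ j k → f i * (g j * h k)))        ≈⟨ diag-assoc n _ ⟩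
    diag n (λ m k → diag m (λ i j → f i * (g j * h k)))        ≈⟨ diag-cong′ n (λ m k → trans (diag-cong′ m λ i j → sym (*-assoc _ _ _)) (diag-*ʳ m (h k) _)) ⟩
    diag n (λ m k → diag m (λ i j → f i * g j) * h k)          ∎)

  ⊛-cong-≤ : ∀ n {f f′ g g′ : ℕ → Carrier} → (∀ i → i ℕ.≤ n → f i ≈ f′ i) → (∀ i → i ℕ.≤ n → g i ≈ g′ i) →
    (f ⊛ g) n ≈ (f′ ⊛ g′) n
  ⊛-cong-≤ n f≈f′ g≈g′ = diag-cong n λ i j i+j≡n →
    *-cong (f≈f′ i (≡.subst (i ℕ.≤_) i+j≡n (ℕₚ.m≤m+n i j))) (g≈g′ j (≡.subst (j ℕ.≤_) i+j≡n (ℕₚ.m≤n+m j i)))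

  ⊛-cong : ∀ n {f f′ g g′ : ℕ → Carrier} → (∀ i → f i ≈ f′ i) → (∀ i → g i ≈ g′ i) → (f ⊛ g) n ≈ (f′ ⊛ g′) n
  ⊛-cong n f≈f′ g≈g′ = diag-cong′ n λ i j → *-cong (f≈f′ i) (g≈g′ j)

  -- Grouping the triangle k + j ≤ N by k pairs `u k` with the partial sum of v up to N - k. When W
  -- is the full sum of v, the error of the Cauchy product is thus a single diagonal of tails of v.
  ⊛-remainder : ∀ N u v W → diag N (λ k l → u k * (W - Σ< (suc l) v)) ≈ Σ< (suc N) u * W - Σ< (suc N) (u ⊛ v)
  ⊛-remainder N u v W = begin
    diag N (λ k l → u k * (W - Σ< (suc l) v))
      ≈⟨ diag-cong′ N (λ k l → solve 3 (λ u w s → u :* (w :- s) := u :* w :+ (:- con (1 , 0)) :* (u :* s)) refl (u k) W (Σ< (suc l) v)) ⟩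
    diag N (λ k l → u k * W + - 1# * (u k * Σ< (suc l) v))
      ≈⟨ trans (diag-+ N _ _) (+-congˡ (diag-* N (- 1#) _)) ⟩
    diag N (λ k l → u k * W) + - 1# * diag N (λ k l → u k * Σ< (suc l) v)
      ≈⟨ +-cong (trans (sym (diag≈Σ< N (λ k l → u k * W))) (Σ<-*ʳ (suc N) W u))
           (*-congˡ (trans (diag-cong′ N λ k l → sym (Σ<-* (suc l) (u k) v)) (sym (Σ<-diag N (λ k j → u k * v j))))) ⟩
    Σ< (suc N) u * W + - 1# * Σ< (suc N) (u ⊛ v)
      ≈⟨ solve 2 (λ a b → a :+ (:- con (1 , 0)) :* b := a :- b) refl (Σ< (suc N) u * W) (Σ< (suc N) (u ⊛ v)) ⟩
    Σ< (suc N) u * W - Σ< (suc N) (u ⊛ v) ∎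

  diag-diag : ∀ m n (G : ℕ → ℕ → ℕ → ℕ → Carrier) →
    diag m (λ i j → diag n (G i j)) ≈ diag n (λ k l → diag m (λ i j → G i j k l))
  diag-diag zero    n G = refl
  diag-diag (suc m) n G = trans (+-congˡ (diag-diag m n (λ i → G (suc i)))) (sym (diag-+ n _ _))

-- Formal exponential generating functions.

record InverseFactorials {c ℓ} (R : CommutativeRing c ℓ) : Set (c ⊔ ℓ) where
  open FiniteSums R
  field
    inv! : ℕ → Carrier
    factorial-inverse : ∀ n → fromℕ (n !) * inv! n ≈ 1#

  inv!-0 : inv! 0 ≈ 1#
  inv!-0 = trans (sym (trans (*-congʳ (+-identityʳ 1#)) (*-identityˡ _))) (factorial-inverse 0)

  inv!-suc : ∀ n → fromℕ (suc n) * inv! (suc n) ≈ inv! n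
  inv!-suc n = trans (sym (trans (*-congˡ (factorial-inverse n)) (*-identityʳ _)))
    (trans (solve 4 (λ a b c d → a :* b :* (c :* d) := a :* c :* b :* d) refl (fromℕ (suc n)) (inv! (suc n)) (fromℕ (n !)) (inv! n))
      (trans (*-congʳ (trans (*-congʳ (sym (fromℕ-* (suc n) (n !)))) (factorial-inverse (suc n)))) (*-identityˡ _)))

  -- The inverse of n + 1 is `n! · inv! (n + 1)`.
  fromℕ-cancel : ∀ n {x y} → fromℕ (suc n) * x ≈ fromℕ (suc n) * y → x ≈ y
  fromℕ-cancel n {x} {y} eq = trans (sym (undo x)) (trans (*-congˡ eq) (undo y))
    where
    undo : ∀ x → fromℕ (n !) * inv! (suc n) * (fromℕ (suc n) * x) ≈ x
    undo x = trans (solve 4 (λ a b c x → a :* b :* (c :* x) := a :* (c :* b) :* x) refl _ _ _ x)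
      (trans (*-congʳ (trans (*-congˡ (inv!-suc n)) (factorial-inverse n))) (*-identityˡ x))

-- All exponential generating functions here are identified through the first-order equation
-- θA = α ⊛ A with θ = t d/dt, which determines A from its constant term.
module ExponentialFormula {c ℓ} (R : CommutativeRing c ℓ) (F : InverseFactorials R) where
  open FiniteSums R
  open InverseFactorials F
  open SetoidReasoning setoid
  open RawSemiringDefs (Semiring.rawSemiring semiring) using (product)

  θ : (ℕ → Carrier) → ℕ → Carrier
  θ f n = fromℕ n * f n

  -- Here α is the logarithmic derivative θA / A, written without division. It is demanded only up
  -- to degree b, because truncated exponentials and sums over bounded tuples satisfy the equation
  -- no further.
  LogDer : ℕ → (ℕ → Carrier) → (ℕ → Carrier) → Set ℓ
  LogDer b α A = ∀ n → n ℕ.≤ b → θ A n ≈ (α ⊛ A) n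

  θ-0 : ∀ f → θ f 0 ≈ 0#
  θ-0 f = zeroˡ (f 0)

  θ-⊛ : ∀ f g n → θ (f ⊛ g) n ≈ (θ f ⊛ g) n + (f ⊛ θ g) n
  θ-⊛ f g n = begin
    fromℕ n * diag n (λ i j → f i * g j)                              ≈⟨ sym (diag-* n _ _) ⟩
    diag n (λ i j → fromℕ n * (f i * g j))                            ≈⟨ diag-cong n split ⟩
    diag n (λ i j → θ f i * g j + f i * θ g j)                        ≈⟨ diag-+ n _ _ ⟩
    (θ f ⊛ g) n + (f ⊛ θ g) n                                         ∎
    where
    split : ∀ i j → i ℕ.+ j ≡ n → fromℕ n * (f i * g j) ≈ θ f i * g j + f i * θ g j
    split i j ≡.refl = trans (*-congʳ (fromℕ-+ i j))
      (solve 4 (λ i j f g → (i :+ j) :* (f :* g) := i :* f :* g :+ f :* (j :* g)) refl _ _ _ _)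

  ⊛-leftComm : ∀ f g h n → (f ⊛ (g ⊛ h)) n ≈ (g ⊛ (f ⊛ h)) n
  ⊛-leftComm f g h n = trans (sym (⊛-assoc f g h n))
    (trans (⊛-cong n (⊛-comm f g) (λ _ → refl)) (⊛-assoc g f h n))

  ⊛-distribʳ : ∀ f g h n → ((λ i → f i + g i) ⊛ h) n ≈ (f ⊛ h) n + (g ⊛ h) n
  ⊛-distribʳ f g h n = trans (diag-cong′ n λ i j → distribʳ _ _ _) (diag-+ n _ _)

  LogDer-cong : ∀ {b α β A B} → (∀ n → n ℕ.≤ b → α n ≈ β n) → (∀ n → n ℕ.≤ b → A n ≈ B n) → LogDer b α A → LogDer b β B
  LogDer-cong α≈β A≈B der n n≤b = trans (*-congˡ (sym (A≈B n n≤b))) (trans (der n n≤b)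
    (⊛-cong-≤ n (λ i i≤n → α≈β i (ℕₚ.≤-trans i≤n n≤b)) (λ i i≤n → A≈B i (ℕₚ.≤-trans i≤n n≤b))))

  LogDer-* : ∀ {b α A} x → LogDer b α A → LogDer b α (λ n → x * A n)
  LogDer-* {b} {α} {A} x der n n≤b = begin
    fromℕ n * (x * A n)                  ≈⟨ solve 3 (λ n x a → n :* (x :* a) := x :* (n :* a)) refl _ _ _ ⟩
    x * (fromℕ n * A n)                  ≈⟨ *-congˡ (der n n≤b) ⟩
    x * (α ⊛ A) n                        ≈⟨ sym (diag-* n x _) ⟩
    diag n (λ i j → x * (α i * A j))     ≈⟨ diag-cong′ n (λ i j → solve 3 (λ x a b → x :* (a :* b) := a :* (x :* b)) refl _ _ _) ⟩
    diag n (λ i j → α i * (x * A j))     ∎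

  LogDer-⊛ : ∀ {b α β A B} → LogDer b α A → LogDer b β B → LogDer b (λ n → α n + β n) (A ⊛ B)
  LogDer-⊛ {b} {α} {β} {A} {B} derA derB n n≤b = begin
    θ (A ⊛ B) n                                ≈⟨ θ-⊛ A B n ⟩
    (θ A ⊛ B) n + (A ⊛ θ B) n                  ≈⟨ +-cong (⊛-cong-≤ n (λ i i≤n → derA i (ℕₚ.≤-trans i≤n n≤b)) (λ _ _ → refl))
                                                         (⊛-cong-≤ n (λ _ _ → refl) (λ i i≤n → derB i (ℕₚ.≤-trans i≤n n≤b))) ⟩
    ((α ⊛ A) ⊛ B) n + (A ⊛ (β ⊛ B)) n          ≈⟨ +-cong (⊛-assoc α A B n) (⊛-leftComm A β B n) ⟩
    (α ⊛ (A ⊛ B)) n + (β ⊛ (A ⊛ B)) n          ≈⟨ sym (⊛-distribʳ α β (A ⊛ B) n) ⟩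
    ((λ n → α n + β n) ⊛ (A ⊛ B)) n            ∎

  -- Since α has no constant term, the coefficient of α ⊛ A in degree n + 1 involves only A_0, ...,
  -- A_n, and the factor n + 1 produced by θ can be cancelled.
  LogDer-unique : ∀ {b α A B} → α 0 ≈ 0# → LogDer b α A → LogDer b α B → A 0 ≈ B 0 → ∀ n → n ℕ.≤ b → A n ≈ B n
  LogDer-unique {b} {α} {A} {B} α₀ derA derB A₀≈B₀ n n≤b = upTo-n n n≤b n ℕₚ.≤-refl
    where
    expand : ∀ (A : ℕ → Carrier) n → (α ⊛ A) (suc n) ≈ diag n (λ i j → α (suc i) * A j)
    expand A n = trans (+-congʳ (trans (*-congʳ α₀) (zeroˡ _))) (+-identityˡ _)
    upTo-n : ∀ n → n ℕ.≤ b → ∀ i → i ℕ.≤ n → A i ≈ B i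
    upTo-n zero    n≤b .0 z≤n = A₀≈B₀
    upTo-n (suc n) n<b i i≤1+n with ℕₚ.m≤n⇒m<n∨m≡n i≤1+n
    ... | inj₁ (s≤s i≤n) = upTo-n n (ℕₚ.<⇒≤ n<b) i i≤n
    ... | inj₂ ≡.refl    = fromℕ-cancel n (begin
      θ A (suc n)                              ≈⟨ trans (derA (suc n) n<b) (expand A n) ⟩
      diag n (λ i j → α (suc i) * A j)         ≈⟨ diag-cong n (λ i j i+j≡n → *-congˡ (upTo-n n (ℕₚ.<⇒≤ n<b) j (≡.subst (j ℕ.≤_) i+j≡n (ℕₚ.m≤n+m j i)))) ⟩
      diag n (λ i j → α (suc i) * B j)         ≈⟨ sym (trans (derB (suc n) n<b) (expand B n)) ⟩
      θ B (suc n)                              ∎)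

  constant : Carrier → ℕ → Carrier
  constant z zero    = z
  constant z (suc n) = 0#

  constant-⊛ : ∀ z f n → (constant z ⊛ f) n ≈ z * f n
  constant-⊛ z f zero    = refl
  constant-⊛ z f (suc n) = trans (+-congˡ (trans (diag-cong′ n λ i j → zeroˡ _) (diag-zero n))) (+-identityʳ _)

  power : (ℕ → Carrier) → ℕ → ℕ → Carrier
  power f zero    = constant 1#
  power f (suc k) = f ⊛ power f k

  exp : (ℕ → Carrier) → ℕ → Carrier
  exp f n = Σ< (suc n) (λ k → power f k n * inv! k)

  module _ (f : ℕ → Carrier) (f₀ : f 0 ≈ 0#) where

    ⊛-vanish : ∀ g h k n → g 0 ≈ 0# → (∀ j → j ℕ.< k → h j ≈ 0#) → n ℕ.≤ k → (g ⊛ h) n ≈ 0#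
    ⊛-vanish g h k n g₀ vanish n≤k = trans (diag-cong n term) (diag-zero n)
      where
      term : ∀ i j → i ℕ.+ j ≡ n → g i * h j ≈ 0#
      term zero    j _      = trans (*-congʳ g₀) (zeroˡ _)
      term (suc i) j ≡.refl = trans (*-congˡ (vanish j (ℕₚ.≤-trans (s≤s (ℕₚ.m≤n+m j i)) n≤k))) (zeroʳ _)

    power-vanish : ∀ k n → n ℕ.< k → power f k n ≈ 0#
    power-vanish (suc k) n (s≤s n≤k) = ⊛-vanish f (power f k) k n f₀ (power-vanish k) n≤k

    θ-constant : ∀ z n → θ (constant z) n ≈ 0#
    θ-constant z zero    = zeroˡ z
    θ-constant z (suc n) = zeroʳ _

    θ-power : ∀ k n → θ (power f (suc k)) n ≈ fromℕ (suc k) * (θ f ⊛ power f k) n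
    θ-power zero    n = begin
      θ (f ⊛ constant 1#) n                                     ≈⟨ θ-⊛ f _ n ⟩
      (θ f ⊛ constant 1#) n + (f ⊛ θ (constant 1#)) n           ≈⟨ +-congˡ (trans (diag-cong′ n λ i j → trans (*-congˡ (θ-constant 1# j)) (zeroʳ _)) (diag-zero n)) ⟩
      (θ f ⊛ constant 1#) n + 0#                                ≈⟨ solve 1 (λ x → x :+ con (0 , 0) := (con (1 , 0) :+ con (0 , 0)) :* x) refl _ ⟩
      fromℕ 1 * (θ f ⊛ constant 1#) n                           ∎
    θ-power (suc k) n = begin
      θ (f ⊛ power f (suc k)) n                                                     ≈⟨ θ-⊛ f _ n ⟩
      (θ f ⊛ power f (suc k)) n + (f ⊛ θ (power f (suc k))) n                       ≈⟨ +-congˡ (⊛-cong n (λ _ → refl) (θ-power k)) ⟩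
      (θ f ⊛ power f (suc k)) n + diag n (λ i j → f i * (fromℕ (suc k) * (θ f ⊛ power f k) j))
        ≈⟨ +-congˡ (trans (diag-cong′ n λ i j → solve 3 (λ a b c → a :* (b :* c) := b :* (a :* c)) refl _ _ _) (diag-* n _ _)) ⟩
      (θ f ⊛ power f (suc k)) n + fromℕ (suc k) * (f ⊛ (θ f ⊛ power f k)) n         ≈⟨ +-congˡ (*-congˡ (⊛-leftComm f (θ f) (power f k) n)) ⟩
      (θ f ⊛ power f (suc k)) n + fromℕ (suc k) * (θ f ⊛ power f (suc k)) n         ≈⟨ solve 2 (λ x n → x :+ n :* x := (con (1 , 0) :+ n) :* x) refl _ _ ⟩
      fromℕ (suc (suc k)) * (θ f ⊛ power f (suc k)) n                               ∎

    -- The number of terms in `exp` varies with the degree, which blocks termwise differentiation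
    -- and convolution. Here it is fixed; `exp-truncate` shows that the surplus terms vanish.
    truncatedExp : ℕ → ℕ → Carrier
    truncatedExp N n = Σ< N (λ k → power f k n * inv! k)

    exp-truncate : ∀ {n b} → n ℕ.≤ b → truncatedExp (suc b) n ≈ exp f n
    exp-truncate {n} {b} n≤b = ≡.subst (λ b → truncatedExp (suc b) n ≈ exp f n) (ℕₚ.m+[n∸m]≡n n≤b) (extend (b ℕ.∸ n))
      where
      extend : ∀ d → truncatedExp (suc (n ℕ.+ d)) n ≈ exp f n
      extend zero    = ≡⇒≈ (≡.cong (λ m → truncatedExp (suc m) n) (ℕₚ.+-identityʳ n))
      extend (suc d) = begin
        truncatedExp (suc (n ℕ.+ suc d)) n       ≈⟨ ≡⇒≈ (≡.cong (λ m → truncatedExp (suc m) n) (ℕₚ.+-suc n d)) ⟩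
        truncatedExp (suc (suc (n ℕ.+ d))) n     ≈⟨ +-congˡ (trans (*-congʳ (power-vanish (suc (n ℕ.+ d)) n (s≤s (ℕₚ.m≤m+n n d)))) (zeroˡ _)) ⟩
        truncatedExp (suc (n ℕ.+ d)) n + 0#      ≈⟨ +-identityʳ _ ⟩
        truncatedExp (suc (n ℕ.+ d)) n           ≈⟨ extend d ⟩
        exp f n                                  ∎

    LogDer-truncatedExp : ∀ b → LogDer b (θ f) (truncatedExp (suc b))
    LogDer-truncatedExp b n n≤b = begin
      fromℕ n * Σ< (suc b) (λ k → power f k n * inv! k)                   ≈⟨ sym (Σ<-* (suc b) _ _) ⟩
      Σ< (suc b) (λ k → fromℕ n * (power f k n * inv! k))                 ≈⟨ Σ<-cong (suc b) (λ k → sym (*-assoc _ _ _)) ⟩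
      Σ< (suc b) (λ k → θ (power f k) n * inv! k)                         ≈⟨ Σ<-shift b _ ⟩
      θ (constant 1#) n * inv! 0 + Σ< b (λ k → θ (power f (suc k)) n * inv! (suc k))
        ≈⟨ +-cong (trans (*-congʳ (θ-constant 1# n)) (zeroˡ _)) (Σ<-cong b term) ⟩
      0# + Σ< b (λ k → (θ f ⊛ power f k) n * inv! k)                      ≈⟨ +-comm _ _ ⟩
      Σ< b (λ k → (θ f ⊛ power f k) n * inv! k) + 0#
        -- The zero is traded for the term k = b: `power f b` starts in degree b and `θ f` in degree
        -- 1, so their product has nothing in degree n ≤ b.
        ≈⟨ +-congˡ (sym (trans (*-congʳ (⊛-vanish (θ f) (power f b) b n (θ-0 f) (power-vanish b) n≤b)) (zeroˡ _))) ⟩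
      Σ< (suc b) (λ k → (θ f ⊛ power f k) n * inv! k)                     ≈⟨ Σ<-cong (suc b) (λ k → sym (diag-*ʳ n (inv! k) _)) ⟩
      Σ< (suc b) (λ k → diag n (λ i j → θ f i * power f k j * inv! k))    ≈⟨ sym (diag-Σ< n (suc b) _) ⟩
      diag n (λ i j → Σ< (suc b) (λ k → θ f i * power f k j * inv! k))
        ≈⟨ diag-cong′ n (λ i j → trans (Σ<-cong (suc b) λ k → *-assoc _ _ _) (Σ<-* (suc b) _ _)) ⟩
      (θ f ⊛ truncatedExp (suc b)) n                                      ∎
      where
      term : ∀ k → θ (power f (suc k)) n * inv! (suc k) ≈ (θ f ⊛ power f k) n * inv! k
      term k = trans (*-congʳ (θ-power k n))
        (trans (solve 3 (λ a b c → a :* b :* c := b :* (a :* c)) refl _ _ _) (*-congˡ (inv!-suc k)))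

    exp-0 : exp f 0 ≈ 1#
    exp-0 = trans (+-identityˡ _) (trans (*-identityˡ _) inv!-0)

    LogDer⇒exp : ∀ {b A} → LogDer b (θ f) A → ∀ n → n ℕ.≤ b → A n ≈ A 0 * exp f n
    LogDer⇒exp {b} {A} der n n≤b = trans
      (LogDer-unique (θ-0 f) der (LogDer-* (A 0) (LogDer-truncatedExp b))
        (sym (trans (*-congˡ (trans (exp-truncate z≤n) exp-0)) (*-identityʳ _))) n n≤b)
      (*-congˡ (exp-truncate n≤b))

  -- Kronecker's delta; `δ a` is the monomial tᵃ as a series. Thus `δ-subst` is θtᵃ = a tᵃ and
  -- `δ-diag` is tᵃ tᵇ = tᵃ⁺ᵇ.
  δ : ℕ → ℕ → Carrier
  δ zero    zero    = 1#
  δ zero    (suc b) = 0#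
  δ (suc a) zero    = 0#
  δ (suc a) (suc b) = δ a b

  δ-< : ∀ {a b} → b ℕ.< a → δ a b ≈ 0#
  δ-< {suc a} {zero}  b<a       = refl
  δ-< {suc a} {suc b} (s≤s b<a) = δ-< b<a

  δ-subst : ∀ a b → fromℕ b * δ a b ≈ fromℕ a * δ a b
  δ-subst zero    zero    = refl
  δ-subst zero    (suc b) = trans (zeroʳ _) (sym (zeroʳ _))
  δ-subst (suc a) zero    = trans (zeroʳ _) (sym (zeroʳ _))
  δ-subst (suc a) (suc b) = trans (distribʳ _ _ _) (trans (+-congˡ (δ-subst a b)) (sym (distribʳ _ _ _)))

  δ-diag : ∀ a b n → diag n (λ i j → δ a i * δ b j) ≈ δ (a ℕ.+ b) n
  δ-diag zero    b zero    = *-identityˡ _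
  δ-diag zero    b (suc n) = trans (+-cong (*-identityˡ _) (trans (diag-cong′ n λ i j → zeroˡ _) (diag-zero n))) (+-identityʳ _)
  δ-diag (suc a) b zero    = zeroˡ _
  δ-diag (suc a) b (suc n) = trans (+-cong (zeroˡ _) (δ-diag a b n)) (+-identityˡ _)

  δ-Σ< : ∀ N n f → n ℕ.< N → Σ< N (λ k → δ k n * f k) ≈ f n
  δ-Σ< (suc N) zero    f n<N = begin
    Σ< (suc N) (λ k → δ k 0 * f k)              ≈⟨ Σ<-shift N _ ⟩
    1# * f 0 + Σ< N (λ k → 0# * f (suc k))      ≈⟨ +-cong (*-identityˡ _) (trans (Σ<-cong N λ k → zeroˡ _) (Σ<-zero N)) ⟩
    f 0 + 0#                                    ≈⟨ +-identityʳ _ ⟩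
    f 0                                         ∎
  δ-Σ< (suc N) (suc n) f (s≤s n<N) = begin
    Σ< (suc N) (λ k → δ k (suc n) * f k)            ≈⟨ Σ<-shift N _ ⟩
    0# * f 0 + Σ< N (λ k → δ k n * f (suc k))       ≈⟨ +-cong (zeroˡ _) (δ-Σ< N n (λ k → f (suc k)) n<N) ⟩
    0# + f (suc n)                                  ≈⟨ +-identityˡ _ ⟩
    f (suc n)                                       ∎

  -- exp(y tᵈ) up to degree b
  expMonomial : ℕ → ℕ → Carrier → ℕ → Carrier
  expMonomial b d y n = Σ< (suc b) (λ k → δ (d ℕ.* k) n * (y ^ k * inv! k))

  -- Under θ the term of index k + 1 gains the factor d(k + 1), and k + 1 cancels against the
  -- factorial, leaving d y tᵈ times the term of index k. The missing top term would have degree d +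
  -- d b, which exceeds b because d ≥ 1.
  LogDer-expMonomial : ∀ b d y → 1 ℕ.≤ d → LogDer b (λ n → δ d n * (fromℕ d * y)) (expMonomial b d y)
  LogDer-expMonomial b d y 1≤d n n≤b = begin
    fromℕ n * Σ< (suc b) (λ k → δ (d ℕ.* k) n * g k)              ≈⟨ sym (Σ<-* (suc b) _ _) ⟩
    Σ< (suc b) (λ k → fromℕ n * (δ (d ℕ.* k) n * g k))            ≈⟨ Σ<-cong (suc b) (λ k → trans (sym (*-assoc _ _ _)) (*-congʳ (δ-subst (d ℕ.* k) n))) ⟩
    Σ< (suc b) (λ k → fromℕ (d ℕ.* k) * δ (d ℕ.* k) n * g k)      ≈⟨ Σ<-shift b _ ⟩
    fromℕ (d ℕ.* 0) * δ (d ℕ.* 0) n * g 0 + Σ< b (λ k → fromℕ (d ℕ.* suc k) * δ (d ℕ.* suc k) n * g (suc k))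
      ≈⟨ +-cong first (Σ<-cong b term) ⟩
    0# + Σ< b (λ k → δ (d ℕ.+ d ℕ.* k) n * (fromℕ d * y * g k))   ≈⟨ +-comm _ _ ⟩
    Σ< b (λ k → δ (d ℕ.+ d ℕ.* k) n * (fromℕ d * y * g k)) + 0#   ≈⟨ +-congˡ (sym (trans (*-congʳ (δ-< beyond)) (zeroˡ _))) ⟩
    Σ< (suc b) (λ k → δ (d ℕ.+ d ℕ.* k) n * (fromℕ d * y * g k))  ≈⟨ Σ<-cong (suc b) (λ k → trans (*-congʳ (sym (δ-diag d (d ℕ.* k) n))) (sym (diag-*ʳ n _ _))) ⟩
    Σ< (suc b) (λ k → diag n (λ i j → δ d i * δ (d ℕ.* k) j * (fromℕ d * y * g k)))  ≈⟨ sym (diag-Σ< n (suc b) _) ⟩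
    diag n (λ i j → Σ< (suc b) (λ k → δ d i * δ (d ℕ.* k) j * (fromℕ d * y * g k)))
      ≈⟨ diag-cong′ n (λ i j → trans (Σ<-cong (suc b) λ k → solve 4 (λ a b c g → a :* b :* (c :* g) := a :* c :* (b :* g)) refl _ _ _ _) (Σ<-* (suc b) _ _)) ⟩
    diag n (λ i j → δ d i * (fromℕ d * y) * expMonomial b d y j)   ∎
    where
    g : ℕ → Carrier
    g k = y ^ k * inv! k
    first : fromℕ (d ℕ.* 0) * δ (d ℕ.* 0) n * g 0 ≈ 0#
    first = trans (*-congʳ (trans (*-congʳ (≡⇒≈ (≡.cong fromℕ (ℕₚ.*-zeroʳ d)))) (zeroˡ _))) (zeroˡ _)
    term : ∀ k → fromℕ (d ℕ.* suc k) * δ (d ℕ.* suc k) n * g (suc k) ≈ δ (d ℕ.+ d ℕ.* k) n * (fromℕ d * y * g k)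
    term k = begin
      fromℕ (d ℕ.* suc k) * δ (d ℕ.* suc k) n * (y * y ^ k * inv! (suc k))
        ≈⟨ *-congʳ (*-cong (fromℕ-* d (suc k)) (≡⇒≈ (≡.cong (λ e → δ e n) (ℕₚ.*-suc d k)))) ⟩
      fromℕ d * fromℕ (suc k) * δ (d ℕ.+ d ℕ.* k) n * (y * y ^ k * inv! (suc k))
        ≈⟨ solve 6 (λ d k e y p i → d :* k :* e :* (y :* p :* i) := e :* (d :* y :* (p :* (k :* i)))) refl _ _ _ _ _ _ ⟩
      δ (d ℕ.+ d ℕ.* k) n * (fromℕ d * y * (y ^ k * (fromℕ (suc k) * inv! (suc k))))
        ≈⟨ *-congˡ (*-congˡ (*-congˡ (inv!-suc k))) ⟩
      δ (d ℕ.+ d ℕ.* k) n * (fromℕ d * y * g k)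
        ∎
    beyond : n ℕ.< d ℕ.+ d ℕ.* b
    beyond = ℕₚ.≤-trans (s≤s n≤b) (ℕₚ.+-mono-≤ 1≤d (≡.subst (ℕ._≤ d ℕ.* b) (ℕₚ.*-identityˡ b) (ℕₚ.*-monoˡ-≤ b 1≤d)))

  expMonomial-0 : ∀ b d y → 1 ℕ.≤ d → expMonomial b d y 0 ≈ 1#
  expMonomial-0 b (suc d) y 1≤d = begin
    Σ< (suc b) (λ k → δ (suc d ℕ.* k) 0 * (y ^ k * inv! k))    ≈⟨ Σ<-shift b _ ⟩
    δ (suc d ℕ.* 0) 0 * (1# * inv! 0) + Σ< b (λ k → 0# * (y ^ suc k * inv! (suc k)))
      ≈⟨ +-cong (*-cong (≡⇒≈ (≡.cong (λ e → δ e 0) (ℕₚ.*-zeroʳ d))) (trans (*-identityˡ _) inv!-0)) (trans (Σ<-cong b λ k → zeroˡ _) (Σ<-zero b)) ⟩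
    1# * 1# + 0#                                               ≈⟨ trans (+-identityʳ _) (*-identityʳ _) ⟩
    1#                                                         ∎

  expLinear : Carrier → ℕ → Carrier
  expLinear x n = x ^ n * inv! n

  LogDer-expLinear : ∀ b x → LogDer b (λ n → δ 1 n * (fromℕ 1 * x)) (expLinear x)
  LogDer-expLinear b x = LogDer-cong (λ _ _ → refl)
    (λ n n≤b → trans (Σ<-cong (suc b) λ k → *-congʳ (≡⇒≈ (≡.cong (λ e → δ e n) (ℕₚ.*-identityˡ k)))) (δ-Σ< (suc b) n _ (s≤s n≤b)))
    (LogDer-expMonomial b 1 x ℕₚ.≤-refl)

  -- The binomial theorem in the form eˣᵗ eʸᵗ = e⁽ˣ⁺ʸ⁾ᵗ. Both sides have logarithmic derivative (x +
  -- y)t and constant term 1, so binomial coefficients never appear.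
  expLinear-+ : ∀ x y n → (expLinear x ⊛ expLinear y) n ≈ expLinear (x + y) n
  expLinear-+ x y n = LogDer-unique (zeroˡ _)
    (LogDer-cong (λ m _ → solve 4 (λ d e x y → d :* (e :* x) :+ d :* (e :* y) := d :* (e :* (x :+ y))) refl _ _ _ _) (λ _ _ → refl)
      (LogDer-⊛ (LogDer-expLinear n x) (LogDer-expLinear n y)))
    (LogDer-expLinear n (x + y))
    (trans (*-cong (*-identityˡ _) (*-identityˡ _)) (trans (*-congˡ inv!-0) (trans (*-identityʳ _) (sym (*-identityˡ _)))))
    n ℕₚ.≤-refl

  egf≥1 : (ℕ → Carrier) → ℕ → Carrier
  egf≥1 u zero    = 0#
  egf≥1 u (suc m) = u (suc m) * inv! (suc m)

  power-cong : ∀ {f g} → (∀ n → f n ≈ g n) → ∀ k n → power f k n ≈ power g k n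
  power-cong f≈g zero    n = refl
  power-cong f≈g (suc k) n = ⊛-cong n f≈g (power-cong f≈g k)

  exp-cong : ∀ {f g} → (∀ n → f n ≈ g n) → ∀ n → exp f n ≈ exp g n
  exp-cong f≈g n = Σ<-cong (suc n) λ k → *-congʳ (power-cong f≈g k n)

-- Sums over lists and the Bell polynomials.

module ListSums {c ℓ} (R : CommutativeRing c ℓ) where
  open FiniteSums R
  open SetoidReasoning setoid

  Σ∈ : ∀ {b} {B : Set b} → List B → (B → Carrier) → Carrier
  Σ∈ xs f = List.foldr (λ x s → f x + s) 0# xs

  Σ∈-cong : ∀ {b} {B : Set b} (xs : List B) {f g : B → Carrier} → (∀ x → f x ≈ g x) → Σ∈ xs f ≈ Σ∈ xs g
  Σ∈-cong []       f≈g = refl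
  Σ∈-cong (x ∷ xs) f≈g = +-cong (f≈g x) (Σ∈-cong xs f≈g)

  Σ∈-* : ∀ {b} {B : Set b} (xs : List B) x f → Σ∈ xs (λ k → x * f k) ≈ x * Σ∈ xs f
  Σ∈-* []       x f = sym (zeroʳ x)
  Σ∈-* (_ ∷ xs) x f = trans (+-congˡ (Σ∈-* xs x f)) (sym (distribˡ x _ _))

  Σ∈-++ : ∀ {b} {B : Set b} (xs ys : List B) f → Σ∈ (xs ++ ys) f ≈ Σ∈ xs f + Σ∈ ys f
  Σ∈-++ []       ys f = sym (+-identityˡ _)
  Σ∈-++ (x ∷ xs) ys f = trans (+-congˡ (Σ∈-++ xs ys f)) (sym (+-assoc _ _ _))

  Σ∈-map : ∀ {b d} {B : Set b} {D : Set d} (g : B → D) (xs : List B) f → Σ∈ (List.map g xs) f ≡ Σ∈ xs (λ x → f (g x))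
  Σ∈-map g []       f = ≡.refl
  Σ∈-map g (x ∷ xs) f = ≡.cong (f (g x) +_) (Σ∈-map g xs f)

  Σ∈-product : ∀ {b d e} {B : Set b} {D : Set d} {E : Set e} (g : B → D → E) xs ys f →
    Σ∈ (cartesianProductWith g xs ys) f ≈ Σ∈ xs (λ x → Σ∈ ys (λ y → f (g x y)))
  Σ∈-product g []       ys f = refl
  Σ∈-product g (x ∷ xs) ys f = trans (Σ∈-++ (List.map (g x) ys) _ f)
    (+-cong (≡⇒≈ (Σ∈-map (g x) ys f)) (Σ∈-product g xs ys f))

  Σ∈-applyUpTo : ∀ {b} {B : Set b} (g : ℕ → B) N f → Σ∈ (applyUpTo g N) f ≈ Σ< N (λ n → f (g n))
  Σ∈-applyUpTo g zero    f = refl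
  Σ∈-applyUpTo g (suc N) f = trans (+-congˡ (Σ∈-applyUpTo (λ n → g (suc n)) N f)) (sym (Σ<-shift N _))

  Σ∈-filter : ∀ {b p} {B : Set b} {P : Pred B p} (P? : Decidable P) xs f →
    Σ∈ (filter P? xs) f ≈ Σ∈ xs (λ x → if does (P? x) then f x else 0#)
  Σ∈-filter P? []       f = refl
  Σ∈-filter P? (x ∷ xs) f with P? x
  ... | true  because _ = +-congˡ (Σ∈-filter P? xs f)
  ... | false because _ = trans (Σ∈-filter P? xs f) (sym (+-identityˡ _))

  diag-Σ∈ : ∀ {b} {B : Set b} n (xs : List B) (F : ℕ → ℕ → B → Carrier) →
    diag n (λ i j → Σ∈ xs (F i j)) ≈ Σ∈ xs (λ k → diag n (λ i j → F i j k))
  diag-Σ∈ n []       F = diag-zero n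
  diag-Σ∈ n (x ∷ xs) F = trans (diag-+ n _ _) (+-congˡ (diag-Σ∈ n xs F))

  Σ∈-*-Σ∈ : ∀ {b d} {B : Set b} {D : Set d} (xs : List B) (ys : List D) f g →
    Σ∈ xs (λ x → Σ∈ ys (λ y → f x * g y)) ≈ Σ∈ xs f * Σ∈ ys g
  Σ∈-*-Σ∈ []       ys f g = sym (zeroˡ _)
  Σ∈-*-Σ∈ (x ∷ xs) ys f g = trans (+-cong (Σ∈-* ys (f x) g) (Σ∈-*-Σ∈ xs ys f g)) (sym (distribʳ _ _ _))

-- The generating function of the Bell sums over (k₁, …, k_L) is Π exp(yᵢ t^cᵢ), where the part
-- sizes cᵢ are kept arbitrary so that the induction on L can drop the first one.
module BellSums {r ℓ} (R : CommutativeRing r ℓ) (F : InverseFactorials R) where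
  open FiniteSums R
  open ListSums R
  open InverseFactorials F
  open ExponentialFormula R F
  open SetoidReasoning setoid
  open RawSemiringDefs (Semiring.rawSemiring semiring) using (product)

  boundedTuples : ∀ m → ℕ → List (Vector ℕ m)
  boundedTuples zero    b = Vector.[] ∷ []
  boundedTuples (suc m) b = cartesianProductWith Vector._∷_ (upTo (suc b)) (boundedTuples m b)

  weight : ∀ {m} → Vector ℕ m → Vector ℕ m → ℕ
  weight c k = Vector.foldr ℕ._+_ 0 (λ i → c i ℕ.* k i)

  monomial : ∀ {m} → Vector Carrier m → Vector ℕ m → Carrier
  monomial y k = product (λ i → inv! (k i)) * product (λ i → y i ^ k i)

  bellSeries : ∀ {m} → ℕ → Vector ℕ m → Vector Carrier m → ℕ → Carrier
  bellSeries {m} b c y n = Σ∈ (boundedTuples m b) (λ k → δ (weight c k) n * monomial y k)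

  weightedParts : ∀ {m} → Vector ℕ m → Vector Carrier m → ℕ → Carrier
  weightedParts {zero}  c y n = 0#
  weightedParts {suc m} c y n = δ (Vector.head c) n * (fromℕ (Vector.head c) * Vector.head y)
    + weightedParts (Vector.tail c) (Vector.tail y) n

  -- The bounded tuples form a Cartesian product, so the sum over them factors; convolving the two
  -- monomials adds the contribution of the first entry to the weight of the rest.
  bellSeries-suc : ∀ {m} b (c : Vector ℕ (suc m)) y n →
    (expMonomial b (Vector.head c) (Vector.head y) ⊛ bellSeries b (Vector.tail c) (Vector.tail y)) n ≈ bellSeries b c y n
  bellSeries-suc {m} b c y n = begin
    diag n (λ i j → Σ< (suc b) (λ k → δ (c₀ ℕ.* k) i * (y₀ ^ k * inv! k)) * bellSeries b c′ y′ j)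
      ≈⟨ diag-cong′ n (λ i j → trans (*-congʳ (sym (Σ∈-applyUpTo (λ k → k) (suc b) _))) (sym (Σ∈-*-Σ∈ (upTo (suc b)) ks _ _))) ⟩
    diag n (λ i j → Σ∈ (upTo (suc b)) (λ k₀ → Σ∈ ks (λ k → δ (c₀ ℕ.* k₀) i * (y₀ ^ k₀ * inv! k₀) * (δ (weight c′ k) j * monomial y′ k))))
      ≈⟨ trans (diag-Σ∈ n (upTo (suc b)) _) (Σ∈-cong (upTo (suc b)) λ k₀ → diag-Σ∈ n ks _) ⟩
    Σ∈ (upTo (suc b)) (λ k₀ → Σ∈ ks (λ k → diag n (λ i j → δ (c₀ ℕ.* k₀) i * (y₀ ^ k₀ * inv! k₀) * (δ (weight c′ k) j * monomial y′ k))))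
      ≈⟨ Σ∈-cong (upTo (suc b)) (λ k₀ → Σ∈-cong ks (term k₀)) ⟩
    Σ∈ (upTo (suc b)) (λ k₀ → Σ∈ ks (λ k → δ (weight c (k₀ Vector.∷ k)) n * monomial y (k₀ Vector.∷ k)))
      ≈⟨ sym (Σ∈-product Vector._∷_ (upTo (suc b)) ks _) ⟩
    bellSeries b c y n ∎
    where
    c₀ = Vector.head c
    c′ = Vector.tail c
    y₀ = Vector.head y
    y′ = Vector.tail y
    ks = boundedTuples m b
    term : ∀ k₀ k → diag n (λ i j → δ (c₀ ℕ.* k₀) i * (y₀ ^ k₀ * inv! k₀) * (δ (weight c′ k) j * monomial y′ k))
      ≈ δ (weight c (k₀ Vector.∷ k)) n * monomial y (k₀ Vector.∷ k)
    term k₀ k = begin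
      diag n (λ i j → δ (c₀ ℕ.* k₀) i * (y₀ ^ k₀ * inv! k₀) * (δ (weight c′ k) j * monomial y′ k))
        ≈⟨ diag-cong′ n (λ i j → solve 6 (λ d e p i a b → d :* (p :* i) :* (e :* (a :* b)) := d :* e :* (i :* a :* (p :* b))) refl _ _ _ _ _ _) ⟩
      diag n (λ i j → δ (c₀ ℕ.* k₀) i * δ (weight c′ k) j * monomial y (k₀ Vector.∷ k))
        ≈⟨ trans (diag-*ʳ n _ _) (*-congʳ (δ-diag (c₀ ℕ.* k₀) (weight c′ k) n)) ⟩
      δ (weight c (k₀ Vector.∷ k)) n * monomial y (k₀ Vector.∷ k) ∎

  LogDer-bellSeries : ∀ {m} b (c : Vector ℕ m) y → (∀ i → 1 ℕ.≤ c i) → LogDer b (weightedParts c y) (bellSeries b c y)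
  LogDer-bellSeries {zero}  b c y 1≤c n n≤b = begin
    fromℕ n * (δ 0 n * (1# * 1#) + 0#)   ≈⟨ solve 2 (λ n d → n :* (d :* (con (1 , 0) :* con (1 , 0)) :+ con (0 , 0)) := n :* d) refl _ _ ⟩
    fromℕ n * δ 0 n                      ≈⟨ trans (δ-subst 0 n) (zeroˡ _) ⟩
    0#                                   ≈⟨ sym (trans (diag-cong′ n λ i j → zeroˡ _) (diag-zero n)) ⟩
    diag n (λ i j → 0# * bellSeries b c y j) ∎
  LogDer-bellSeries {suc m} b c y 1≤c = LogDer-cong (λ _ _ → refl) (λ n _ → bellSeries-suc b c y n)
    (LogDer-⊛ (LogDer-expMonomial b (Vector.head c) (Vector.head y) (1≤c Fin.zero))
              (LogDer-bellSeries b (Vector.tail c) (Vector.tail y) (λ i → 1≤c (Fin.suc i))))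

  bellSeries-0 : ∀ {m} b (c : Vector ℕ m) y → (∀ i → 1 ℕ.≤ c i) → bellSeries b c y 0 ≈ 1#
  bellSeries-0 {zero}  b c y 1≤c = solve 0 (con (1 , 0) :* (con (1 , 0) :* con (1 , 0)) :+ con (0 , 0) := con (1 , 0)) refl
  bellSeries-0 {suc m} b c y 1≤c = trans (sym (bellSeries-suc b c y 0))
    (trans (*-cong (expMonomial-0 b (Vector.head c) (Vector.head y) (1≤c Fin.zero)) (bellSeries-0 b (Vector.tail c) (Vector.tail y) (λ i → 1≤c (Fin.suc i))))
      (*-identityʳ _))

  if-≟ : ∀ a b x → (if does (a ℕₚ.≟ b) then x else 0#) ≈ δ a b * x
  if-≟ zero    zero    x = sym (*-identityˡ x)
  if-≟ zero    (suc b) x = sym (zeroˡ x)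
  if-≟ (suc a) zero    x = sym (zeroˡ x)
  if-≟ (suc a) (suc b) x = if-≟ a b x

  weightedParts-toℕ : ∀ m o (f : ℕ → Carrier) n → n ℕ.< m →
    weightedParts {m} (λ i → o ℕ.+ toℕ i) (λ i → f (toℕ i)) (o ℕ.+ n) ≈ fromℕ (o ℕ.+ n) * f n
  weightedParts-toℕ m o f n n<m = trans (generic m (λ k → o ℕ.+ k) f (o ℕ.+ n)) (trans (Σ<-cong m select) (δ-Σ< m n _ n<m))
    where
    generic : ∀ m (g : ℕ → ℕ) (f : ℕ → Carrier) n → weightedParts {m} (λ i → g (toℕ i)) (λ i → f (toℕ i)) n ≈ Σ< m (λ k → δ (g k) n * (fromℕ (g k) * f k))
    generic zero    g f n = refl
    generic (suc m) g f n = trans (+-congˡ (generic m (λ k → g (suc k)) (λ k → f (suc k)) n)) (sym (Σ<-shift m _))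
    cancel-δ : ∀ o k → δ (o ℕ.+ k) (o ℕ.+ n) ≡ δ k n
    cancel-δ zero    k = ≡.refl
    cancel-δ (suc o) k = cancel-δ o k
    select : ∀ k → δ (o ℕ.+ k) (o ℕ.+ n) * (fromℕ (o ℕ.+ k) * f k) ≈ δ k n * (fromℕ (o ℕ.+ k) * f k)
    select k = *-congʳ (≡⇒≈ (cancel-δ o k))

  bellPolynomial : ∀ m → Vector Carrier m → Carrier
  bellPolynomial m y = Σ∈ (filter (λ k → weight (λ i → suc (toℕ i)) k ℕₚ.≟ m) (boundedTuples m m))
    (λ k → fromℕ (m !) * product (λ i → inv! (k i)) * product (λ i → y i ^ k i))

  -- With parts 1, ..., m the logarithmic derivative of the product of exponentials is
  -- `Σ_{d≤m} d f_d tᵈ`. It agrees with θf only up to degree m, which suffices since only the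
  -- coefficient of tᵐ is read off.
  bellPolynomial≈exp : ∀ m f → f 0 ≈ 0# → bellPolynomial m (λ i → f (suc (toℕ i))) ≈ fromℕ (m !) * exp f m
  bellPolynomial≈exp m f f₀ = begin
    bellPolynomial m y              ≈⟨ Σ∈-filter (λ k → weight c k ℕₚ.≟ m) (boundedTuples m m) _ ⟩
    Σ∈ (boundedTuples m m) (λ k → if does (weight c k ℕₚ.≟ m) then fromℕ (m !) * product (λ i → inv! (k i)) * product (λ i → y i ^ k i) else 0#)
                                    ≈⟨ Σ∈-cong (boundedTuples m m) indicator ⟩
    Σ∈ (boundedTuples m m) (λ k → fromℕ (m !) * (δ (weight c k) m * monomial y k))
                                    ≈⟨ Σ∈-* (boundedTuples m m) _ _ ⟩
    fromℕ (m !) * bellSeries m c y m ≈⟨ *-congˡ (LogDer⇒exp f f₀ der m ℕₚ.≤-refl) ⟩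
    fromℕ (m !) * (bellSeries m c y 0 * exp f m) ≈⟨ *-congˡ (trans (*-congʳ (bellSeries-0 m c y λ i → s≤s z≤n)) (*-identityˡ _)) ⟩
    fromℕ (m !) * exp f m           ∎
    where
    c : Vector ℕ m
    c i = suc (toℕ i)
    y : Vector Carrier m
    y i = f (suc (toℕ i))
    indicator : ∀ k → (if does (weight c k ℕₚ.≟ m) then fromℕ (m !) * product (λ i → inv! (k i)) * product (λ i → y i ^ k i) else 0#)
      ≈ fromℕ (m !) * (δ (weight c k) m * monomial y k)
    indicator k = trans (if-≟ (weight c k) m _)
      (solve 4 (λ d n a b → d :* (n :* a :* b) := n :* (d :* (a :* b))) refl _ _ _ _)
    parts : ∀ n → n ℕ.≤ m → weightedParts c y n ≈ θ f n
    parts zero    n≤m = trans (vanish m (λ i → toℕ i) y) (sym (θ-0 f))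
      where
      vanish : ∀ m (g : Vector ℕ m) y → weightedParts {m} (λ i → suc (g i)) y 0 ≈ 0#
      vanish zero    g y = refl
      vanish (suc m) g y = trans (+-cong (zeroˡ _) (vanish m (Vector.tail g) (Vector.tail y))) (+-identityʳ _)
    parts (suc n) n<m = weightedParts-toℕ m 1 (λ k → f (suc k)) n n<m
    der : LogDer m (θ f) (bellSeries m c y)
    der = LogDer-cong parts (λ _ _ → refl) (LogDer-bellSeries m c y λ i → s≤s z≤n)

-- Limits and geometrically bounded series in a complete normed ring.

-- z ⊑ r stands for ∣z∣ ≤ r, so that no square root is needed to speak about absolute values.
record Norm {c ℓ₁ ℓ₂ r ℓ} (F : OrderedField c ℓ₁ ℓ₂) (A : CommutativeRing r ℓ) : Set (lsuc (c ⊔ ℓ₁ ⊔ ℓ₂ ⊔ r ⊔ ℓ)) where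
  private module R = OrderedFieldFacts F
  open CommutativeRing A
  infix 4 _⊑_
  field
    _⊑_         : Carrier → R.Carrier → Set ℓ₂
    archimedean : ∀ x → ∃[ n ] (x R.< R.fromℕ n)
    ⊑-resp      : ∀ {z w x y} → z ≈ w → x R.≤ y → z ⊑ x → w ⊑ y
    ⊑⇒nonneg    : ∀ {z x} → z ⊑ x → R.0# R.≤ x
    ⊑-0         : 0# ⊑ R.0#
    ⊑-1         : 1# ⊑ R.1#
    ⊑-neg       : ∀ {z x} → z ⊑ x → - z ⊑ x
    ⊑-+         : ∀ {z w x y} → z ⊑ x → w ⊑ y → z + w ⊑ x R.+ y
    ⊑-*         : ∀ {z w x y} → z ⊑ x → w ⊑ y → z * w ⊑ x R.* y
    bounded     : ∀ z → ∃[ x ] z ⊑ x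
    separated   : ∀ {z} → (∀ ε → R.0# R.< ε → z ⊑ ε) → z ≈ 0#
    complete    : (s : ℕ → Carrier) →
      (∀ ε → R.0# R.< ε → ∃[ N ] (∀ m n → N ℕ.≤ m → N ℕ.≤ n → s m - s n ⊑ ε)) →
      ∃[ l ] (∀ ε → R.0# R.< ε → ∃[ N ] (∀ n → N ℕ.≤ n → s n - l ⊑ ε))

module Limits {c ℓ₁ ℓ₂ r ℓ} (F : OrderedField c ℓ₁ ℓ₂) (A : CommutativeRing r ℓ) (V : Norm F A) where
  module R = OrderedFieldFacts F
  open Norm V public
  open FiniteSums A public
  open R using (Rate)
  open Rate
  open R.≤-Reasoning

  ⊑-resp-≈ : ∀ {z w x} → z ≈ w → z ⊑ x → w ⊑ x
  ⊑-resp-≈ z≈w = ⊑-resp z≈w R.≤-refl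

  ⊑-mono : ∀ {z x y} → x R.≤ y → z ⊑ x → z ⊑ y
  ⊑-mono = ⊑-resp refl

  ⊑-fromℕ : ∀ n → fromℕ n ⊑ R.fromℕ n
  ⊑-fromℕ zero    = ⊑-0
  ⊑-fromℕ (suc n) = ⊑-+ ⊑-1 (⊑-fromℕ n)

  ⊑-^ : ∀ {z x} n → z ⊑ x → z ^ n ⊑ x R.^ n
  ⊑-^ zero    z⊑x = ⊑-1
  ⊑-^ (suc n) z⊑x = ⊑-* z⊑x (⊑-^ n z⊑x)

  ⊑-diag : ∀ n {F : ℕ → ℕ → Carrier} {B} → (∀ i j → i ℕ.+ j ≡ n → F i j ⊑ B) → diag n F ⊑ R.fromℕ (suc n) R.* B
  ⊑-diag n bound = ⊑-mono (R.≤-reflexive (R.*-comm _ _)) (go n bound)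
    where
    go : ∀ n {F : ℕ → ℕ → Carrier} {B} → (∀ i j → i ℕ.+ j ≡ n → F i j ⊑ B) → diag n F ⊑ B R.* R.fromℕ (suc n)
    go zero    bound = ⊑-mono (R.≤-reflexive (R.solve 1 (λ b → b R.:= b R.:* (R.con (1 , 0) R.:+ R.con (0 , 0))) R.refl _)) (bound 0 0 ≡.refl)
    go (suc n) bound = ⊑-mono (R.≤-reflexive (R.solve 2 (λ b n → b R.:+ b R.:* n R.:= b R.:* (R.con (1 , 0) R.:+ n)) R.refl _ _))
      (⊑-+ (bound 0 (suc n) ≡.refl) (go n λ i j i+j≡n → bound (suc i) j (≡.cong suc i+j≡n)))

  Lim : (ℕ → Carrier) → Carrier → Set (c ⊔ ℓ₂)
  Lim s l = ∀ ε → R.0# R.< ε → ∃[ N ] (∀ n → N ℕ.≤ n → s n - l ⊑ ε)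

  lim-cong : ∀ {s t l m} → (∀ n → s n ≈ t n) → l ≈ m → Lim s l → Lim t m
  lim-cong s≈t l≈m lim ε 0<ε = proj₁ (lim ε 0<ε) , λ n N≤n →
    ⊑-resp-≈ (+-cong (s≈t n) (-‿cong l≈m)) (proj₂ (lim ε 0<ε) n N≤n)

  lim-unique : ∀ {s l m} → Lim s l → Lim s m → l ≈ m
  lim-unique {s} {l} {m} sl sm = trans (solve 2 (λ l m → l := m :+ (l :- m)) refl l m)
    (trans (+-congˡ (separated close)) (+-identityʳ m))
    where
    close : ∀ ε → R.0# R.< ε → l - m ⊑ ε
    close ε 0<ε =
      let N₁ , near₁ = sl (ε R.* R.½) (R.0<x*½ 0<ε)
          N₂ , near₂ = sm (ε R.* R.½) (R.0<x*½ 0<ε)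
      in ⊑-resp (solve 3 (λ a l m → :- (a :- l) :+ (a :- m) := l :- m) refl (s (N₁ ℕ.+ N₂)) l m)
      (R.≤-reflexive (R.halves ε))
      (⊑-+ (⊑-neg (near₁ (N₁ ℕ.+ N₂) (ℕₚ.m≤m+n N₁ N₂))) (near₂ (N₁ ℕ.+ N₂) (ℕₚ.m≤n+m N₂ N₁)))

  lim-const : ∀ x → Lim (λ _ → x) x
  lim-const x ε 0<ε = 0 , λ n _ → ⊑-resp (sym (-‿inverseʳ x)) (R.<⇒≤ 0<ε) ⊑-0

  lim-+ : ∀ {s t l m} → Lim s l → Lim t m → Lim (λ n → s n + t n) (l + m)
  lim-+ {s} {t} {l} {m} sl tm ε 0<ε =
    let N₁ , near₁ = sl (ε R.* R.½) (R.0<x*½ 0<ε)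
        N₂ , near₂ = tm (ε R.* R.½) (R.0<x*½ 0<ε)
    in N₁ ℕ.+ N₂ , λ n N≤n →
    ⊑-resp (solve 4 (λ a b l m → (a :- l) :+ (b :- m) := (a :+ b) :- (l :+ m)) refl (s n) (t n) l m) (R.≤-reflexive (R.halves ε))
      (⊑-+ (near₁ n (ℕₚ.≤-trans (ℕₚ.m≤m+n N₁ N₂) N≤n)) (near₂ n (ℕₚ.≤-trans (ℕₚ.m≤n+m N₂ N₁) N≤n)))

  lim-* : ∀ {s t l m} → Lim s l → Lim t m → Lim (λ n → s n * t n) (l * m)
  lim-* {s} {t} {l} {m} sl tm ε 0<ε = N₁ ℕ.+ (N₂ ℕ.+ N₃) , close
    where
    L M S ν : R.Carrier
    L = proj₁ (bounded l)
    M = proj₁ (bounded m)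
    S = R.1# R.+ (M R.+ L)
    0<S : R.0# R.< S
    0<S = R.+-pos-nonneg R.0<1 (R.+-nonneg (⊑⇒nonneg (proj₂ (bounded m))) (⊑⇒nonneg (proj₂ (bounded l))))
    -- From ab - lm = (a - l)(b - m) + (a - l)m + l(b - m). Bounding the first factor `b - m` by 1,
    -- through `N₃`, makes the total at most ν(1 + M + L).
    ν = R.recip S 0<S R.* ε
    0<ν : R.0# R.< ν
    0<ν = R.*-pos (R.recip-pos S 0<S) 0<ε
    N₁ N₂ N₃ : ℕ
    N₁ = proj₁ (sl ν 0<ν)
    N₂ = proj₁ (tm ν 0<ν)
    N₃ = proj₁ (tm R.1# R.0<1)
    size : ν R.* R.1# R.+ (ν R.* M R.+ L R.* ν) R.≤ ε
    size = begin
      ν R.* R.1# R.+ (ν R.* M R.+ L R.* ν) ≈⟨ R.solve 3 (λ d m l → d R.:* R.con (1 , 0) R.:+ (d R.:* m R.:+ l R.:* d) R.:= (R.con (1 , 0) R.:+ (m R.:+ l)) R.:* d) R.refl ν M L ⟩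
      S R.* (R.recip S 0<S R.* ε)          ≈⟨ R.trans (R.sym (R.*-assoc S _ ε)) (R.trans (R.*-congʳ (R.recip-inverseʳ S 0<S)) (R.*-identityˡ ε)) ⟩
      ε                                    ∎
    close : ∀ n → N₁ ℕ.+ (N₂ ℕ.+ N₃) ℕ.≤ n → s n * t n - l * m ⊑ ε
    close n N≤n = ⊑-resp (solve 4 (λ a b l m → (a :- l) :* (b :- m) :+ ((a :- l) :* m :+ l :* (b :- m)) := a :* b :- l :* m) refl (s n) (t n) l m) size
      (⊑-+ (⊑-* near₁ near₃) (⊑-+ (⊑-* near₁ (proj₂ (bounded m))) (⊑-* (proj₂ (bounded l)) near₂)))
      where
      N₂₃≤n : N₂ ℕ.+ N₃ ℕ.≤ n
      N₂₃≤n = ℕₚ.≤-trans (ℕₚ.m≤n+m _ N₁) N≤n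
      near₁ : s n - l ⊑ ν
      near₁ = proj₂ (sl ν 0<ν) n (ℕₚ.≤-trans (ℕₚ.m≤m+n N₁ _) N≤n)
      near₂ : t n - m ⊑ ν
      near₂ = proj₂ (tm ν 0<ν) n (ℕₚ.≤-trans (ℕₚ.m≤m+n N₂ N₃) N₂₃≤n)
      near₃ : t n - m ⊑ R.1#
      near₃ = proj₂ (tm R.1# R.0<1) n (ℕₚ.≤-trans (ℕₚ.m≤n+m N₃ N₂) N₂₃≤n)

  lim-*ˡ : ∀ x {s l} → Lim s l → Lim (λ n → x * s n) (x * l)
  lim-*ˡ x = lim-* (lim-const x)

  lim-neg : ∀ {s l} → Lim s l → Lim (λ n → - s n) (- l)
  lim-neg {s} {l} sl ε 0<ε = proj₁ (sl ε 0<ε) , λ n N≤n →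
    ⊑-resp-≈ (solve 2 (λ a l → :- (a :- l) := :- a :- :- l) refl (s n) l) (⊑-neg (proj₂ (sl ε 0<ε) n N≤n))

  lim-- : ∀ {s t l m} → Lim s l → Lim t m → Lim (λ n → s n - t n) (l - m)
  lim-- sl tm = lim-+ sl (lim-neg tm)

  lim-drop : ∀ k {s l} → Lim s l → Lim (λ n → s (k ℕ.+ n)) l
  lim-drop k sl ε 0<ε = proj₁ (sl ε 0<ε) , λ n N≤n → proj₂ (sl ε 0<ε) (k ℕ.+ n) (ℕₚ.≤-trans N≤n (ℕₚ.m≤n+m n k))

  lim-unsuc : ∀ {s l} → Lim (λ n → s (suc n)) l → Lim s l
  lim-unsuc {s} {l} lim ε 0<ε = suc (proj₁ (lim ε 0<ε)) , shifted
    where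
    shifted : ∀ n → suc (proj₁ (lim ε 0<ε)) ℕ.≤ n → s n - l ⊑ ε
    shifted (suc n) (s≤s N≤n) = proj₂ (lim ε 0<ε) n N≤n

  lim-diag : ∀ m {s : ℕ → ℕ → ℕ → Carrier} {l : ℕ → ℕ → Carrier} → (∀ i j → Lim (λ n → s n i j) (l i j)) →
    Lim (λ n → diag m (s n)) (diag m l)
  lim-diag zero    lim = lim 0 0
  lim-diag (suc m) lim = lim-+ (lim 0 (suc m)) (lim-diag m λ i j → lim (suc i) j)

  lim-geometric : ∀ {s l} C t → R.0# R.≤ C → (∀ n → s n - l ⊑ C R.* rate t R.^ n) → Lim s l
  lim-geometric C t 0≤C bound ε 0<ε =
    let N , small = R.geometric-null archimedean t C 0≤C ε 0<ε in N , λ n N≤n → ⊑-mono (small n N≤n) (bound n)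

  lim-near : ∀ {s l} → Lim s l → (D : ℕ → R.Carrier) → ∀ k → (∀ n → s (k ℕ.+ n) - s k ⊑ D k) → ∀ ε → R.0# R.< ε → l - s k ⊑ D k R.+ ε
  lim-near {s} {l} lim D k bound ε 0<ε =
    let N , near = lim ε 0<ε in ⊑-resp-≈ (solve 3 (λ a b l → (a :- b) :+ :- (a :- l) := l :- b) refl (s (k ℕ.+ N)) (s k) l)
    (⊑-+ (bound N) (⊑-neg (near (k ℕ.+ N) (ℕₚ.m≤n+m N k))))

  record Geometric (v : ℕ → Carrier) : Set (c ⊔ ℓ₂) where
    constructor geometric
    field
      constant : R.Carrier
      decay    : Rate
      0≤C      : R.0# R.≤ constant
      bound    : ∀ n → v n ⊑ constant R.* rate decay R.^ n

  Geometric-* : ∀ {u v : ℕ → Carrier} {B} → (∀ n → u n ⊑ B) → Geometric v → Geometric (λ n → u n * v n)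
  Geometric-* {B = B} u⊑B (geometric C s 0≤C bound) = geometric (B R.* C) s (R.*-nonneg (⊑⇒nonneg (u⊑B 0)) 0≤C)
    λ n → ⊑-mono (R.≤-reflexive (R.sym (R.*-assoc B C _))) (⊑-* (u⊑B n) (bound n))

  Geometric-suc : ∀ {v} → Geometric v → Geometric (λ n → v (suc n))
  Geometric-suc (geometric C s 0≤C bound) = geometric C s 0≤C λ n →
    ⊑-mono (R.*-monoʳ-≤ C 0≤C (R.^-antimono (nonneg s) (at-most-1 s) (ℕₚ.n≤1+n n))) (bound (suc n))

  Geometric-^ : ∀ s {z} → z ⊑ rate s → Geometric (z ^_)
  Geometric-^ s z⊑s = geometric R.1# s R.0≤1 λ n → ⊑-mono (R.≤-reflexive (R.sym (R.*-identityˡ _))) (⊑-^ n z⊑s)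

  Geometric-polynomial : ∀ k {v} → Geometric v → Geometric (λ n → fromℕ n ^ k * v n)
  Geometric-polynomial k (geometric C s 0≤C bound) =
    let D , t , 0≤D , growth = R.polynomial-geometric k s in geometric (C R.* D) t (R.*-nonneg 0≤C 0≤D) λ n → ⊑-mono
    (begin
      R.fromℕ n R.^ k R.* (C R.* rate s R.^ n)   ≈⟨ R.solve 3 (λ a c x → a R.:* (c R.:* x) R.:= c R.:* (a R.:* x)) R.refl _ _ _ ⟩
      C R.* (R.fromℕ n R.^ k R.* rate s R.^ n)   ≤⟨ R.*-monoʳ-≤ C 0≤C (growth n) ⟩
      C R.* (D R.* rate t R.^ n)                 ≈⟨ R.sym (R.*-assoc C D _) ⟩
      C R.* D R.* rate t R.^ n                   ∎)
    (⊑-* (⊑-^ k (⊑-fromℕ n)) (bound n))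

  Sum : (ℕ → Carrier) → Carrier → Set (c ⊔ ℓ₂)
  Sum v l = Lim (λ N → Σ< N v) l

  sum-cong : ∀ {u v l m} → (∀ n → u n ≈ v n) → l ≈ m → Sum u l → Sum v m
  sum-cong u≈v = lim-cong (λ N → Σ<-cong N u≈v)

  sum-*ˡ : ∀ x {v l} → Sum v l → Sum (λ n → x * v n) (x * l)
  sum-*ˡ x lim = lim-cong (λ N → sym (Σ<-* N x _)) refl (lim-*ˡ x lim)

  sum-suc : ∀ {v l} → Sum v l → Sum (λ n → v (suc n)) (l - v 0)
  sum-suc {v} {l} lim = lim-cong
    (λ N → trans (+-congʳ (Σ<-shift N v)) (solve 2 (λ a b → a :+ b :- a := b) refl _ _)) refl
    (lim-- (lim-drop 1 lim) (lim-const (v 0)))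

  block : ∀ M N (v : ℕ → Carrier) → Σ< (M ℕ.+ N) v - Σ< M v ≈ Σ< N (λ n → v (M ℕ.+ n))
  block M zero    v = trans (+-congʳ (≡⇒≈ (≡.cong (λ k → Σ< k v) (ℕₚ.+-identityʳ M)))) (-‿inverseʳ _)
  block M (suc N) v = trans (+-congʳ (≡⇒≈ (≡.cong (λ k → Σ< k v) (ℕₚ.+-suc M N))))
    (trans (solve 3 (λ a b c → a :+ b :- c := a :- c :+ b) refl _ _ _) (+-congʳ (block M N v)))

  tailConstant : R.Carrier → Rate → R.Carrier
  tailConstant C s = C R.* R.recip (R.1# R.- rate s) (R.0<1-rate s)

  tailConstant-nonneg : ∀ {C} s → R.0# R.≤ C → R.0# R.≤ tailConstant C s
  tailConstant-nonneg s 0≤C = R.*-nonneg 0≤C (R.<⇒≤ (R.recip-pos _ (R.0<1-rate s)))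

  module _ {v : ℕ → Carrier} (G : Geometric v) where
    open Geometric G renaming (constant to C; decay to s)
    private
      E : R.Carrier
      E = tailConstant C s
      σ : R.Carrier
      σ = rate s
      E-spec : E R.* (R.1# R.- σ) R.≈ C
      E-spec = R.trans (R.*-assoc C _ _) (R.trans (R.*-congˡ (R.trans (R.*-comm _ _) (R.recip-inverseʳ _ (R.0<1-rate s)))) (R.*-identityʳ C))
      E≥0 : R.0# R.≤ E
      E≥0 = tailConstant-nonneg s 0≤C

    block-bound : ∀ M N → Σ< N (λ n → v (M ℕ.+ n)) ⊑ E R.* σ R.^ M
    block-bound M N = ⊑-mono (R.x≤x+d (R.*-nonneg E≥0 (R.^-nonneg (M ℕ.+ N) (nonneg s)))
        (R.solve 2 (λ a b → a R.:= a R.:- b R.:+ b) R.refl _ _)) (telescope N)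
      where
      -- Because E(1 - σ) = C, each majorant C σⁿ equals E σⁿ - E σⁿ⁺¹. Keeping the subtracted end
      -- term makes the induction go through.
      telescope : ∀ N → Σ< N (λ n → v (M ℕ.+ n)) ⊑ E R.* σ R.^ M R.- E R.* σ R.^ (M ℕ.+ N)
      telescope zero    = ⊑-mono (R.≤-reflexive (R.trans (R.sym (R.-‿inverseʳ _)) (R.+-congˡ (R.-‿cong (R.*-congˡ (R.reflexive (≡.cong (σ R.^_) (≡.sym (ℕₚ.+-identityʳ M)))))))))
        ⊑-0
      telescope (suc N) = ⊑-mono (R.≤-reflexive (begin-equality
        E R.* σ R.^ M R.- E R.* σ R.^ (M ℕ.+ N) R.+ C R.* σ R.^ (M ℕ.+ N)
          ≈⟨ R.+-congˡ (R.*-congʳ (R.sym E-spec)) ⟩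
        E R.* σ R.^ M R.- E R.* σ R.^ (M ℕ.+ N) R.+ E R.* (R.1# R.- σ) R.* σ R.^ (M ℕ.+ N)
          ≈⟨ R.solve 4 (λ e a b s → e R.:* a R.:- e R.:* b R.:+ e R.:* (R.con (1 , 0) R.:- s) R.:* b R.:= e R.:* a R.:- e R.:* (s R.:* b)) R.refl E (σ R.^ M) (σ R.^ (M ℕ.+ N)) σ ⟩
        E R.* σ R.^ M R.- E R.* σ R.^ (suc (M ℕ.+ N))
          ≈⟨ R.+-congˡ (R.-‿cong (R.*-congˡ (R.reflexive (≡.cong (σ R.^_) (≡.sym (ℕₚ.+-suc M N)))))) ⟩
        E R.* σ R.^ M R.- E R.* σ R.^ (M ℕ.+ suc N) ∎))
        (⊑-+ (telescope N) (bound (M ℕ.+ N)))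

    partial-bound : ∀ M N → Σ< (M ℕ.+ N) v - Σ< M v ⊑ E R.* σ R.^ M
    partial-bound M N = ⊑-resp-≈ (sym (block M N v)) (block-bound M N)

    summable : ∃[ l ] Sum v l
    summable = complete (λ N → Σ< N v) λ ε 0<ε → cauchy ε (R.geometric-null archimedean s E E≥0 (ε R.* R.½) (R.0<x*½ 0<ε))
      where
      cauchy : ∀ ε → (∃[ N ] (∀ n → N ℕ.≤ n → E R.* σ R.^ n R.≤ ε R.* R.½)) →
        ∃[ N ] (∀ m n → N ℕ.≤ m → N ℕ.≤ n → Σ< m v - Σ< n v ⊑ ε)
      cauchy ε (N , small) = N , λ m n N≤m N≤n →
        ⊑-resp (solve 3 (λ a b c → (a :- c) :+ :- (b :- c) := a :- b) refl _ _ _) (R.≤-reflexive (R.halves ε)) (⊑-+ (from-N m N≤m) (⊑-neg (from-N n N≤n)))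
        where
        from-N : ∀ m → N ℕ.≤ m → Σ< m v - Σ< N v ⊑ ε R.* R.½
        from-N m N≤m = ≡.subst (λ k → Σ< k v - Σ< N v ⊑ ε R.* R.½) (ℕₚ.m+[n∸m]≡n N≤m)
          (⊑-mono (small N ℕₚ.≤-refl) (partial-bound N (m ℕ.∸ N)))

    -- The added 1 is slack: the axioms of `Norm` do not state that `_⊑_` is closed under limits, so
    -- the partial-sum bound passes to the limit up to an ε, taken to be `σ ^ k` itself.
    tail-bound : ∀ {l} → Sum v l → ∀ k → l - Σ< k v ⊑ (E R.+ R.1#) R.* σ R.^ k
    tail-bound lim k = ⊑-mono (R.≤-reflexive (R.solve 2 (λ e x → e R.:* x R.:+ x R.:= (e R.:+ R.con (1 , 0)) R.:* x) R.refl _ _))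
      (lim-near lim (λ k → E R.* σ R.^ k) k (partial-bound k) (σ R.^ k) (R.^-pos k (positive s)))

    sum-bound : ∀ {l} → Sum v l → l ⊑ E R.+ R.1#
    sum-bound lim = ⊑-resp (solve 1 (λ l → l :- con (0 , 0) := l) refl _) (R.≤-reflexive (R.*-identityʳ _)) (tail-bound lim 0)

  ⊑-Σ< : ∀ N {f : ℕ → Carrier} {B} → (∀ n → n ℕ.< N → f n ⊑ B) → Σ< N f ⊑ R.fromℕ N R.* B
  ⊑-Σ< zero    bound = ⊑-mono (R.≤-reflexive (R.sym (R.zeroˡ _))) ⊑-0
  ⊑-Σ< (suc N) bound = ⊑-mono (R.≤-reflexive (R.solve 2 (λ b n → n R.:* b R.:+ b R.:= (R.con (1 , 0) R.:+ n) R.:* b) R.refl _ _))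
    (⊑-+ (⊑-Σ< N λ n n<N → bound n (ℕₚ.m<n⇒m<1+n n<N)) (bound N ℕₚ.≤-refl))

-- Infinite products, geometric inverses and Cauchy products.

module Series {c ℓ₁ ℓ₂ r ℓ} (F : OrderedField c ℓ₁ ℓ₂) (A : CommutativeRing r ℓ) (V : Norm F A) where
  open Limits F A V public
  open R using (Rate)
  open Rate
  open R.≤-Reasoning

  module _ {ε : ℕ → Carrier} (G : Geometric ε) where
    open Geometric G renaming (constant to C; decay to s)
    private
      p : ℕ → Carrier
      p N = Π< N (λ n → 1# + ε n)

      π v : ℕ → R.Carrier
      π zero    = R.1#
      π (suc N) = π N R.* (R.1# R.+ C R.* rate s R.^ N)
      v n = π n R.* (C R.* rate s R.^ n)

      0≤Cs^ : ∀ n → R.0# R.≤ C R.* rate s R.^ n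
      0≤Cs^ n = R.*-nonneg 0≤C (R.^-nonneg n (nonneg s))

      0≤π : ∀ n → R.0# R.≤ π n
      0≤π zero    = R.0≤1
      0≤π (suc n) = R.*-nonneg (0≤π n) (R.+-nonneg R.0≤1 (0≤Cs^ n))

      p⊑π : ∀ N → p N ⊑ π N
      p⊑π zero    = ⊑-1
      p⊑π (suc N) = ⊑-* (p⊑π N) (⊑-+ ⊑-1 (bound N))

      difference : ∀ n → p (suc n) - p n ⊑ v n
      difference n = ⊑-resp-≈ (solve 2 (λ p e → p :* e := p :* (con (1 , 0) :+ e) :- p) refl (p n) (ε n)) (⊑-* (p⊑π n) (bound n))

      small : ∃[ N ] (∀ n → N ℕ.≤ n → C R.* rate s R.^ n R.≤ R.gap s)
      small = R.geometric-null archimedean s C 0≤C (R.gap s) (R.0<gap s)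

      -- `v` majorises the differences of the partial products. Its successive quotients are bounded
      -- by `s + s · C sⁿ`, and this stays below the midpoint rate once `C sⁿ ≤ gap s`.
      ratio : ∀ n → proj₁ small ℕ.≤ n → v (suc n) R.≤ rate (R.widen s) R.* v n
      ratio n N≤n = begin
        π n R.* (R.1# R.+ C R.* rate s R.^ n) R.* (C R.* (rate s R.* rate s R.^ n))
          ≈⟨ R.solve 4 (λ p c s x → p R.:* (R.con (1 , 0) R.:+ c R.:* x) R.:* (c R.:* (s R.:* x)) R.:= (s R.:+ s R.:* (c R.:* x)) R.:* (p R.:* (c R.:* x))) R.refl (π n) C (rate s) (rate s R.^ n) ⟩
        (rate s R.+ rate s R.* (C R.* rate s R.^ n)) R.* v n
          ≤⟨ R.*-monoˡ-≤ (v n) (R.*-nonneg (0≤π n) (0≤Cs^ n)) (R.+-mono-≤ R.≤-refl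
               (R.≤-trans (R.*-mono-≤ (nonneg s) (0≤Cs^ n) (at-most-1 s) (small .proj₂ n N≤n)) (R.≤-reflexive (R.*-identityˡ _)))) ⟩
        rate (R.widen s) R.* v n ∎

      differences : Geometric (λ n → p (suc n) - p n)
      differences =
        let D , 0≤D , decay = R.eventually-geometric (R.widen s) (proj₁ small) v (λ n → R.*-nonneg (0≤π n) (0≤Cs^ n)) ratio
        in geometric D (R.widen s) 0≤D λ n → ⊑-mono (decay n) (difference n)

      telescope : ∀ N → 1# + Σ< N (λ n → p (suc n) - p n) ≈ p N
      telescope zero    = +-identityʳ 1#
      telescope (suc N) = trans (sym (+-assoc _ _ _)) (trans (+-congʳ (telescope N)) (solve 2 (λ a b → a :+ (b :- a) := b) refl (p N) (p (suc N))))

    -- The partial products telescope into 1 plus the series of their differences, whose geometric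
    -- decay is the ratio test above; no logarithm is involved.
    product-converges : ∃[ l ] Lim (λ N → Π< N (λ n → 1# + ε n)) l
    product-converges = 1# + proj₁ (summable differences) ,
      lim-cong telescope refl (lim-+ (lim-const 1#) (proj₂ (summable differences)))

    product-bounded : ∃[ B ] (∀ N → Π< N (λ n → 1# + ε n) ⊑ B)
    product-bounded = _ , λ N → ⊑-resp-≈ (telescope N) (⊑-+ ⊑-1 (block-bound differences 0 N))

  lim-^ : ∀ s {z} → z ⊑ rate s → Lim (z ^_) 0#
  lim-^ s {z} z⊑s = lim-geometric R.1# s R.0≤1 λ n →
    ⊑-resp (solve 1 (λ x → x := x :- con (0 , 0)) refl (z ^ n)) (R.≤-reflexive (R.sym (R.*-identityˡ _))) (⊑-^ n z⊑s)

  -- The inverse is the sum of the powers of z. Its bound depends on the rate alone, so it is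
  -- uniform over all z below that rate, in particular over all powers of q.
  geometric-inverse : ∀ s {z} → z ⊑ rate s → ∃[ w ] ((1# - z) * w ≈ 1# × w ⊑ tailConstant R.1# s R.+ R.1#)
  geometric-inverse s {z} z⊑s = w , lim-unique (lim-cong partial refl (lim-*ˡ (1# - z) converges)) powers , sum-bound (Geometric-^ s z⊑s) converges
    where
    w : Carrier
    w = proj₁ (summable (Geometric-^ s z⊑s))
    converges : Sum (z ^_) w
    converges = proj₂ (summable (Geometric-^ s z⊑s))
    partial : ∀ N → (1# - z) * Σ< N (z ^_) ≈ 1# - z ^ N
    partial zero    = solve 1 (λ z → (con (1 , 0) :- z) :* con (0 , 0) := con (1 , 0) :- con (1 , 0)) refl z
    partial (suc N) = trans (distribˡ _ _ _) (trans (+-congʳ (partial N))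
      (solve 2 (λ z p → con (1 , 0) :- p :+ (con (1 , 0) :- z) :* p := con (1 , 0) :- z :* p) refl z (z ^ N)))
    powers : Lim (λ N → 1# - z ^ N) 1#
    powers = lim-cong (λ _ → refl) (solve 0 (con (1 , 0) :- con (0 , 0) := con (1 , 0)) refl) (lim-- (lim-const 1#) (lim-^ s z⊑s))

  -- The remainder after N is a diagonal of N + 1 products of a term of u with a tail of v. Brought
  -- to a common rate ρ, each is at most `K ρᴺ⁺¹`; the factor N + 1 is absorbed by widening ρ.
  cauchy-product : ∀ {u v U W} → Geometric u → Geometric v → Sum u U → Sum v W → Sum (u ⊛ v) (U * W)
  cauchy-product {u} {v} {U} {W} geo-u@(geometric C s 0≤C bound-u) geo-v@(geometric D t 0≤D bound-v) sum-u sum-v =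
    -- `⊛-remainder` concerns partial sums of N + 1 terms, whence the shift by one.
    lim-unsuc (lim-cong (λ N → solve 2 (λ a b → a :- (a :- b) := b) refl (Σ< (suc N) u * W) (Σ< (suc N) (u ⊛ v)))
                        (solve 1 (λ a → a :- con (0 , 0) := a) refl (U * W))
                        (lim-- (lim-* (lim-drop 1 sum-u) (lim-const W)) remainder-null))
    where
    ρ : Rate
    ρ = s R.⊔ʳ t
    G K E : R.Carrier
    G = tailConstant D t R.+ R.1#
    K = C R.* G
    E = R.recip (R.gap ρ) (R.0<gap ρ)
    0≤G : R.0# R.≤ G
    0≤G = R.+-nonneg (tailConstant-nonneg t 0≤D) R.0≤1
    0≤K : R.0# R.≤ K
    0≤K = R.*-nonneg 0≤C 0≤G
    term : ∀ N k l → k ℕ.+ l ≡ N → u k * (W - Σ< (suc l) v) ⊑ K R.* rate ρ R.^ suc N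
    term N k l k+l≡N = ⊑-mono (begin
      (C R.* rate s R.^ k) R.* (G R.* rate t R.^ suc l)
        ≈⟨ R.solve 4 (λ c x g y → c R.:* x R.:* (g R.:* y) R.:= c R.:* g R.:* (x R.:* y)) R.refl _ _ _ _ ⟩
      K R.* (rate s R.^ k R.* rate t R.^ suc l)
        ≤⟨ R.*-monoʳ-≤ K 0≤K (R.*-mono-≤ (R.^-nonneg k (nonneg s)) (R.^-nonneg (suc l) (nonneg t))
             (R.^-mono-≤ k (nonneg s) (R.⊔ʳ-upperˡ s t)) (R.^-mono-≤ (suc l) (nonneg t) (R.⊔ʳ-upperʳ s t))) ⟩
      K R.* (rate ρ R.^ k R.* rate ρ R.^ suc l)
        ≈⟨ R.*-congˡ (R.trans (R.sym (R.^-homo-* (rate ρ) k (suc l))) (R.reflexive (≡.cong (rate ρ R.^_) (≡.trans (ℕₚ.+-suc k l) (≡.cong suc k+l≡N))))) ⟩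
      K R.* rate ρ R.^ suc N ∎)
      (⊑-* (bound-u k) (tail-bound geo-v sum-v (suc l)))
    remainder-null : Lim (λ N → Σ< (suc N) u * W - Σ< (suc N) (u ⊛ v)) 0#
    remainder-null = lim-geometric (K R.* E) (R.widen ρ) (R.*-nonneg 0≤K (R.<⇒≤ (R.recip-pos _ (R.0<gap ρ)))) λ N →
      ⊑-resp (trans (⊛-remainder N u v W) (solve 1 (λ x → x := x :- con (0 , 0)) refl _)) (begin
        R.fromℕ (suc N) R.* (K R.* rate ρ R.^ suc N)   ≈⟨ R.solve 3 (λ n k x → n R.:* (k R.:* x) R.:= k R.:* (n R.:* x)) R.refl _ _ _ ⟩
        K R.* (R.fromℕ (suc N) R.* rate ρ R.^ suc N)   ≤⟨ R.*-monoʳ-≤ K 0≤K (R.linear-geometric ρ (suc N)) ⟩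
        K R.* (E R.* rate (R.widen ρ) R.^ suc N)       ≈⟨ R.sym (R.*-assoc K E _) ⟩
        K R.* E R.* rate (R.widen ρ) R.^ suc N         ≤⟨ R.*-monoʳ-≤ (K R.* E) (R.*-nonneg 0≤K (R.<⇒≤ (R.recip-pos _ (R.0<gap ρ))))
                                                            (R.^-antimono (nonneg (R.widen ρ)) (at-most-1 (R.widen ρ)) (ℕₚ.n≤1+n N)) ⟩
        K R.* E R.* rate (R.widen ρ) R.^ N             ∎)
      (⊑-diag N (term N))

-- Newton's identity for the q-series coefficients.

-- With w_n = 1/(1 - qⁿ) and h_n = 1/(q;q)_n, the power sums and complete homogeneous symmetric
-- functions of 1, q, q², …, this is Newton's identity n h_n = Σ w_k h_{n-k}.
module Newton {r ℓ} (A : CommutativeRing r ℓ) (q : CommutativeRing.Carrier A) (w h : ℕ → CommutativeRing.Carrier A) where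
  open FiniteSums A
  open SetoidReasoning setoid

  module _ (w₀ : w 0 ≈ 0#) (w-inverse : ∀ n → (1# - q ^ suc n) * w (suc n) ≈ 1#)
           (h-step : ∀ n → (1# - q ^ suc n) * h (suc n) ≈ h n) where

    w-cancel : ∀ n {x y} → (1# - q ^ suc n) * x ≈ (1# - q ^ suc n) * y → x ≈ y
    w-cancel n {x} {y} eq = trans (sym (undo x)) (trans (*-congˡ eq) (undo y))
      where
      undo : ∀ x → w (suc n) * ((1# - q ^ suc n) * x) ≈ x
      undo x = trans (sym (*-assoc _ _ _)) (trans (*-congʳ (trans (*-comm _ _) (w-inverse n))) (*-identityˡ x))

    q^*h : ∀ n → q ^ suc n * h (suc n) ≈ h (suc n) - h n
    q^*h n = trans (solve 2 (λ q h → q :* h := h :- (con (1 , 0) :- q) :* h) refl _ _) (+-congˡ (-‿cong (h-step n)))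

    -- The index i is a dummy: this is the sum of `qʲ h_j` over j ≤ n, and `qʲ h_j = h_j - h_{j-1}`
    -- for j ≥ 1.
    telescope : ∀ n → diag n (λ i j → q ^ j * h j) ≈ h n
    telescope zero    = *-identityˡ (h 0)
    telescope (suc n) = trans (+-cong (q^*h n) (telescope n)) (solve 2 (λ a b → a :- b :+ b := a) refl _ _)

    -- Splits 1 - qⁱqʲ as (1 - qʲ) + qʲ(1 - qⁱ).
    convolution-step : ∀ n → (1# - q ^ suc n) * (w ⊛ h) (suc n) ≈ (w ⊛ h) n + h n
    convolution-step n = begin
      (1# - q ^ suc n) * diag (suc n) (λ i j → w i * h j)
        ≈⟨ sym (diag-* (suc n) (1# - q ^ suc n) (λ i j → w i * h j)) ⟩
      diag (suc n) (λ i j → (1# - q ^ suc n) * (w i * h j))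
        ≈⟨ diag-cong (suc n) split ⟩
      diag (suc n) (λ i j → left i j + right i j)
        ≈⟨ diag-+ (suc n) left right ⟩
      diag (suc n) left + diag (suc n) right
        ≈⟨ +-cong first second ⟩
      (w ⊛ h) n + h n ∎
      where
      left right : ℕ → ℕ → Carrier
      left i j = w i * ((1# - q ^ j) * h j)
      right i j = (1# - q ^ i) * w i * (q ^ j * h j)
      split : ∀ i j → i ℕ.+ j ≡ suc n → (1# - q ^ suc n) * (w i * h j) ≈ left i j + right i j
      split i j i+j≡n = trans (*-congʳ (+-congˡ (-‿cong (trans (≡⇒≈ (≡.cong (q ^_) (≡.sym i+j≡n))) (^-homo-* q i j)))))
        (solve 4 (λ a b w h → (con (1 , 0) :- a :* b) :* (w :* h) := w :* ((con (1 , 0) :- b) :* h) :+ (con (1 , 0) :- a) :* w :* (b :* h)) refl _ _ _ _)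
      first : diag (suc n) left ≈ (w ⊛ h) n
      first = trans (diag-last n left) (trans (+-cong (diag-cong′ n λ i j → *-congˡ (h-step j))
        (solve 2 (λ w h → w :* ((con (1 , 0) :- con (1 , 0)) :* h) := con (0 , 0)) refl _ _)) (+-identityʳ _))
      second : diag (suc n) right ≈ h n
      second = trans (+-cong (trans (*-congʳ (solve 1 (λ w → (con (1 , 0) :- con (1 , 0)) :* w := con (0 , 0)) refl _)) (zeroˡ _))
          (diag-cong′ n λ i j → trans (*-congʳ (w-inverse i)) (*-identityˡ _)))
        (trans (+-identityˡ _) (telescope n))

    -- Both sides F satisfy (1 - qⁿ⁺¹) F(n+1) = F(n) + h n, and the factor 1 - qⁿ⁺¹ is invertible.
    newton : ∀ n → fromℕ n * h n ≈ (w ⊛ h) n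
    newton zero    = trans (zeroˡ _) (sym (trans (*-congʳ w₀) (zeroˡ _)))
    newton (suc n) = w-cancel n (begin
      (1# - q ^ suc n) * (fromℕ (suc n) * h (suc n))   ≈⟨ solve 3 (λ a n h → a :* (n :* h) := n :* (a :* h)) refl _ _ _ ⟩
      fromℕ (suc n) * ((1# - q ^ suc n) * h (suc n))   ≈⟨ *-congˡ (h-step n) ⟩
      fromℕ (suc n) * h n                              ≈⟨ solve 2 (λ n h → (con (1 , 0) :+ n) :* h := n :* h :+ h) refl _ _ ⟩
      fromℕ n * h n + h n                              ≈⟨ +-congʳ (newton n) ⟩
      (w ⊛ h) n + h n                                  ≈⟨ sym (convolution-step n) ⟩
      (1# - q ^ suc n) * (w ⊛ h) (suc n)               ∎)

-- Divisor sums and Lambert series.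

divisors : ℕ → List ℕ
divisors n = filter (_∣? n) (applyUpTo suc n)

module Lambert {r ℓ} (A : CommutativeRing r ℓ) where
  open FiniteSums A
  open ListSums A
  open SetoidReasoning setoid

  indicator : ℕ → ℕ → Carrier
  indicator d n = if does (d ∣? n) then 1# else 0#

  indicator-∣ : ∀ {d n} → d ∣ n → indicator d n ≈ 1#
  indicator-∣ {d} {n} d∣n with d ∣? n
  ... | yes _   = refl
  ... | no  d∤n = ⊥-elim (d∤n d∣n)

  indicator-∤ : ∀ {d n} → ¬ d ∣ n → indicator d n ≈ 0#
  indicator-∤ {d} {n} d∤n with d ∣? n
  ... | yes d∣n = ⊥-elim (d∤n d∣n)
  ... | no  _   = refl

  Σ∈-divisors : ∀ n f → Σ∈ (divisors n) f ≈ Σ< n (λ d → indicator (suc d) n * f (suc d))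
  Σ∈-divisors n f = trans (Σ∈-filter (_∣? n) (applyUpTo suc n) f)
    (trans (Σ∈-applyUpTo suc n _) (Σ<-cong n λ d → scale (does (suc d ∣? n)) (f (suc d))))
    where
    scale : ∀ b x → (if b then x else 0#) ≈ (if b then 1# else 0#) * x
    scale true  x = sym (*-identityˡ x)
    scale false x = sym (zeroˡ x)

  Σ∈-divisors-≤ : ∀ {n N} f → n ℕ.≤ N → Σ∈ (divisors (suc n)) f ≈ Σ< (suc N) (λ d → indicator (suc d) (suc n) * f (suc d))
  Σ∈-divisors-≤ {n} {N} f n≤N = trans (Σ∈-divisors (suc n) f)
    (≡.subst (λ N → Σ< (suc n) summand ≈ Σ< (suc N) summand) (ℕₚ.m+[n∸m]≡n n≤N) (extend (N ℕ.∸ n)))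
    where
    summand : ℕ → Carrier
    summand d = indicator (suc d) (suc n) * f (suc d)
    extend : ∀ k → Σ< (suc n) summand ≈ Σ< (suc (n ℕ.+ k)) summand
    extend zero    = ≡⇒≈ (≡.cong (λ m → Σ< (suc m) summand) (≡.sym (ℕₚ.+-identityʳ n)))
    extend (suc k) = begin
      Σ< (suc n) summand                   ≈⟨ extend k ⟩
      Σ< (suc (n ℕ.+ k)) summand           ≈⟨ sym (+-identityʳ _) ⟩
      Σ< (suc (n ℕ.+ k)) summand + 0#      ≈⟨ +-congˡ (sym (trans (*-congʳ (indicator-∤ λ d∣n →
                                                ℕₚ.<⇒≱ (s≤s (s≤s (ℕₚ.m≤m+n n k))) (∣⇒≤ d∣n))) (zeroˡ _))) ⟩
      Σ< (suc (suc (n ℕ.+ k))) summand     ≈⟨ ≡⇒≈ (≡.cong (λ m → Σ< (suc m) summand) (≡.sym (ℕₚ.+-suc n k))) ⟩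
      Σ< (suc (n ℕ.+ suc k)) summand       ∎

  module _ (q : Carrier) where

    multiples : ℕ → ℕ → Carrier
    multiples d N = Σ< N (λ n → indicator d (suc n) * q ^ suc n)

    -- Letting d run up to N for every n ≤ N, where the indicator kills the surplus, turns the
    -- region of summation into a square on which the sums commute.
    divisor-exchange : ∀ N f →
      Σ< N (λ n → Σ∈ (divisors (suc n)) f * q ^ suc n) ≈ Σ< N (λ d → f (suc d) * multiples (suc d) N)
    divisor-exchange zero    f = refl
    divisor-exchange (suc N) f = begin
      Σ< (suc N) (λ n → Σ∈ (divisors (suc n)) f * q ^ suc n)
        ≈⟨ Σ<-cong-< (suc N) (λ n n<N → trans (*-congʳ (Σ∈-divisors-≤ f (ℕₚ.≤-pred n<N))) (sym (Σ<-*ʳ (suc N) _ _))) ⟩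
      Σ< (suc N) (λ n → Σ< (suc N) (λ d → indicator (suc d) (suc n) * f (suc d) * q ^ suc n))
        ≈⟨ Σ<-swap (suc N) (suc N) _ ⟩
      Σ< (suc N) (λ d → Σ< (suc N) (λ n → indicator (suc d) (suc n) * f (suc d) * q ^ suc n))
        ≈⟨ Σ<-cong (suc N) (λ d → trans (Σ<-cong (suc N) λ n → solve 3 (λ i f q → i :* f :* q := f :* (i :* q)) refl _ _ _) (Σ<-* (suc N) _ _)) ⟩
      Σ< (suc N) (λ d → f (suc d) * multiples (suc d) (suc N)) ∎

    -- The first multiple of suc d beyond N is suc d + g.
    multiples-remainder : ∀ d {v} → (1# - q ^ suc d) * v ≈ 1# → ∀ N →
      ∃[ g ] (g ℕ.≤ N × N ℕ.< suc d ℕ.+ g × suc d ∣ g × v * q ^ suc d ≈ multiples (suc d) N + v * q ^ (suc d ℕ.+ g))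
    multiples-remainder d {v} v-inverse zero = 0 , z≤n , s≤s z≤n , (suc d ∣0) ,
      trans (*-congˡ (≡⇒≈ (≡.cong (q ^_) (≡.sym (ℕₚ.+-identityʳ (suc d)))))) (sym (+-identityˡ _))
    multiples-remainder d {v} v-inverse (suc N) = step (multiples-remainder d v-inverse N)
      where
      step : ∃[ g ] (g ℕ.≤ N × N ℕ.< suc d ℕ.+ g × suc d ∣ g × v * q ^ suc d ≈ multiples (suc d) N + v * q ^ (suc d ℕ.+ g)) →
        ∃[ g ] (g ℕ.≤ suc N × suc N ℕ.< suc d ℕ.+ g × suc d ∣ g × v * q ^ suc d ≈ multiples (suc d) (suc N) + v * q ^ (suc d ℕ.+ g))
      step (g , g≤N , N<d+g , d∣g , eq) with suc N ℕₚ.≟ suc d ℕ.+ g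
      ... | yes 1+N≡d+g = suc N , ℕₚ.≤-refl , s≤s (ℕₚ.m≤n+m (suc N) d) , d∣1+N , (begin
          v * q ^ suc d                                                             ≈⟨ eq ⟩
          multiples (suc d) N + v * q ^ (suc d ℕ.+ g)                               ≈⟨ +-congˡ (*-congˡ (≡⇒≈ (≡.cong (q ^_) (≡.sym 1+N≡d+g)))) ⟩
          -- With `e = q ^ suc d`, one step of the geometric series is v = (1 - e)v + e v; its first
          -- part yields the new term, its second the new remainder.
          multiples (suc d) N + v * q ^ suc N                                       ≈⟨ +-congˡ (solve 3 (λ v e p → v :* p := (con (1 , 0) :- e) :* v :* p :+ v :* (e :* p)) refl v (q ^ suc d) (q ^ suc N)) ⟩
          multiples (suc d) N + ((1# - q ^ suc d) * v * q ^ suc N + v * (q ^ suc d * q ^ suc N))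
            ≈⟨ +-congˡ (+-cong (*-congʳ (trans v-inverse (sym (indicator-∣ d∣1+N)))) (*-congˡ (sym (^-homo-* q (suc d) (suc N))))) ⟩
          multiples (suc d) N + (indicator (suc d) (suc N) * q ^ suc N + v * q ^ (suc d ℕ.+ suc N)) ≈⟨ sym (+-assoc _ _ _) ⟩
          multiples (suc d) (suc N) + v * q ^ (suc d ℕ.+ suc N)                     ∎)
        where
        d∣1+N : suc d ∣ suc N
        d∣1+N = ≡.subst (suc d ∣_) (≡.sym 1+N≡d+g) (∣m∣n⇒∣m+n ∣-refl d∣g)
      ... | no  1+N≢d+g = g , ℕₚ.m≤n⇒m≤1+n g≤N , 1+N<d+g , d∣g , (begin
          v * q ^ suc d                                                             ≈⟨ eq ⟩
          multiples (suc d) N + v * q ^ (suc d ℕ.+ g)                               ≈⟨ +-congʳ (sym (trans (+-congˡ (trans (*-congʳ (indicator-∤ d∤1+N)) (zeroˡ _))) (+-identityʳ _))) ⟩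
          multiples (suc d) (suc N) + v * q ^ (suc d ℕ.+ g)                         ∎)
        where
        1+N<d+g : suc N ℕ.< suc d ℕ.+ g
        1+N<d+g = ℕₚ.≤∧≢⇒< N<d+g 1+N≢d+g
        excess : ℕ
        excess = N ℕ.∸ g
        g+excess : g ℕ.+ suc excess ≡ suc N
        g+excess = ≡.trans (ℕₚ.+-suc g excess) (≡.cong suc (ℕₚ.m+[n∸m]≡n g≤N))
        -- `suc N` lies strictly between the consecutive multiples `g` and `suc d + g`.
        d∤1+N : ¬ suc d ∣ suc N
        d∤1+N d∣1+N = ℕₚ.<⇒≱
          (ℕₚ.+-cancelˡ-< g (suc excess) (suc d) (≡.subst₂ ℕ._<_ (≡.sym g+excess) (ℕₚ.+-comm (suc d) g) 1+N<d+g))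
          (∣⇒≤ (∣m+n∣m⇒∣n (≡.subst (suc d ∣_) (≡.sym g+excess) d∣1+N) d∣g))

-- q-Pochhammer products and Euler's functional equation.

module QSeries {c ℓ₁ ℓ₂ r ℓ} (F : OrderedField c ℓ₁ ℓ₂) (A : CommutativeRing r ℓ) (V : Norm F A)
  (q : CommutativeRing.Carrier A) (s : OrderedFieldFacts.Rate F) (q⊑s : Norm._⊑_ V q (OrderedFieldFacts.Rate.rate s)) where
  open Series F A V public
  open R using (Rate)
  open Rate
  open SetoidReasoning setoid

  q^-bound : ∀ k → q ^ suc k ⊑ rate s
  q^-bound k = ⊑-mono (R.≤-trans (R.^-antimono (nonneg s) (at-most-1 s) (s≤s (z≤n {k}))) (R.≤-reflexive (R.*-identityʳ (rate s)))) (⊑-^ (suc k) q⊑s)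

  -- 1/(1 - qⁿ), with w 0 = 0 so that convolutions with w start at index 1.
  w : ℕ → Carrier
  w zero    = 0#
  w (suc k) = proj₁ (geometric-inverse s (q^-bound k))

  w-inverse : ∀ n → (1# - q ^ suc n) * w (suc n) ≈ 1#
  w-inverse n = proj₁ (proj₂ (geometric-inverse s (q^-bound n)))

  w-constant : R.Carrier
  w-constant = tailConstant R.1# s R.+ R.1#

  0≤w-constant : R.0# R.≤ w-constant
  0≤w-constant = R.+-nonneg (tailConstant-nonneg s R.0≤1) R.0≤1

  w-bound : ∀ n → w n ⊑ w-constant
  w-bound zero    = ⊑-mono 0≤w-constant ⊑-0
  w-bound (suc n) = proj₂ (proj₂ (geometric-inverse s (q^-bound n)))

  h : ℕ → Carrier
  h zero    = 1#
  h (suc n) = h n * w (suc n)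

  h-step : ∀ n → (1# - q ^ suc n) * h (suc n) ≈ h n
  h-step n = trans (solve 3 (λ a h w → a :* (h :* w) := h :* (a :* w)) refl (1# - q ^ suc n) (h n) (w (suc n)))
    (trans (*-congˡ (w-inverse n)) (*-identityʳ (h n)))

  private
    -- From 1/(1 - qⁿ) = 1 + qⁿ/(1 - qⁿ). In this form h_N is a partial product of factors 1 +
    -- (geometric term), so the product criterion bounds all of them at once.
    h-product : ∀ N → Π< N (λ n → 1# + w (suc n) * q ^ suc n) ≈ h N
    h-product zero    = refl
    h-product (suc N) = *-cong (h-product N)
      (trans (+-congʳ (sym (w-inverse N))) (solve 2 (λ q w → (con (1 , 0) :- q) :* w :+ w :* q := w) refl (q ^ suc N) (w (suc N))))

    h-bounded′ : ∃[ B ] (∀ N → Π< N (λ n → 1# + w (suc n) * q ^ suc n) ⊑ B)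
    h-bounded′ = product-bounded (Geometric-* (λ n → w-bound (suc n)) (Geometric-suc (Geometric-^ s q⊑s)))

  h-constant : R.Carrier
  h-constant = proj₁ h-bounded′

  h-bound : ∀ n → h n ⊑ h-constant
  h-bound n = ⊑-resp-≈ (h-product n) (proj₂ h-bounded′ n)

  qProduct : Carrier → ℕ → Carrier
  qProduct x N = Π< N (λ j → 1# - x * q ^ j)

  abstract
    qProduct-converges : ∀ x → ∃[ l ] Lim (qProduct x) l
    qProduct-converges x =
      let l , lim = product-converges (Geometric-* {u = λ _ → - x} (λ _ → proj₂ (bounded (- x))) (Geometric-^ s q⊑s))
      in l , lim-cong (λ N → Π<-cong N λ n → solve 2 (λ x p → con (1 , 0) :+ :- x :* p := con (1 , 0) :- x :* p) refl x (q ^ n)) refl lim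

  qProduct-h : ∀ n → qProduct q n * h n ≈ 1#
  qProduct-h zero    = *-identityʳ 1#
  qProduct-h (suc n) = trans (solve 4 (λ p a h w → p :* a :* (h :* w) := p :* h :* (a :* w)) refl (qProduct q n) (1# - q ^ suc n) (h n) (w (suc n)))
    (trans (*-cong (qProduct-h n) (w-inverse n)) (*-identityʳ 1#))

  shifted-qProduct : ∀ {Q} → Lim (qProduct q) Q → ∀ n → Lim (qProduct (q ^ suc n)) (Q * h n)
  shifted-qProduct {Q} lim n = lim-cong split refl (lim-* (lim-drop n lim) (lim-const (h n)))
    where
    split : ∀ N → qProduct q (n ℕ.+ N) * h n ≈ qProduct (q ^ suc n) N
    split N = begin
      qProduct q (n ℕ.+ N) * h n                                     ≈⟨ *-congʳ (Π<-+ n N (λ j → 1# - q * q ^ j)) ⟩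
      qProduct q n * Π< N (λ j → 1# - q * q ^ (n ℕ.+ j)) * h n       ≈⟨ solve 3 (λ a b h → a :* b :* h := a :* h :* b) refl (qProduct q n) _ (h n) ⟩
      qProduct q n * h n * Π< N (λ j → 1# - q * q ^ (n ℕ.+ j))       ≈⟨ *-cong (qProduct-h n)
        (Π<-cong N λ j → +-congˡ (-‿cong (trans (*-congˡ (^-homo-* q n j)) (sym (*-assoc _ _ _))))) ⟩
      1# * qProduct (q ^ suc n) N                                    ≈⟨ *-identityˡ _ ⟩
      qProduct (q ^ suc n) N                                         ∎

  module Euler {x : Carrier} (t : Rate) (x⊑t : x ⊑ rate t) where

    y : ℕ → Carrier
    y j = x * q ^ j

    q^⊑1 : ∀ j → q ^ j ⊑ R.1#
    q^⊑1 j = ⊑-mono (R.^-≤-1 j (nonneg s) (at-most-1 s)) (⊑-^ j q⊑s)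

    y⊑t : ∀ j → y j ⊑ rate t
    y⊑t j = ⊑-mono (R.≤-reflexive (R.*-identityʳ _)) (⊑-* x⊑t (q^⊑1 j))

    Geometric-h : ∀ {z} → z ⊑ rate t → Geometric (λ n → h n * z ^ n)
    Geometric-h z⊑t = Geometric-* h-bound (Geometric-^ t z⊑t)

    abstract
      E : ℕ → Carrier
      E j = proj₁ (summable (Geometric-h (y⊑t j)))

      E-sum : ∀ j → Sum (λ n → h n * y j ^ n) (E j)
      E-sum j = proj₂ (summable (Geometric-h (y⊑t j)))

    E-step : ∀ j → (1# - x * q ^ j) * E j ≈ E (suc j)
    E-step j = lim-unique
      (lim-cong (λ _ → refl) (solve 2 (λ y e → e :- y :* e := (con (1 , 0) :- y) :* e) refl (y j) (E j))
        (lim-- (lim-drop 1 (E-sum j)) (lim-*ˡ (y j) (E-sum j))))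
      (lim-cong partial refl (lim-drop 1 (E-sum (suc j))))
      where
      y-suc : ∀ n → y (suc j) ^ n ≈ y j ^ n * q ^ n
      y-suc n = trans (^-congˡ n (solve 3 (λ x q p → x :* (q :* p) := x :* p :* q) refl x q (q ^ j))) (^-distrib-* (y j) q n)
      -- The functional equation is exact for partial sums provided the subtracted sum is one term
      -- shorter: its new term arises from (1 - qᴺ⁺¹) h_{N+1} = h_N.
      partial : ∀ N → Σ< (suc N) (λ n → h n * y (suc j) ^ n) ≈ Σ< (suc N) (λ n → h n * y j ^ n) - y j * Σ< N (λ n → h n * y j ^ n)
      partial zero    = solve 2 (λ h y → con (0 , 0) :+ h :* con (1 , 0) := (con (0 , 0) :+ h :* con (1 , 0)) :- y :* con (0 , 0)) refl (h 0) (y j)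
      partial (suc N) = begin
        Σ< (suc N) (λ n → h n * y (suc j) ^ n) + h (suc N) * y (suc j) ^ suc N
          ≈⟨ +-cong (partial N) (*-congˡ (y-suc (suc N))) ⟩
        S - y j * S′ + h (suc N) * (y j ^ suc N * q ^ suc N)
          ≈⟨ solve 6 (λ S S′ y h p e → S :- y :* S′ :+ h :* (y :* p :* e) := S :+ h :* (y :* p) :- y :* (S′ :+ (con (1 , 0) :- e) :* h :* p))
               refl S S′ (y j) (h (suc N)) (y j ^ N) (q ^ suc N) ⟩
        S + h (suc N) * y j ^ suc N - y j * (S′ + (1# - q ^ suc N) * h (suc N) * y j ^ N)
          ≈⟨ +-congˡ (-‿cong (*-congˡ (+-congˡ (*-congʳ (h-step N))))) ⟩
        S + h (suc N) * y j ^ suc N - y j * (S′ + h N * y j ^ N) ∎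
        where
        S S′ : Carrier
        S = Σ< (suc N) (λ n → h n * y j ^ n)
        S′ = Σ< N (λ n → h n * y j ^ n)

    E-product : ∀ N → qProduct x N * E 0 ≈ E N
    E-product zero    = *-identityˡ _
    E-product (suc N) = trans (solve 3 (λ p a e → p :* a :* e := a :* (p :* e)) refl (qProduct x N) (1# - x * q ^ N) (E 0))
      (trans (*-congˡ (E-product N)) (E-step N))

    -- Splitting off the term n = 0 leaves E_N - 1 = x qᴺ Z_N. The sums Z_N are bounded uniformly in
    -- N because every x qᴺ obeys the same rate t, so the factor qᴺ decides.
    E-limit : Lim E 1#
    E-limit = lim-geometric D s 0≤D λ N → ⊑-resp (sym (E-1 N)) (bound-step N) (⊑-* (⊑-* x⊑t (⊑-^ N q⊑s)) (Z-bound N))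
      where
      Geometric-h-suc : ∀ N → Geometric (λ n → h (suc n) * y N ^ n)
      Geometric-h-suc N = Geometric-* (λ n → h-bound (suc n)) (Geometric-^ t (y⊑t N))
      D : R.Carrier
      D = tailConstant (h-constant R.* R.1#) t R.+ R.1#
      0≤D : R.0# R.≤ D
      0≤D = R.+-nonneg (tailConstant-nonneg t (R.*-nonneg (⊑⇒nonneg (h-bound 0)) R.0≤1)) R.0≤1
      Z : ℕ → Carrier
      Z N = proj₁ (summable (Geometric-h-suc N))
      Z-sum : ∀ N → Sum (λ n → h (suc n) * y N ^ n) (Z N)
      Z-sum N = proj₂ (summable (Geometric-h-suc N))
      Z-bound : ∀ N → Z N ⊑ D
      Z-bound N = sum-bound (Geometric-h-suc N) (Z-sum N)
      E-1 : ∀ N → E N - 1# ≈ y N * Z N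
      E-1 N = lim-unique
        (lim-cong (λ _ → refl) (+-congˡ (-‿cong (*-identityʳ 1#))) (sum-suc (E-sum N)))
        (sum-cong (λ n → solve 3 (λ y h p → y :* (h :* p) := h :* (y :* p)) refl (y N) (h (suc n)) (y N ^ n)) refl (sum-*ˡ (y N) (Z-sum N)))
      bound-step : ∀ N → rate t R.* rate s R.^ N R.* D R.≤ D R.* rate s R.^ N
      bound-step N = R.≤-trans (R.*-monoˡ-≤ D 0≤D (R.*-monoˡ-≤ _ (R.^-nonneg N (nonneg s)) (at-most-1 t)))
        (R.≤-reflexive (R.solve 2 (λ p d → R.con (1 , 0) R.:* p R.:* d R.:= d R.:* p) R.refl _ _))

    euler : ∀ {X} → Lim (qProduct x) X → X * E 0 ≈ 1#
    euler lim = lim-unique (lim-cong E-product refl (lim-* lim (lim-const (E 0)))) E-limit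

    p b : ℕ → Carrier
    p n = w n * x ^ n
    b n = h n * x ^ n

    b-newton : ∀ n → fromℕ n * b n ≈ (p ⊛ b) n
    b-newton n = begin
      fromℕ n * (h n * x ^ n)                             ≈⟨ sym (*-assoc _ _ _) ⟩
      fromℕ n * h n * x ^ n                               ≈⟨ *-congʳ (Newton.newton A q w h refl w-inverse h-step n) ⟩
      (w ⊛ h) n * x ^ n                                   ≈⟨ sym (diag-*ʳ n (x ^ n) (λ i j → w i * h j)) ⟩
      diag n (λ i j → w i * h j * x ^ n)                  ≈⟨ diag-cong n (λ i j i+j≡n →
        trans (*-congˡ (trans (≡⇒≈ (≡.cong (x ^_) (≡.sym i+j≡n))) (^-homo-* x i j)))
          (solve 4 (λ w h a b → w :* h :* (a :* b) := w :* a :* (h :* b)) refl (w i) (h j) (x ^ i) (x ^ j))) ⟩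
      (p ⊛ b) n                                           ∎

    Geometric-p : ∀ m → Geometric (λ n → fromℕ n ^ m * p n)
    Geometric-p m = Geometric-polynomial m (Geometric-* w-bound (Geometric-^ t x⊑t))

    Geometric-b : ∀ m → Geometric (λ n → fromℕ n ^ m * b n)
    Geometric-b m = Geometric-polynomial m (Geometric-h x⊑t)

    abstract
      P B : ℕ → Carrier
      P m = proj₁ (summable (Geometric-p m))
      B m = proj₁ (summable (Geometric-b m))

      P-sum : ∀ m → Sum (λ n → fromℕ n ^ m * p n) (P m)
      P-sum m = proj₂ (summable (Geometric-p m))

      B-sum : ∀ m → Sum (λ n → fromℕ n ^ m * b n) (B m)
      B-sum m = proj₂ (summable (Geometric-b m))

    euler-B : ∀ {X} → Lim (qProduct x) X → X * B 0 ≈ 1#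
    euler-B lim = trans (*-congˡ (lim-unique (B-sum 0)
      (sum-cong (λ n → trans (*-congˡ (^-congˡ n (*-identityʳ x))) (sym (*-identityˡ _))) refl (E-sum 0)))) (euler lim)

-- Lambert expansion of K and the recurrence between moments.

module Moments {c ℓ₁ ℓ₂ r ℓ} (F : OrderedField c ℓ₁ ℓ₂) (A : CommutativeRing r ℓ) (V : Norm F A)
  (q : CommutativeRing.Carrier A) (s : OrderedFieldFacts.Rate F) (q⊑s : Norm._⊑_ V q (OrderedFieldFacts.Rate.rate s))
  (z : CommutativeRing.Carrier A) (t : OrderedFieldFacts.Rate F)
  (zq⊑t : Norm._⊑_ V (CommutativeRing._*_ A z q) (OrderedFieldFacts.Rate.rate t)) where
  open QSeries F A V q s q⊑s public
  open Euler t zq⊑t public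
  open R using (Rate)
  open Rate
  open ListSums A
  open Lambert A
  open SetoidReasoning setoid

  x : Carrier
  x = z * q

  private
    ρ : Rate
    ρ = s R.⊔ʳ t

    0≤ρ : R.0# R.≤ rate ρ
    0≤ρ = nonneg ρ

  -- Up to N the two sides differ by one geometric tail for each d ≤ N, namely dᵐ zᵈ w_d qᵈ⁺ᵍ with d
  -- + g > N. As z may be large, zᵈ is merged with qᵈ into (zq)ᵈ; this leaves (zq)ᵈ qᵍ, which is at
  -- most ρᴺ in absolute value.
  lambert : ∀ m → Sum (λ n → Σ∈ (divisors (suc n)) (λ d → fromℕ d ^ m * z ^ d) * q ^ suc n) (P m)
  lambert m = lim-cong (λ N → solve 2 (λ a b → a :- (a :- b) := b) refl (main N) (series N))
    (solve 1 (λ a → a :- con (0 , 0) := a) refl (P m))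
    (lim-- main-limit (lim-geometric (w-constant R.* C) τ (R.*-nonneg 0≤w-constant 0≤C) remainder-bound))
    where
    f : ℕ → Carrier
    f d = fromℕ d ^ m * z ^ d
    main series : ℕ → Carrier
    main N = Σ< N (λ d → fromℕ (suc d) ^ m * p (suc d))
    series N = Σ< N (λ n → Σ∈ (divisors (suc n)) f * q ^ suc n)
    main-limit : Lim main (P m)
    main-limit = lim-cong (λ _ → refl) (trans (+-congˡ (-‿cong (trans (*-congˡ (zeroˡ _)) (zeroʳ _)))) (solve 1 (λ a → a :- con (0 , 0) := a) refl (P m)))
      (sum-suc (P-sum m))
    -- The exponent is m + 1 because dᵐ ≤ Nᵐ and there are N tails to add up.
    poly : ∃[ C ] ∃[ τ ] (R.0# R.≤ C) × (∀ n → R.fromℕ n R.^ suc m R.* rate ρ R.^ n R.≤ C R.* rate τ R.^ n)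
    poly = R.polynomial-geometric (suc m) ρ
    C : R.Carrier
    C = proj₁ poly
    τ : Rate
    τ = proj₁ (proj₂ poly)
    0≤C : R.0# R.≤ C
    0≤C = proj₁ (proj₂ (proj₂ poly))
    term : ℕ → ℕ → Carrier
    term N d = f (suc d) * (w (suc d) * q ^ suc d - multiples q (suc d) N)
    term-bound : ∀ N d → d ℕ.< N → term N d ⊑ R.fromℕ N R.^ m R.* (w-constant R.* rate ρ R.^ N)
    term-bound N d d<N = bound (multiples-remainder q d (w-inverse d) N)
      where
      bound : ∃[ g ] (g ℕ.≤ N × N ℕ.< suc d ℕ.+ g × suc d ∣ g × w (suc d) * q ^ suc d ≈ multiples q (suc d) N + w (suc d) * q ^ (suc d ℕ.+ g)) →
        term N d ⊑ R.fromℕ N R.^ m R.* (w-constant R.* rate ρ R.^ N)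
      bound (g , _ , N<d+g , _ , eq) = ⊑-resp (sym simplify)
        (R.*-mono-≤ (R.^-nonneg m (R.fromℕ-nonneg (suc d))) (R.*-nonneg 0≤w-constant (R.*-nonneg (R.^-nonneg (suc d) (nonneg t)) (R.^-nonneg g (nonneg s))))
          (R.^-mono-≤ m (R.fromℕ-nonneg (suc d)) (R.fromℕ-mono d<N))
          (R.*-monoʳ-≤ w-constant 0≤w-constant powers))
        (⊑-* (⊑-^ m (⊑-fromℕ (suc d))) (⊑-* (w-bound (suc d)) (⊑-* (⊑-^ (suc d) zq⊑t) (⊑-^ g q⊑s))))
        where
        simplify : term N d ≈ fromℕ (suc d) ^ m * (w (suc d) * (x ^ suc d * q ^ g))
        simplify = begin
          f (suc d) * (w (suc d) * q ^ suc d - multiples q (suc d) N)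
            ≈⟨ *-congˡ (trans (+-congʳ eq) (solve 2 (λ a b → a :+ b :- a := b) refl (multiples q (suc d) N) (w (suc d) * q ^ (suc d ℕ.+ g)))) ⟩
          f (suc d) * (w (suc d) * q ^ (suc d ℕ.+ g))
            ≈⟨ *-congˡ (*-congˡ (^-homo-* q (suc d) g)) ⟩
          fromℕ (suc d) ^ m * z ^ suc d * (w (suc d) * (q ^ suc d * q ^ g))
            ≈⟨ solve 5 (λ n z w a b → n :* z :* (w :* (a :* b)) := n :* (w :* (z :* a :* b))) refl (fromℕ (suc d) ^ m) (z ^ suc d) (w (suc d)) (q ^ suc d) (q ^ g) ⟩
          fromℕ (suc d) ^ m * (w (suc d) * (z ^ suc d * q ^ suc d * q ^ g))
            ≈⟨ *-congˡ (*-congˡ (*-congʳ (sym (^-distrib-* z q (suc d))))) ⟩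
          fromℕ (suc d) ^ m * (w (suc d) * (x ^ suc d * q ^ g)) ∎
        powers : rate t R.^ suc d R.* rate s R.^ g R.≤ rate ρ R.^ N
        powers = R.≤-trans (R.*-mono-≤ (R.^-nonneg (suc d) (nonneg t)) (R.^-nonneg g (nonneg s))
            (R.^-mono-≤ (suc d) (nonneg t) (R.⊔ʳ-upperʳ s t)) (R.^-mono-≤ g (nonneg s) (R.⊔ʳ-upperˡ s t)))
          (R.≤-trans (R.≤-reflexive (R.sym (R.^-homo-* (rate ρ) (suc d) g)))
            (R.^-antimono 0≤ρ (at-most-1 ρ) (ℕₚ.<⇒≤ N<d+g)))
    remainder : ∀ N → Σ< N (term N) ≈ main N - series N
    remainder N = begin
      Σ< N (term N)
        ≈⟨ Σ<-cong N (λ d → trans (solve 5 (λ n z w a b → n :* z :* (w :* a :- b) := n :* (w :* (z :* a)) :+ :- con (1 , 0) :* (n :* z :* b)) refl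
              (fromℕ (suc d) ^ m) (z ^ suc d) (w (suc d)) (q ^ suc d) (multiples q (suc d) N))
            (+-congʳ (*-congˡ (*-congˡ (sym (^-distrib-* z q (suc d))))))) ⟩
      Σ< N (λ d → fromℕ (suc d) ^ m * p (suc d) + - 1# * (f (suc d) * multiples q (suc d) N))
        ≈⟨ trans (Σ<-+ N _ _) (+-congˡ (Σ<-* N (- 1#) _)) ⟩
      main N + - 1# * Σ< N (λ d → f (suc d) * multiples q (suc d) N)
        ≈⟨ +-congˡ (*-congˡ (sym (divisor-exchange q N f))) ⟩
      main N + - 1# * series N
        ≈⟨ solve 2 (λ a b → a :+ :- con (1 , 0) :* b := a :- b) refl (main N) (series N) ⟩
      main N - series N ∎
    remainder-bound : ∀ N → main N - series N - 0# ⊑ w-constant R.* C R.* rate τ R.^ N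
    remainder-bound N = ⊑-resp (trans (remainder N) (solve 1 (λ a → a := a :- con (0 , 0)) refl (main N - series N)))
      (R.≤-trans (R.≤-reflexive (R.solve 4 (λ n k w p → n R.:* (k R.:* (w R.:* p)) R.:= w R.:* (n R.:* k R.:* p)) R.refl (R.fromℕ N) (R.fromℕ N R.^ m) w-constant (rate ρ R.^ N)))
        (R.≤-trans (R.*-monoʳ-≤ w-constant 0≤w-constant (proj₂ (proj₂ (proj₂ poly)) N)) (R.≤-reflexive (R.sym (R.*-assoc w-constant C _)))))
      (⊑-Σ< N (term-bound N))

  module _ (I : InverseFactorials A) where
    open InverseFactorials I
    open ExponentialFormula A I

    -- For k + l = n the inner sum over i + j = m is the binomial expansion of nᵐ / m!, independent
    -- of k and l. It comes out as a factor, and Newton's identity supplies one further n, raising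
    -- the exponent to m + 1.
    moments-term : ∀ m n →
      diag m (λ i j → inv! i * inv! j * ((λ k → fromℕ k ^ i * p k) ⊛ (λ l → fromℕ l ^ j * b l)) n) ≈ inv! m * (fromℕ n ^ suc m * b n)
    moments-term m n = begin
      diag m (λ i j → inv! i * inv! j * ((λ k → fromℕ k ^ i * p k) ⊛ (λ l → fromℕ l ^ j * b l)) n)
        ≈⟨ diag-cong′ m (λ i j → sym (diag-* n (inv! i * inv! j) (λ k l → fromℕ k ^ i * p k * (fromℕ l ^ j * b l)))) ⟩
      diag m (λ i j → diag n (λ k l → inv! i * inv! j * (fromℕ k ^ i * p k * (fromℕ l ^ j * b l))))
        ≈⟨ diag-diag m n _ ⟩
      diag n (λ k l → diag m (λ i j → inv! i * inv! j * (fromℕ k ^ i * p k * (fromℕ l ^ j * b l))))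
        ≈⟨ diag-cong n inner ⟩
      diag n (λ k l → expLinear (fromℕ n) m * (p k * b l))
        ≈⟨ diag-* n (expLinear (fromℕ n) m) (λ k l → p k * b l) ⟩
      expLinear (fromℕ n) m * (p ⊛ b) n
        ≈⟨ *-congˡ (sym (b-newton n)) ⟩
      fromℕ n ^ m * inv! m * (fromℕ n * b n)
        ≈⟨ solve 4 (λ k i n b → k :* i :* (n :* b) := i :* (n :* k :* b)) refl (fromℕ n ^ m) (inv! m) (fromℕ n) (b n) ⟩
      inv! m * (fromℕ n ^ suc m * b n) ∎
      where
      inner : ∀ k l → k ℕ.+ l ≡ n →
        diag m (λ i j → inv! i * inv! j * (fromℕ k ^ i * p k * (fromℕ l ^ j * b l))) ≈ expLinear (fromℕ n) m * (p k * b l)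
      inner k l ≡.refl = begin
        diag m (λ i j → inv! i * inv! j * (fromℕ k ^ i * p k * (fromℕ l ^ j * b l)))
          ≈⟨ diag-cong′ m (λ i j → solve 6 (λ i j a p c b → i :* j :* (a :* p :* (c :* b)) := a :* i :* (c :* j) :* (p :* b)) refl (inv! i) (inv! j) (fromℕ k ^ i) (p k) (fromℕ l ^ j) (b l)) ⟩
        diag m (λ i j → expLinear (fromℕ k) i * expLinear (fromℕ l) j * (p k * b l))
          ≈⟨ diag-*ʳ m (p k * b l) (λ i j → expLinear (fromℕ k) i * expLinear (fromℕ l) j) ⟩
        (expLinear (fromℕ k) ⊛ expLinear (fromℕ l)) m * (p k * b l)
          ≈⟨ *-congʳ (expLinear-+ (fromℕ k) (fromℕ l) m) ⟩
        expLinear (fromℕ k + fromℕ l) m * (p k * b l)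
          ≈⟨ *-congʳ (*-congʳ (^-congˡ m (sym (fromℕ-+ k l)))) ⟩
        expLinear (fromℕ (k ℕ.+ l)) m * (p k * b l) ∎

    moments : ∀ m → diag m (λ i j → inv! i * inv! j * (P i * B j)) ≈ inv! m * B (suc m)
    moments m = lim-unique
      (lim-diag m λ i j → lim-*ˡ (inv! i * inv! j) (cauchy-product (Geometric-p i) (Geometric-b j) (P-sum i) (B-sum j)))
      (lim-cong (λ N → sym (partial N)) refl (sum-*ˡ (inv! m) (B-sum (suc m))))
      where
      partial : ∀ N → diag m (λ i j → inv! i * inv! j * Σ< N ((λ k → fromℕ k ^ i * p k) ⊛ (λ l → fromℕ l ^ j * b l)))
        ≈ Σ< N (λ n → inv! m * (fromℕ n ^ suc m * b n))
      partial N = trans (diag-cong′ m λ i j → sym (Σ<-* N (inv! i * inv! j) _)) (trans (diag-Σ< m N _) (Σ<-cong N (moments-term m)))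

    -- The index shift K_{m+1} = P_m is what makes θ of this series equal to Σ P_m tᵐ⁺¹ / m!, that
    -- is, t times the generating function occurring in `moments`.
    K-series : ℕ → Carrier
    K-series zero    = 0#
    K-series (suc m) = P m * inv! (suc m)

    B≈exp : ∀ m → B m * inv! m ≈ B 0 * exp K-series m
    B≈exp m = trans (LogDer⇒exp K-series refl {b = m} {A = λ n → B n * inv! n} (λ n _ → der n) m ℕₚ.≤-refl)
      (*-congʳ (trans (*-congˡ inv!-0) (*-identityʳ (B 0))))
      where
      der : ∀ n → θ (λ n → B n * inv! n) n ≈ (θ K-series ⊛ (λ n → B n * inv! n)) n
      der zero    = trans (zeroˡ _) (sym (trans (*-congʳ (zeroˡ _)) (zeroˡ _)))
      der (suc m) = begin
        fromℕ (suc m) * (B (suc m) * inv! (suc m))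
          ≈⟨ trans (solve 3 (λ n b i → n :* (b :* i) := n :* i :* b) refl (fromℕ (suc m)) (B (suc m)) (inv! (suc m))) (*-congʳ (inv!-suc m)) ⟩
        inv! m * B (suc m)
          ≈⟨ sym (moments m) ⟩
        diag m (λ i j → inv! i * inv! j * (P i * B j))
          ≈⟨ diag-cong′ m (λ i j → sym (trans (*-congʳ (trans (solve 3 (λ n p k → n :* (p :* k) := p :* (n :* k)) refl (fromℕ (suc i)) (P i) (inv! (suc i))) (*-congˡ (inv!-suc i))))
                (solve 4 (λ p i b j → p :* i :* (b :* j) := i :* j :* (p :* b)) refl (P i) (inv! i) (B j) (inv! j)))) ⟩
        diag m (λ i j → θ K-series (suc i) * (B j * inv! j))
          ≈⟨ sym (trans (+-congʳ (trans (*-congʳ (zeroˡ _)) (zeroˡ _))) (+-identityˡ _)) ⟩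
        (θ K-series ⊛ (λ n → B n * inv! n)) (suc m) ∎

-- The two identities in a normed ring with inverse factorials.

module Identities {c ℓ₁ ℓ₂ r ℓ} (F : OrderedField c ℓ₁ ℓ₂) (A : CommutativeRing r ℓ) (V : Norm F A) (I : InverseFactorials A)
  (q : CommutativeRing.Carrier A) (s : OrderedFieldFacts.Rate F) (q⊑s : Norm._⊑_ V q (OrderedFieldFacts.Rate.rate s))
  (z : CommutativeRing.Carrier A) (t : OrderedFieldFacts.Rate F)
  (zq⊑t : Norm._⊑_ V (CommutativeRing._*_ A z q) (OrderedFieldFacts.Rate.rate t)) where
  open Moments F A V q s q⊑s z t zq⊑t
  open InverseFactorials I
  open ExponentialFormula A I
  open BellSums A I
  open ListSums A
  open SetoidReasoning setoid

  mTerm : (ℕ → Carrier) → ℕ → ℕ → Carrier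
  mTerm Qₙ m n = fromℕ (n ℕ.^ m) * z ^ n * q ^ n * Qₙ n

  kTerm : ℕ → ℕ → Carrier
  kTerm m n = Σ∈ (divisors n) (λ d → fromℕ (d ℕ.^ m) * z ^ d) * q ^ n

  -- The subtracted value is the term n = 0, over which the series defining M does not run. It
  -- vanishes for m ≥ 1 and equals Q for m = 0.
  mSum : ∀ {Q} m → Sum (λ n → mTerm (λ n → Q * h n) m (suc n)) (Q * B m - Q * (fromℕ 0 ^ m * b 0))
  mSum {Q} m = sum-cong (λ n → expand (suc n)) refl (sum-suc (sum-*ˡ Q (B-sum m)))
    where
    expand : ∀ n → Q * (fromℕ n ^ m * b n) ≈ mTerm (λ n → Q * h n) m n
    expand n = begin
      Q * (fromℕ n ^ m * (h n * x ^ n))           ≈⟨ *-congˡ (*-cong (sym (fromℕ-^ n m)) (*-congˡ (^-distrib-* z q n))) ⟩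
      Q * (fromℕ (n ℕ.^ m) * (h n * (z ^ n * q ^ n)))
        ≈⟨ solve 5 (λ Q k h a b → Q :* (k :* (h :* (a :* b))) := k :* a :* b :* (Q :* h)) refl Q (fromℕ (n ℕ.^ m)) (h n) (z ^ n) (q ^ n) ⟩
      mTerm (λ n → Q * h n) m n                   ∎

  kSum : ∀ m → Sum (λ n → kTerm m (suc n)) (P m)
  kSum m = sum-cong (λ n → *-congʳ (Σ∈-cong (divisors (suc n)) λ d → *-congʳ (sym (fromℕ-^ d m)))) refl (lambert m)

  module _ {Q X X⁻¹} {Qₙ M K : ℕ → Carrier} (Q-lim : Lim (qProduct q) Q) (X-lim : Lim (qProduct (z * q)) X) (XX⁻¹ : X * X⁻¹ ≈ 1#)
    (Qₙ-lim : ∀ n → Lim (qProduct (q ^ suc n)) (Qₙ n))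
    (M-sum : ∀ m → Sum (λ n → mTerm Qₙ m (suc n)) (M m))
    (K-sum : ∀ m → Sum (λ n → kTerm m (suc n)) (K (suc m))) where

    ratio≈ : Q * X⁻¹ ≈ Q * B 0
    ratio≈ = begin
      Q * X⁻¹                ≈⟨ sym (*-identityʳ _) ⟩
      Q * X⁻¹ * 1#           ≈⟨ *-congˡ (sym (euler-B X-lim)) ⟩
      Q * X⁻¹ * (X * B 0)    ≈⟨ solve 4 (λ q i x b → q :* i :* (x :* b) := q :* b :* (x :* i)) refl Q X⁻¹ X (B 0) ⟩
      Q * B 0 * (X * X⁻¹)    ≈⟨ *-congˡ XX⁻¹ ⟩
      Q * B 0 * 1#           ≈⟨ *-identityʳ _ ⟩
      Q * B 0                ∎

    M≈ : ∀ m → M (suc m) ≈ Q * B (suc m)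
    M≈ m = trans
      (lim-unique (M-sum (suc m)) (sum-cong (λ n → *-congˡ (lim-unique (shifted-qProduct Q-lim (suc n)) (Qₙ-lim (suc n)))) refl (mSum (suc m))))
      (solve 4 (λ q b k h → q :* b :- q :* (con (0 , 0) :* k :* h) := q :* b) refl Q (B (suc m)) (fromℕ 0 ^ m) (b 0))

    exp≈ : ∀ m → Q * X⁻¹ * exp (egf≥1 K) m ≈ Q * B m * inv! m
    exp≈ m = begin
      Q * X⁻¹ * exp (egf≥1 K) m      ≈⟨ *-cong ratio≈ (exp-cong K≈ m) ⟩
      Q * B 0 * exp (K-series I) m   ≈⟨ trans (*-assoc _ _ _) (*-congˡ (sym (B≈exp I m))) ⟩
      Q * (B m * inv! m)             ≈⟨ sym (*-assoc _ _ _) ⟩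
      Q * B m * inv! m               ∎
      where
      K≈ : ∀ n → egf≥1 K n ≈ K-series I n
      K≈ zero    = refl
      K≈ (suc m) = *-congʳ (lim-unique (K-sum m) (kSum m))

    generating-function : ∀ m → Q * X⁻¹ * exp (egf≥1 K) m ≈ constant (Q * X⁻¹) m + egf≥1 M m
    generating-function zero    = trans (*-congˡ (exp-0 (egf≥1 K) refl)) (trans (*-identityʳ _) (sym (+-identityʳ _)))
    generating-function (suc m) = trans (exp≈ (suc m)) (trans (*-congʳ (sym (M≈ m))) (sym (+-identityˡ _)))

    bell-formula : ∀ m → 1 ℕ.≤ m → M m ≈ Q * X⁻¹ * bellPolynomial m (λ i → egf≥1 K (suc (toℕ i)))
    bell-formula (suc m) _ = sym (begin
      Q * X⁻¹ * bellPolynomial (suc m) (λ i → egf≥1 K (suc (toℕ i)))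
        ≈⟨ *-congˡ (bellPolynomial≈exp (suc m) (egf≥1 K) refl) ⟩
      Q * X⁻¹ * (fromℕ (suc m !) * exp (egf≥1 K) (suc m))
        ≈⟨ solve 3 (λ a n e → a :* (n :* e) := n :* (a :* e)) refl (Q * X⁻¹) (fromℕ (suc m !)) (exp (egf≥1 K) (suc m)) ⟩
      fromℕ (suc m !) * (Q * X⁻¹ * exp (egf≥1 K) (suc m))
        ≈⟨ *-congˡ (exp≈ (suc m)) ⟩
      fromℕ (suc m !) * (Q * B (suc m) * inv! (suc m))
        ≈⟨ solve 3 (λ n a i → n :* (a :* i) := a :* (n :* i)) refl (fromℕ (suc m !)) (Q * B (suc m)) (inv! (suc m)) ⟩
      Q * B (suc m) * (fromℕ (suc m !) * inv! (suc m))
        ≈⟨ trans (*-congˡ (factorial-inverse (suc m))) (*-identityʳ _) ⟩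
      Q * B (suc m)
        ≈⟨ sym (M≈ m) ⟩
      M (suc m) ∎)

-- The complex numbers as a complete normed ring.

module ComplexNumbers {a ℓ₁ ℓ₂} (ℝ : Reals a ℓ₁ ℓ₂) where
  open Complex ℝ using (ℂ; _+i_; re; im; ι; normSq; ∣_∣<_; NonZeroℂ; 1/ℕ; 1/_!)
  module R = OrderedFieldFacts (Reals.orderedField ℝ)
  open R using (Rate; solve; _:=_; _:+_; _:*_; _:-_; :-_; con)
  open Rate

  ℂ-ring : CommutativeRing a ℓ₁
  ℂ-ring = record
    { Carrier = ℂ
    ; _≈_ = Complex._≈_ ℝ
    ; _+_ = Complex._+_ ℝ
    ; _*_ = Complex._*_ ℝ
    ; -_ = Complex.-_ ℝ
    ; 0# = Complex.0# ℝ
    ; 1# = Complex.1# ℝ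
    ; isCommutativeRing = record
      { isRing = record
        { +-isAbelianGroup = record
          { isGroup = record
            { isMonoid = record
              { isSemigroup = record
                { isMagma = record
                  { isEquivalence = record
                    { refl = R.refl , R.refl
                    ; sym = λ (p , q) → R.sym p , R.sym q
                    ; trans = λ (p , q) (p′ , q′) → R.trans p p′ , R.trans q q′
                    }
                  ; ∙-cong = λ (p , q) (p′ , q′) → R.+-cong p p′ , R.+-cong q q′
                  }
                ; assoc = λ z w v → R.+-assoc _ _ _ , R.+-assoc _ _ _
                }
              ; identity = (λ z → R.+-identityˡ _ , R.+-identityˡ _) , (λ z → R.+-identityʳ _ , R.+-identityʳ _)
              }
            ; inverse = (λ z → R.-‿inverseˡ _ , R.-‿inverseˡ _) , (λ z → R.-‿inverseʳ _ , R.-‿inverseʳ _)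
            ; ⁻¹-cong = λ (p , q) → R.-‿cong p , R.-‿cong q
            }
          ; comm = λ z w → R.+-comm _ _ , R.+-comm _ _
          }
        ; *-cong = λ (p , q) (p′ , q′) → R.+-cong (R.*-cong p p′) (R.-‿cong (R.*-cong q q′)) , R.+-cong (R.*-cong p q′) (R.*-cong q p′)
        ; *-assoc = λ z w v →
            solve 6 (λ a b c d e f → (a :* c :- b :* d) :* e :- (a :* d :+ b :* c) :* f := a :* (c :* e :- d :* f) :- b :* (c :* f :+ d :* e))
              R.refl (re z) (im z) (re w) (im w) (re v) (im v) ,
            solve 6 (λ a b c d e f → (a :* c :- b :* d) :* f :+ (a :* d :+ b :* c) :* e := a :* (c :* f :+ d :* e) :+ b :* (c :* e :- d :* f))
              R.refl (re z) (im z) (re w) (im w) (re v) (im v)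
        ; *-identity = (λ z →
            solve 2 (λ a b → con (1 , 0) :* a :- con (0 , 0) :* b := a) R.refl (re z) (im z) ,
            solve 2 (λ a b → con (1 , 0) :* b :+ con (0 , 0) :* a := b) R.refl (re z) (im z)) , (λ z →
            solve 2 (λ a b → a :* con (1 , 0) :- b :* con (0 , 0) := a) R.refl (re z) (im z) ,
            solve 2 (λ a b → a :* con (0 , 0) :+ b :* con (1 , 0) := b) R.refl (re z) (im z))
        ; distrib = (λ z w v →
            solve 6 (λ a b c d e f → a :* (c :+ e) :- b :* (d :+ f) := (a :* c :- b :* d) :+ (a :* e :- b :* f)) R.refl (re z) (im z) (re w) (im w) (re v) (im v) ,
            solve 6 (λ a b c d e f → a :* (d :+ f) :+ b :* (c :+ e) := (a :* d :+ b :* c) :+ (a :* f :+ b :* e)) R.refl (re z) (im z) (re w) (im w) (re v) (im v)) , (λ v z w →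
            solve 6 (λ a b c d e f → (c :+ e) :* a :- (d :+ f) :* b := (c :* a :- d :* b) :+ (e :* a :- f :* b)) R.refl (re v) (im v) (re z) (im z) (re w) (im w) ,
            solve 6 (λ a b c d e f → (c :+ e) :* b :+ (d :+ f) :* a := (c :* b :+ d :* a) :+ (e :* b :+ f :* a)) R.refl (re v) (im v) (re z) (im z) (re w) (im w))
        }
      ; *-comm = λ z w →
          solve 4 (λ a b c d → a :* c :- b :* d := c :* a :- d :* b) R.refl (re z) (im z) (re w) (im w) ,
          solve 4 (λ a b c d → a :* d :+ b :* c := c :* b :+ d :* a) R.refl (re z) (im z) (re w) (im w)
      }
    }

  private module A = FiniteSums ℂ-ring
  open R.≤-Reasoning

  normSq-cong : ∀ {z w} → z A.≈ w → normSq z R.≈ normSq w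
  normSq-cong (p , q) = R.+-cong (R.*-cong p p) (R.*-cong q q)

  normSq-nonneg : ∀ z → R.0# R.≤ normSq z
  normSq-nonneg z = R.+-nonneg (R.square-nonneg (re z)) (R.square-nonneg (im z))

  normSq-* : ∀ z w → normSq (z A.* w) R.≈ normSq z R.* normSq w
  normSq-* z w = solve 4 (λ a b c d → (a :* c :- b :* d) :* (a :* c :- b :* d) :+ (a :* d :+ b :* c) :* (a :* d :+ b :* c)
    := (a :* a :+ b :* b) :* (c :* c :+ d :* d)) R.refl (re z) (im z) (re w) (im w)

  re²≤normSq : ∀ z → re z R.* re z R.≤ normSq z
  re²≤normSq z = R.x≤x+d (R.square-nonneg (im z)) R.refl

  im²≤normSq : ∀ z → im z R.* im z R.≤ normSq z
  im²≤normSq z = R.x≤x+d (R.square-nonneg (re z)) (R.+-comm _ _)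

  infix 4 _⊑_
  -- Nonnegativity is recorded because squaring forgets the sign of the bound.
  _⊑_ : ℂ → R.Carrier → Set ℓ₂
  z ⊑ x = R.0# R.≤ x × normSq z R.≤ x R.* x

  -- The Cauchy-Schwarz inequality, from Lagrange's identity: the defect is the square of
  -- `re z · im w - im z · re w`. The triangle inequality rests on it.
  inner-≤ : ∀ {z w x y} → z ⊑ x → w ⊑ y → re z R.* re w R.+ im z R.* im w R.≤ x R.* y
  inner-≤ {z} {w} {x} {y} (0≤x , z≤x) (0≤y , w≤y) = R.square-cancel-≤ (R.*-nonneg 0≤x 0≤y) (begin
    (re z R.* re w R.+ im z R.* im w) R.* (re z R.* re w R.+ im z R.* im w)
      ≤⟨ R.x≤x+d (R.square-nonneg (re z R.* im w R.- im z R.* re w))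
           (solve 4 (λ a b c d → (a :* a :+ b :* b) :* (c :* c :+ d :* d) := (a :* c :+ b :* d) :* (a :* c :+ b :* d) :+ (a :* d :- b :* c) :* (a :* d :- b :* c)) R.refl (re z) (im z) (re w) (im w)) ⟩
    normSq z R.* normSq w     ≤⟨ R.*-mono-≤ (normSq-nonneg z) (normSq-nonneg w) z≤x w≤y ⟩
    x R.* x R.* (y R.* y)     ≈⟨ solve 2 (λ x y → x :* x :* (y :* y) := x :* y :* (x :* y)) R.refl x y ⟩
    x R.* y R.* (x R.* y)     ∎)

  ⊑-+ : ∀ {z w x y} → z ⊑ x → w ⊑ y → z A.+ w ⊑ x R.+ y
  ⊑-+ {z} {w} {x} {y} z⊑x@(0≤x , z≤x) w⊑y@(0≤y , w≤y) = R.+-nonneg 0≤x 0≤y , (begin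
    normSq (z A.+ w)
      ≈⟨ solve 4 (λ a b c d → (a :+ c) :* (a :+ c) :+ (b :+ d) :* (b :+ d)
           := (a :* a :+ b :* b) :+ (c :* c :+ d :* d) :+ ((a :* c :+ b :* d) :+ (a :* c :+ b :* d))) R.refl (re z) (im z) (re w) (im w) ⟩
    normSq z R.+ normSq w R.+ (i R.+ i)
      ≤⟨ R.+-mono-≤ (R.+-mono-≤ z≤x w≤y) (R.+-mono-≤ i≤xy i≤xy) ⟩
    x R.* x R.+ y R.* y R.+ (x R.* y R.+ x R.* y)
      ≈⟨ solve 2 (λ x y → x :* x :+ y :* y :+ (x :* y :+ x :* y) := (x :+ y) :* (x :+ y)) R.refl x y ⟩
    (x R.+ y) R.* (x R.+ y) ∎)
    where
    i : R.Carrier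
    i = re z R.* re w R.+ im z R.* im w
    i≤xy : i R.≤ x R.* y
    i≤xy = inner-≤ z⊑x w⊑y

  square-≤ : ∀ {x e} → x R.≤ e → R.- x R.≤ e → x R.* x R.≤ e R.* e
  square-≤ {x} {e} x≤e -x≤e = R.x≤x+d (R.*-nonneg (R.x≤y⇒0≤y-x x≤e) (R.x≤y⇒0≤y-x -x≤e))
    (solve 2 (λ x e → e :* e := x :* x :+ (e :- x) :* (e :- :- x)) R.refl x e)

  neg-square : ∀ x → R.- x R.* R.- x R.≈ x R.* x
  neg-square x = solve 1 (λ x → :- x :* :- x := x :* x) R.refl x

  small-real : ∀ {x} → (∀ ε → R.0# R.< ε → x R.* x R.≤ ε R.* ε) → x R.≈ R.0#
  small-real {x} small = R.≤-antisym (upper small)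
    (R.≤-trans (R.x≤y⇒0≤y-x (upper λ ε 0<ε → R.≤-trans (R.≤-reflexive (neg-square x)) (small ε 0<ε)))
      (R.≤-reflexive (solve 1 (λ x → con (0 , 0) :- :- x := x) R.refl x)))
    where
    upper : ∀ {x} → (∀ ε → R.0# R.< ε → x R.* x R.≤ ε R.* ε) → x R.≤ R.0#
    upper small = R.≤-squeeze λ ε 0<ε → R.≤-trans (R.square-cancel-≤ (R.<⇒≤ 0<ε) (small ε 0<ε)) (R.≤-reflexive (R.sym (R.+-identityˡ ε)))

  complete : (s : ℕ → ℂ) →
      (∀ ε → R.0# R.< ε → ∃[ N ] (∀ m n → N ℕ.≤ m → N ℕ.≤ n → s m A.- s n ⊑ ε)) →
      ∃[ l ] (∀ ε → R.0# R.< ε → ∃[ N ] (∀ n → N ℕ.≤ n → s n A.- l ⊑ ε))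
  complete s cauchy = (proj₁ re-limit +i proj₁ im-limit) , close
    where
    component : (f : ℂ → R.Carrier) → (∀ z → f z R.* f z R.≤ normSq z) → (∀ z w → f (z A.- w) R.≈ f z R.- f w) → Reals.Cauchy ℝ (λ n → f (s n))
    -- Halving ε turns the weak bound given by `_⊑_` into the strict one that `Cauchy` demands.
    component f f≤norm f-sub ε 0<ε = let N , near = cauchy (ε R.* R.½) (R.0<x*½ 0<ε) in N , λ m n N≤m N≤n →
      R.≤-<-trans (R.≤-trans (R.≤-reflexive (R.sym (f-sub (s m) (s n))))
        (R.square-cancel-≤ (proj₁ (near m n N≤m N≤n)) (R.≤-trans (f≤norm (s m A.- s n)) (proj₂ (near m n N≤m N≤n)))))
        (R.x*½<x 0<ε)
    re-limit : ∃[ l ] Reals._⟶_ ℝ (λ n → re (s n)) l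
    re-limit = Reals.complete ℝ _ (component re re²≤normSq (λ _ _ → R.refl))
    im-limit : ∃[ l ] Reals._⟶_ ℝ (λ n → im (s n)) l
    im-limit = Reals.complete ℝ _ (component im im²≤normSq (λ _ _ → R.refl))
    swap : ∀ x y → R.- (x R.- y) R.≈ y R.- x
    swap x y = solve 2 (λ x y → :- (x :- y) := y :- x) R.refl x y
    close : ∀ ε → R.0# R.< ε → ∃[ N ] (∀ n → N ℕ.≤ n → s n A.- (proj₁ re-limit +i proj₁ im-limit) ⊑ ε)
    close ε 0<ε =
      let N₁ , near₁ = proj₂ re-limit (ε R.* R.½) (R.0<x*½ 0<ε)
          N₂ , near₂ = proj₂ im-limit (ε R.* R.½) (R.0<x*½ 0<ε)
      in N₁ ℕ.+ N₂ , λ n N≤n →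
        let lt₁ , gt₁ = near₁ n (ℕₚ.≤-trans (ℕₚ.m≤m+n N₁ N₂) N≤n)
            lt₂ , gt₂ = near₂ n (ℕₚ.≤-trans (ℕₚ.m≤n+m N₂ N₁) N≤n)
        in R.<⇒≤ 0<ε , R.≤-trans
          (R.+-mono-≤ (square-≤ (R.<⇒≤ lt₁) (R.≤-trans (R.≤-reflexive (swap _ _)) (R.<⇒≤ gt₁)))
                      (square-≤ (R.<⇒≤ lt₂) (R.≤-trans (R.≤-reflexive (swap _ _)) (R.<⇒≤ gt₂))))
          halved
      where
      η : R.Carrier
      -- Each component is kept within ε/2, since 2η² = εη ≤ ε².
      η = ε R.* R.½
      halved : η R.* η R.+ η R.* η R.≤ ε R.* ε
      halved = begin
        η R.* η R.+ η R.* η         ≈⟨ R.trans (R.sym (R.distribʳ η η η)) (R.*-congʳ (R.halves ε)) ⟩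
        ε R.* η                     ≤⟨ R.*-monoʳ-≤ ε (R.<⇒≤ 0<ε) (R.<⇒≤ (R.x*½<x 0<ε)) ⟩
        ε R.* ε                     ∎

  norm : Norm (Reals.orderedField ℝ) ℂ-ring
  norm = record
    { _⊑_ = _⊑_
    ; archimedean = Reals.archimedean ℝ
    ; ⊑-resp = λ z≈w x≤y (0≤x , z≤x) → R.≤-trans 0≤x x≤y ,
        R.≤-trans (R.≤-reflexive (R.sym (normSq-cong z≈w))) (R.≤-trans z≤x (R.*-mono-≤ 0≤x 0≤x x≤y x≤y))
    ; ⊑⇒nonneg = proj₁
    ; ⊑-0 = R.≤-refl , R.≤-reflexive (solve 0 (con (0 , 0) :* con (0 , 0) :+ con (0 , 0) :* con (0 , 0) := con (0 , 0) :* con (0 , 0)) R.refl)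
    ; ⊑-1 = R.0≤1 , R.≤-reflexive (solve 0 (con (1 , 0) :* con (1 , 0) :+ con (0 , 0) :* con (0 , 0) := con (1 , 0) :* con (1 , 0)) R.refl)
    ; ⊑-neg = λ (0≤x , z≤x) → 0≤x , R.≤-trans (R.≤-reflexive (R.+-cong (neg-square _) (neg-square _))) z≤x
    ; ⊑-+ = ⊑-+
    ; ⊑-* = λ {z} {w} {x} {y} (0≤x , z≤x) (0≤y , w≤y) → R.*-nonneg 0≤x 0≤y ,
        R.≤-trans (R.≤-reflexive (normSq-* z w)) (R.≤-trans (R.*-mono-≤ (normSq-nonneg z) (normSq-nonneg w) z≤x w≤y)
          (R.≤-reflexive (solve 2 (λ x y → x :* x :* (y :* y) := x :* y :* (x :* y)) R.refl x y)))
    ; bounded = λ z → R.1# R.+ normSq z , R.+-nonneg R.0≤1 (normSq-nonneg z) ,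
        R.x≤x+d (R.+-nonneg (R.+-nonneg R.0≤1 (normSq-nonneg z)) (R.square-nonneg (normSq z)))
          (solve 1 (λ n → (con (1 , 0) :+ n) :* (con (1 , 0) :+ n) := n :+ (con (1 , 0) :+ n :+ n :* n)) R.refl (normSq z))
    ; separated = λ {z} small →
        small-real (λ ε 0<ε → R.≤-trans (re²≤normSq z) (proj₂ (small ε 0<ε))) ,
        small-real (λ ε 0<ε → R.≤-trans (im²≤normSq z) (proj₂ (small ε 0<ε)))
    ; complete = complete
    }

  -- The witness is (1 + ∣z∣²)/2, which is at least ∣z∣ since its square exceeds ∣z∣² by ((1 - ∣z∣²)/2)².
  rate-of : ∀ {z} → ∣ z ∣< R.1# → ∃[ s ] z ⊑ rate s
  rate-of {z} z<1 = s , nonneg s , R.x≤x+d (R.square-nonneg g) (begin-equality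
      (R.1# R.- g) R.* (R.1# R.- g)                  ≈⟨ solve 1 (λ g → (con (1 , 0) :- g) :* (con (1 , 0) :- g) := con (1 , 0) :- (g :+ g) :+ g :* g) R.refl g ⟩
      R.1# R.- (g R.+ g) R.+ g R.* g                 ≈⟨ R.+-congʳ (R.+-congˡ (R.-‿cong (R.halves _))) ⟩
      R.1# R.- (R.1# R.- normSq z) R.+ g R.* g       ≈⟨ R.+-congʳ (solve 1 (λ n → con (1 , 0) :- (con (1 , 0) :- n) := n) R.refl (normSq z)) ⟩
      normSq z R.+ g R.* g                           ∎)
    where
    N<1 : normSq z R.< R.1#
    N<1 = R.<-respʳ-≈ (R.*-identityʳ R.1#) z<1
    g : R.Carrier
    g = (R.1# R.- normSq z) R.* R.½
    0<g : R.0# R.< g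
    0<g = R.0<x*½ (R.x<y⇒0<y-x N<1)
    s : Rate
    s = record
      { rate = R.1# R.- g
      ; positive = begin-strict
          R.0#                             <⟨ R.0<½ ⟩
          R.½                              ≤⟨ R.x≤x+d (R.*-nonneg (normSq-nonneg z) (R.<⇒≤ R.0<½)) R.refl ⟩
          R.½ R.+ normSq z R.* R.½         ≈⟨ solve 2 (λ h n → h :+ n :* h := (con (1 , 0) :* h :+ con (1 , 0) :* h) :- (con (1 , 0) :- n) :* h) R.refl R.½ (normSq z) ⟩
          R.1# R.* R.½ R.+ R.1# R.* R.½ R.- g ≈⟨ R.+-congʳ (R.halves R.1#) ⟩
          R.1# R.- g                       ∎
      ; below-1 = R.x<x+d 0<g (solve 1 (λ g → con (1 , 0) := con (1 , 0) :- g :+ g) R.refl g)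
      }

  -- Multiplicativity makes `normSq z` invertible, hence apart from zero; being nonnegative it must
  -- lie on the positive side. This turns a known inverse into the strict inequality behind
  -- `NonZeroℂ`.
  x*y≈1⇒nonzero : ∀ {z w} → z A.* w A.≈ A.1# → NonZeroℂ z
  x*y≈1⇒nonzero {z} {w} zw≈1 = positive-part (Equivalence.to R.#⇔<> (R.x*y≈1⇒x#0 product))
    where
    product : normSq z R.* normSq w R.≈ R.1#
    product = R.trans (R.sym (normSq-* z w)) (R.trans (normSq-cong zw≈1)
      (solve 0 (con (1 , 0) :* con (1 , 0) :+ con (0 , 0) :* con (0 , 0) := con (1 , 0)) R.refl))
    positive-part : normSq z R.< R.0# ⊎ R.0# R.< normSq z → R.0# R.< normSq z
    positive-part (inj₁ n<0) = ⊥-elim (normSq-nonneg z n<0)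
    positive-part (inj₂ 0<n) = 0<n

  inverse : ∀ w → NonZeroℂ w → ℂ
  inverse w w≠0 = (re w R.* R.recip (normSq w) w≠0) +i (R.- (im w R.* R.recip (normSq w) w≠0))

  *-inverse : ∀ w w≠0 → w A.* inverse w w≠0 A.≈ A.1#
  *-inverse w w≠0 =
    R.trans (solve 3 (λ a b r → a :* (a :* r) :- b :* (:- (b :* r)) := (a :* a :+ b :* b) :* r) R.refl (re w) (im w) _) (R.recip-inverseʳ (normSq w) w≠0) ,
    solve 3 (λ a b r → a :* (:- (b :* r)) :+ b :* (a :* r) := con (0 , 0)) R.refl (re w) (im w) _

  fromℕ-ι : ∀ n → A.fromℕ n A.≈ ι (R.fromℕ n)
  fromℕ-ι zero    = R.refl , R.refl
  fromℕ-ι (suc n) = R.+-congˡ (proj₁ (fromℕ-ι n)) , R.trans (R.+-congˡ (proj₂ (fromℕ-ι n))) (R.+-identityʳ R.0#)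

  *-1/ℕ : ∀ n .{{_ : NonZero n}} → ι (R.fromℕ n) A.* 1/ℕ n A.≈ A.1#
  *-1/ℕ (suc n) =
    R.trans (solve 2 (λ a r → a :* r :- con (0 , 0) :* con (0 , 0) := a :* r) R.refl _ _) (R.recip-inverseʳ _ _) ,
    solve 2 (λ a r → a :* con (0 , 0) :+ con (0 , 0) :* r := con (0 , 0)) R.refl (R.fromℕ (suc n)) (R.recip (R.fromℕ (suc n)) (R.fromℕ-pos n))

  inverseFactorials : InverseFactorials ℂ-ring
  inverseFactorials = record
    { inv! = 1/_!
    ; factorial-inverse = λ n → A.trans (A.*-congʳ {1/ n !} {A.fromℕ (n !)} {ι (R.fromℕ (n !))} (fromℕ-ι (n !))) (*-1/ℕ (n !) {{n ℕₚ.!≢0}})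
    }

-- Agreement of the concrete complex definitions with the abstract ones.

module Translation {a ℓ₁ ℓ₂} (ℝ : Reals a ℓ₁ ℓ₂) where
  open ComplexNumbers ℝ
  module C = Complex ℝ
  open Series (Reals.orderedField ℝ) ℂ-ring norm hiding (module R; complete; _⊑_; ⊑-+)
  open ExponentialFormula ℂ-ring inverseFactorials
  open BellSums ℂ-ring inverseFactorials
  open ListSums ℂ-ring

  Σ<-≡ : ∀ N f → C.Σ< N f ≡ Σ< N f
  Σ<-≡ zero    f = ≡.refl
  Σ<-≡ (suc N) f = ≡.cong (C._+ f N) (Σ<-≡ N f)

  Π<-≡ : ∀ N f → C.Π< N f ≡ Π< N f
  Π<-≡ zero    f = ≡.refl
  Π<-≡ (suc N) f = ≡.cong (C._* f N) (Π<-≡ N f)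

  ⟶⇒Lim : ∀ {s t l} → (∀ n → s n ≈ t n) → s C.⟶ l → Lim t l
  ⟶⇒Lim {s} {t} {l} s≈t s⟶l = lim-cong {s} {t} {l} {l} s≈t (refl {l}) λ ε 0<ε →
    let N , near = s⟶l ε 0<ε in N , λ n N≤n → R.<⇒≤ 0<ε , R.<⇒≤ (near n N≤n)

  -- The target bound is strict while `Lim` is weak, so the limit is invoked at ε/2, and (ε/2)² <
  -- ε².
  Lim⇒⟶ : ∀ {s t l} → (∀ n → t n ≈ s n) → Lim t l → s C.⟶ l
  Lim⇒⟶ {s} {t} {l} t≈s lim ε 0<ε =
    let N , near = lim-cong {t} {s} {l} {l} t≈s (refl {l}) lim (ε R.* R.½) (R.0<x*½ 0<ε) in N , λ n N≤n →
      R.≤-<-trans (proj₂ (near n N≤n))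
        (R.≤-<-trans (R.*-monoʳ-≤ (ε R.* R.½) (R.<⇒≤ (R.0<x*½ 0<ε)) (R.<⇒≤ (R.x*½<x 0<ε))) (R.*-monoˡ-< ε 0<ε (R.x*½<x 0<ε)))

  Sum≥1⇒Sum : ∀ {f g : ℕ → Carrier} {l} → (∀ n → f (suc n) ≈ g (suc n)) → C.Sum≥1 f l → Sum (λ n → g (suc n)) l
  Sum≥1⇒Sum {f} {g} {l} f≈g = ⟶⇒Lim {λ N → C.Σ< N (λ n → f (suc n))} {λ N → Σ< N (λ n → g (suc n))} {l} λ N →
    trans (≡⇒≈ (Σ<-≡ N (λ n → f (suc n)))) (Σ<-cong N {λ n → f (suc n)} {λ n → g (suc n)} f≈g)

  Sum⇒Sum≥1 : ∀ {f g : ℕ → Carrier} {l} → (∀ n → g (suc n) ≈ f (suc n)) → Sum (λ n → g (suc n)) l → C.Sum≥1 f l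
  Sum⇒Sum≥1 {f} {g} {l} g≈f = Lim⇒⟶ {λ N → C.Σ< N (λ n → f (suc n))} {λ N → Σ< N (λ n → g (suc n))} {l} λ N →
    trans (Σ<-cong N {λ n → g (suc n)} {λ n → f (suc n)} g≈f) (sym (≡⇒≈ (Σ<-≡ N (λ n → f (suc n)))))

  constant-≡ : ∀ z n → C.constant z n ≡ constant z n
  constant-≡ z zero    = ≡.refl
  constant-≡ z (suc n) = ≡.refl

  egf-≡ : ∀ u n → C.egf≥1 u n ≡ egf≥1 u n
  egf-≡ u zero    = ≡.refl
  egf-≡ u (suc n) = ≡.refl

  ⊛-≈ : ∀ {f f′ g g′} → (∀ n → f n ≈ f′ n) → (∀ n → g n ≈ g′ n) → ∀ n → (f C.⊛ g) n ≈ (f′ ⊛ g′) n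
  ⊛-≈ {f} {f′} {g} {g′} f≈f′ g≈g′ n = trans (≡⇒≈ (Σ<-≡ (suc n) (λ i → f i C.* g (n ℕ.∸ i))))
    (trans (diag≈Σ< n (λ i j → f i C.* g j)) (⊛-cong n {f} {f′} {g} {g′} f≈f′ g≈g′))

  power-≈ : ∀ {f g} → (∀ n → f n ≈ g n) → ∀ k n → C.power f k n ≈ power g k n
  power-≈ f≈g zero    n = ≡⇒≈ (constant-≡ 1# n)
  power-≈ {f} {g} f≈g (suc k) n = ⊛-≈ {f} {g} {C.power f k} {power g k} f≈g (power-≈ {f} {g} f≈g k) n

  exp-≈ : ∀ {f g} → (∀ n → f n ≈ g n) → ∀ n → C.exp f n ≈ exp g n
  exp-≈ {f} {g} f≈g n = trans (≡⇒≈ (Σ<-≡ (suc n) (λ k → C.power f k n C.* C.1/ k !)))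
    (Σ<-cong (suc n) {λ k → C.power f k n C.* C.1/ k !} {λ k → power g k n C.* C.1/ k !}
      λ k → *-congʳ {C.1/ k !} {C.power f k n} {power g k n} (power-≈ {f} {g} f≈g k n))

  boundedTuples-≡ : ∀ m b → C.boundedTuples m b ≡ boundedTuples m b
  boundedTuples-≡ zero    b = ≡.refl
  boundedTuples-≡ (suc m) b = ≡.cong (cartesianProductWith Vector._∷_ (upTo (suc b))) (boundedTuples-≡ m b)

  -- The arguments u_i / i! are definitionally the coefficients of `egf≥1 u`. What remains is to
  -- identify the two images of m! and the two copies of the list of tuples.
  Y-≈ : ∀ m u → C.Y m (λ i → u (suc (toℕ i))) ≈ bellPolynomial m (λ i → egf≥1 u (suc (toℕ i)))
  Y-≈ m u = trans {C.Y m (λ i → u (suc (toℕ i)))} {Σ∈ (C.bellTuples m) term} {bellPolynomial m (λ i → egf≥1 u (suc (toℕ i)))}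
    (Σ∈-cong (C.bellTuples m) {g = term} λ k →
      *-congʳ {C.product (λ i → (u (suc (toℕ i)) C.* C.1/ suc (toℕ i) !) C.^ k i)} {C.fromℕ (m !) C.* C.product (λ i → C.1/ k i !)} {fromℕ (m !) C.* C.product (λ i → C.1/ k i !)}
        (*-congʳ {C.product (λ i → C.1/ k i !)} {C.fromℕ (m !)} {fromℕ (m !)} (sym {fromℕ (m !)} (fromℕ-ι (m !)))))
    (≡⇒≈ (≡.cong (λ ks → Σ∈ (List.filter (λ k → weight (λ i → suc (toℕ i)) k ℕₚ.≟ m) ks) term) (boundedTuples-≡ m m)))
    where
    term : Vector ℕ m → Carrier
    term k = fromℕ (m !) C.* C.product (λ i → C.1/ k i !) C.* C.product (λ i → (u (suc (toℕ i)) C.* C.1/ suc (toℕ i) !) C.^ k i)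

-- Existence of the values and both identities over the complex numbers.

module MainTheorem {a ℓ₁ ℓ₂} (ℝ : Reals a ℓ₁ ℓ₂) (q c : Complex.ℂ ℝ)
  (s : OrderedFieldFacts.Rate (Reals.orderedField ℝ)) (q⊑s : Norm._⊑_ (ComplexNumbers.norm ℝ) q (OrderedFieldFacts.Rate.rate s))
  (t : OrderedFieldFacts.Rate (Reals.orderedField ℝ)) (cq⊑t : Norm._⊑_ (ComplexNumbers.norm ℝ) (Complex._*_ ℝ c q) (OrderedFieldFacts.Rate.rate t)) where
  open ComplexNumbers ℝ
  open Translation ℝ
  open Moments (Reals.orderedField ℝ) ℂ-ring norm q s q⊑s c t cq⊑t hiding (module R; complete; _⊑_; ⊑-+)
  open Identities (Reals.orderedField ℝ) ℂ-ring norm inverseFactorials q s q⊑s c t cq⊑t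
  open ExponentialFormula ℂ-ring inverseFactorials using (egf≥1; exp; constant; constant-⊛)
  open BellSums ℂ-ring inverseFactorials using (bellPolynomial)
  open ListSums ℂ-ring

  qProduct-≡ : ∀ x N → C.Π< N (λ j → C.1# C.- x C.* q C.^ j) ≈ qProduct x N
  qProduct-≡ x N = ≡⇒≈ (Π<-≡ N (λ j → C.1# C.- x C.* q C.^ j))

  Lim⇒Pochhammer : ∀ {x l} → Lim (qProduct x) l → C.Pochhammer∞ x q l
  Lim⇒Pochhammer {x} {l} = Lim⇒⟶ {λ N → C.Π< N (λ j → C.1# C.- x C.* q C.^ j)} {qProduct x} {l} λ N → sym (qProduct-≡ x N)

  Pochhammer⇒Lim : ∀ {x l} → C.Pochhammer∞ x q l → Lim (qProduct x) l
  Pochhammer⇒Lim {x} {l} = ⟶⇒Lim {λ N → C.Π< N (λ j → C.1# C.- x C.* q C.^ j)} {qProduct x} {l} (qProduct-≡ x)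

  m-term : (ℕ → Carrier) → ℕ → ℕ → Carrier
  m-term Qₙ m n = C.fromℕ (n ℕ.^ m) C.* c C.^ n C.* q C.^ n C.* Qₙ n

  m-term-≈ : ∀ Qₙ m n → m-term Qₙ m n ≈ mTerm Qₙ m n
  m-term-≈ Qₙ m n = *-congʳ {Qₙ n} {C.fromℕ (n ℕ.^ m) C.* c C.^ n C.* q C.^ n} {fromℕ (n ℕ.^ m) C.* c C.^ n C.* q C.^ n}
    (*-congʳ {q C.^ n} {C.fromℕ (n ℕ.^ m) C.* c C.^ n} {fromℕ (n ℕ.^ m) C.* c C.^ n}
      (*-congʳ {c C.^ n} {C.fromℕ (n ℕ.^ m)} {fromℕ (n ℕ.^ m)} (sym {fromℕ (n ℕ.^ m)} (fromℕ-ι (n ℕ.^ m)))))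

  k-term-≈ : ∀ m n → C.σ m c n C.* q C.^ n ≈ kTerm m n
  k-term-≈ m n = *-congʳ {q C.^ n} {C.σ m c n} {Σ∈ (C.divisors n) term} (Σ∈-cong (C.divisors n) {g = term} λ d →
    *-congʳ {c C.^ d} {C.fromℕ (d ℕ.^ m)} {fromℕ (d ℕ.^ m)} (sym {fromℕ (d ℕ.^ m)} (fromℕ-ι (d ℕ.^ m))))
    where
    term : ℕ → Carrier
    term d = fromℕ (d ℕ.^ m) C.* c C.^ d

  Q X : Carrier
  Q = proj₁ (qProduct-converges q)
  X = proj₁ (qProduct-converges (c C.* q))

  Q-limit : Lim (qProduct q) Q
  Q-limit = proj₂ (qProduct-converges q)

  X-limit : Lim (qProduct (c C.* q)) X
  X-limit = proj₂ (qProduct-converges (c C.* q))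

  canonicalM canonicalK : ℕ → Carrier
  canonicalM m = Q C.* B m C.- Q C.* (fromℕ 0 C.^ m C.* b 0)
  canonicalK zero    = C.0#
  canonicalK (suc m) = P m

  M-values : ∀ m → C.Sum≥1 (m-term (λ n → Q C.* h n) m) (canonicalM m)
  M-values m = Sum⇒Sum≥1 {m-term (λ n → Q C.* h n) m} {mTerm (λ n → Q C.* h n) m} {canonicalM m}
        (λ n → sym {m-term (λ n → Q C.* h n) m (suc n)} {mTerm (λ n → Q C.* h n) m (suc n)} (m-term-≈ (λ n → Q C.* h n) m (suc n))) (mSum {Q} m)

  K-values : ∀ m → C.Sum≥1 (λ n → C.σ m c n C.* q C.^ n) (P m)
  K-values m = Sum⇒Sum≥1 {λ n → C.σ m c n C.* q C.^ n} {kTerm m} {P m} (λ n → sym (k-term-≈ m (suc n))) (kSum m)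

  X-nonzero : C.NonZeroℂ X
  X-nonzero = x*y≈1⇒nonzero {X} {B 0} (euler-B {X} X-limit)

  values : C.Values q c
  values = record
    { [q]∞ = Q
    ; [cq]∞ = X
    ; [q^1+_]∞ = λ n → Q C.* h n
    ; M = canonicalM
    ; K = canonicalK
    ; [q]∞-value = Lim⇒Pochhammer {q} {Q} Q-limit
    ; [cq]∞-value = Lim⇒Pochhammer {c C.* q} {X} X-limit
    ; [cq]∞-nonzero = X-nonzero
    ; [q^1+]∞-value = λ n → Lim⇒Pochhammer {q C.^ suc n} {Q C.* h n} (shifted-qProduct {Q} Q-limit n)
    ; M-value = M-values
    ; K-value = K-values
    }

  module _ (v : C.Values q c) where
    open C.Values v
    private
      Q-lim : Lim (qProduct q) [q]∞
      Q-lim = Pochhammer⇒Lim [q]∞-value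
      X-lim : Lim (qProduct (c C.* q)) [cq]∞
      X-lim = Pochhammer⇒Lim [cq]∞-value
      Qₙ-lim : ∀ n → Lim (qProduct (q C.^ suc n)) [q^1+ n ]∞
      Qₙ-lim n = Pochhammer⇒Lim ([q^1+]∞-value n)
      M-sum : ∀ m → Sum (λ n → mTerm [q^1+_]∞ m (suc n)) (M m)
      M-sum m = Sum≥1⇒Sum {m-term [q^1+_]∞ m} {mTerm [q^1+_]∞ m} (λ n → m-term-≈ [q^1+_]∞ m (suc n)) (M-value m)
      K-sum : ∀ m → Sum (λ n → kTerm m (suc n)) (K (suc m))
      K-sum m = Sum≥1⇒Sum {λ n → C.σ m c n C.* q C.^ n} {kTerm m} (λ n → k-term-≈ m (suc n)) (K-value m)

    identity-of-series : C.constant ratio C.⊛ C.exp (C.egf≥1 K) C.≋ C.constant ratio C.⊕ C.egf≥1 M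
    identity-of-series n = trans {(C.constant ratio C.⊛ C.exp (C.egf≥1 K)) n} {(constant ratio ⊛ exp (egf≥1 K)) n} {C.constant ratio n C.+ C.egf≥1 M n}
      (⊛-≈ {C.constant ratio} {constant ratio} {C.exp (C.egf≥1 K)} {exp (egf≥1 K)} (λ n → ≡⇒≈ (constant-≡ ratio n)) (exp-≈ {C.egf≥1 K} {egf≥1 K} λ n → ≡⇒≈ (egf-≡ K n)) n)
      (trans {(constant ratio ⊛ exp (egf≥1 K)) n} {ratio C.* exp (egf≥1 K) n} {C.constant ratio n C.+ C.egf≥1 M n} (constant-⊛ ratio (exp (egf≥1 K)) n)
        (trans {ratio C.* exp (egf≥1 K) n} {constant ratio n C.+ egf≥1 M n} {C.constant ratio n C.+ C.egf≥1 M n}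
          (generating-function {Q = [q]∞} {[cq]∞} {inverse [cq]∞ [cq]∞-nonzero} {[q^1+_]∞} {M} {K} Q-lim X-lim (*-inverse [cq]∞ [cq]∞-nonzero) Qₙ-lim M-sum K-sum n)
          (sym (≡⇒≈ (≡.cong₂ C._+_ (constant-≡ ratio n) (egf-≡ M n))))))

    bell-identity : ∀ m → 1 ℕ.≤ m → M m C.≈ ratio C.* C.Y m (λ i → K (suc (toℕ i)))
    bell-identity m 1≤m = trans {M m} {ratio C.* bellPolynomial m (λ i → egf≥1 K (suc (toℕ i)))} {ratio C.* C.Y m (λ i → K (suc (toℕ i)))}
      (bell-formula {Q = [q]∞} {[cq]∞} {inverse [cq]∞ [cq]∞-nonzero} {[q^1+_]∞} {M} {K} Q-lim X-lim (*-inverse [cq]∞ [cq]∞-nonzero) Qₙ-lim M-sum K-sum m 1≤m)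
      (*-congˡ {ratio} {bellPolynomial m (λ i → egf≥1 K (suc (toℕ i)))} {C.Y m (λ i → K (suc (toℕ i)))}
        (sym {C.Y m (λ i → K (suc (toℕ i)))} {bellPolynomial m (λ i → egf≥1 K (suc (toℕ i)))} (Y-≈ m K)))

open import Data.Nat.Base using (_≤_)

theorem2p2 : ∀ {a ℓ₁ ℓ₂} (ℝ : Reals a ℓ₁ ℓ₂) → let open Complex ℝ in
    (q c : ℂ) → ∣ q ∣< Reals.1# ℝ → ∣ c * q ∣< Reals.1# ℝ →
    Values q c ×
    ((v : Values q c) → let open Values v in
    (constant ratio ⊛ exp (egf≥1 K) ≋ constant ratio ⊕ egf≥1 M) ×
    (∀ m → 1 ≤ m → M m ≈ ratio * Y m (λ i → K (suc (toℕ i)))))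
theorem2p2 ℝ q c ∣q∣<1 ∣cq∣<1 = values , λ v → identity-of-series v , bell-identity v
  where
  open MainTheorem ℝ q c
    (proj₁ (ComplexNumbers.rate-of ℝ {q} ∣q∣<1)) (proj₂ (ComplexNumbers.rate-of ℝ {q} ∣q∣<1))
    (proj₁ (ComplexNumbers.rate-of ℝ {Complex._*_ ℝ c q} ∣cq∣<1)) (proj₂ (ComplexNumbers.rate-of ℝ {Complex._*_ ℝ c q} ∣cq∣<1))
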